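{- Let $n$ and $b$ be nonnegative integers with $0.2495\,n \leq b < n/4$. Then every graph on $n$ vertices with at least $n^2/4$ edges and book number at most $b$ which is not the balanced complete bipartite graph has at least $b^2(n-4b)$ triangles, with equality if and only if the graph is (isomorphic to) $S_{b,n}$.
   Context: A book in a graph is a collection of triangles sharing a common edge; its size is the number of such triangles. The book number $b(G)$ of a graph $G$ is the size of the largest book in $G$, i.e. the maximum over edges $uv$ of the number of common neighbours of $u$ and $v$. The balanced complete bipartite graph on $n$ vertices is the complete bipartite graph with parts of sizes $\lfloor n/2\rfloor$ and $\lceil n/2\rceil$. For nonnegative integers $b \le n/4$, $S_{b,n}$ is the graph on $n$ vertices whose vertex set is partitioned into six parts $U_1,U_2,U_3,V_1,V_2,V_3$ with $|U_1|=|U_2|=|V_1|=|V_2|=b$, $|U_3|=\lfloor (n-4b)/2\rfloor$, $|V_3|=\lceil (n-4b)/2\rceil$, where $U_i$ is complete to $U_j$ for $i\neq j$, $V_i$ is complete to $V_j$ for $i \neq j$, $U_i$ is complete to $V_i$ for each $i$, and there are no other edges (a blow-up of the $3$-prism, i.e. two disjoint triangles joined by a perfect matching). It has $\lfloor n^2/4\rfloor$ edges and $b^2(n-4b)$ triangles. -}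

module Defs where

open import Data.Nat using (ℕ; zero; suc; _+_; _*_; _∸_; _⊔_; _<ᵇ_; _≡ᵇ_; _/_)
open import Data.Bool using (Bool; true; false; _∧_; _xor_; not; if_then_else_)
open import Data.Fin using (Fin; zero; suc; toℕ)
open import Data.Fin.Permutation using (Permutation′; _⟨$⟩ʳ_)
open import Relation.Binary.PropositionalEquality using (_≡_)
open import Data.Product using (Σ)

record Graph (n : ℕ) : Set where
  field
    adj    : Fin n → Fin n → Bool
    sym    : ∀ i j → adj i j ≡ adj j i
    irrefl : ∀ i → adj i i ≡ false
open Graph public

sumF : ∀ {n} → (Fin n → ℕ) → ℕ
sumF {zero}  f = 0
sumF {suc n} f = f zero + sumF (λ i → f (suc i))

maxF : ∀ {n} → (Fin n → ℕ) → ℕ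
maxF {zero}  f = 0
maxF {suc n} f = f zero ⊔ maxF (λ i → f (suc i))

ind : Bool → ℕ
ind true  = 1
ind false = 0

edgeCount : ∀ {n} → Graph n → ℕ
edgeCount G = sumF λ i → sumF λ j → ind ((toℕ i <ᵇ toℕ j) ∧ adj G i j)

triangleCount : ∀ {n} → Graph n → ℕ
triangleCount G = sumF λ i → sumF λ j → sumF λ k →
  ind ((toℕ i <ᵇ toℕ j) ∧ (toℕ j <ᵇ toℕ k) ∧ adj G i j ∧ adj G j k ∧ adj G i k)

codegree : ∀ {n} → Graph n → Fin n → Fin n → ℕ
codegree G u v = sumF λ w → ind (adj G u w ∧ adj G v w)

bookNumber : ∀ {n} → Graph n → ℕ
bookNumber G = maxF λ u → maxF λ v → if adj G u v then codegree G u v else 0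

IsoTo : ∀ {n} → Graph n → (Fin n → Fin n → Bool) → Set
IsoTo {n} G H = Σ (Permutation′ n) λ π → ∀ i j → adj G i j ≡ H (π ⟨$⟩ʳ i) (π ⟨$⟩ʳ j)

balancedBipartite : (n : ℕ) → Fin n → Fin n → Bool
balancedBipartite n i j = not ((toℕ i <ᵇ n / 2) ≡ᵇᵇ (toℕ j <ᵇ n / 2))
  where
  _≡ᵇᵇ_ : Bool → Bool → Bool
  x ≡ᵇᵇ y = not (x xor y)

-- S_{b,n}: vertex k (= toℕ) lies in
--   U1 = [0,b), U2 = [b,2b), V1 = [2b,3b), V2 = [3b,4b),
--   U3 = [4b, 4b + ⌊(n-4b)/2⌋), V3 = the rest (size ⌈(n-4b)/2⌉).
-- side: 0 for U, 1 for V; index: 1,2,3.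
sSide : ℕ → ℕ → ℕ → ℕ
sSide b n k = if k <ᵇ 2 * b then 0 else if k <ᵇ 4 * b then 1
              else if k <ᵇ 4 * b + (n ∸ 4 * b) / 2 then 0 else 1

sIndex : ℕ → ℕ → ℕ → ℕ
sIndex b n k = if k <ᵇ b then 1 else if k <ᵇ 2 * b then 2 else if k <ᵇ 3 * b then 1
               else if k <ᵇ 4 * b then 2 else 3

-- U_i complete to U_j (i ≠ j), V_i complete to V_j (i ≠ j), U_i complete to V_i, nothing else:
-- adjacent iff (same side) xor (same index).
S : (b n : ℕ) → Fin n → Fin n → Bool
S b n i j = (sSide b n (toℕ i) ≡ᵇ sSide b n (toℕ j)) xor (sIndex b n (toℕ i) ≡ᵇ sIndex b n (toℕ j))

{-# OPTIONS --safe #-}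

-- Write k = n - 4b, so 499 k ≤ 4b, and suppose that G has T ≤ b²k triangles. Averaging over all vertices v,
-- some cut into N(v) and its complement has at most 3n²/2000 ordered edges inside its sides. All but
-- x ≤ 3n/110 vertices have a neighbourhood close to one of the two sides; this gives classes A and B,
-- independent because an edge inside one would lie in more than b triangles, and a set X of x exceptions.
-- Let u ∈ X have a and c neighbours in A and B, put σ = a + c - 2b, and let t and s count the ordered
-- triangles at u through A × B and X × (A ∪ B). The book bound on the edges at u gives 2t + s ≤ b (a + c),
-- which bounds 4t + 2s below in terms of σ. Σ σ is bounded below by the edge count, and the edges inside X
-- are bounded by counting, for each w ∈ A ∪ B, the pairs in X of which w is adjacent to exactly one.
-- Together, for every ℓ ≥ 12,
--   16 (T - b²k) ≥ (x - k) (16b² - 8bℓx + ℓx²) + (nonnegative terms).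
-- With ℓ = 4b this excludes 0 < x < k; with ℓ = 12 it gives T ≥ b²k, and when T = b²k all the nonnegative
-- terms vanish, which determines G as the blow-up of the prism. If x = 0, then G is balanced bipartite.
module Submission where

open import Defs
open import Data.Product using (_×_)
open import Relation.Nullary using (¬_)
open import Relation.Binary.PropositionalEquality using (_≡_)

-- The cut comes from `Σ (2 deg v - n)² ≥ 0`: together with the edge bound it makes the edges inside
-- the sides, summed over all `v`, at most `2τ = 12T`. As `T ≤ b²k` and `500k ≤ n`, some cut has at
-- most `3n²/2000` of them. In the blow-up of the prism, X is the union of U₃ and V₃, each of its
-- vertices has `a = c = b` and `s = 0`, and its `surplus` is 0, so the bound for one vertex has no
-- slack there. What disturbs it are the missing A-B pairs `ρ` among the neighbours of a vertex.
-- They are compensated by the term `20 ℓ ρ`; the total charge `80 R` is covered by the `16 b r`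
-- that the same missing pairs cost in the edge count, since `R ≤ x r` and `9x ≤ b`. No single ℓ
-- suffices. For `x < k` the factor `16b² - 8bℓx + ℓx²` has to be negative already at `x = 1`, which
-- needs `ℓ > 2b`. For `x > k` it has to be positive up to `x = b/9`, which needs `ℓ < 19`. Hence
-- the bound for one vertex is proved uniformly in `ℓ ≥ 12` and used twice.

module Counting-books-and-triangles where

  open import Data.Bool using (Bool; true; false; _∧_; _xor_; not; if_then_else_) renaming (T to IsTrue)
  import Data.Bool.Properties as Boolₚ
  open import Data.Empty using (⊥; ⊥-elim)
  open import Data.Fin using (Fin; zero; suc; toℕ; punchIn)
  import Data.Fin.Properties as Finₚ
  open import Data.Fin.Permutation as Perm using (Permutation′; _⟨$⟩ʳ_)
  open import Data.Integer
    using (ℤ; +_; -[1+_]; 0ℤ; 1ℤ; -1ℤ; _+_; _*_; _-_; -_; _≤_; _≤?_; _≟_)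
  import Data.Integer.Properties as ℤₚ
  open import Data.Integer.Tactic.RingSolver using (solve)
  open import Data.List using (List; []; _∷_; map)
  open import Data.Nat as ℕ using (ℕ; _<ᵇ_; _≡ᵇ_; _∸_)
  import Data.Nat.DivMod as ℕᵈ
  import Data.Nat.Properties as ℕₚ
  open import Data.Product using (_,_; proj₁; proj₂; ∃)
  open import Data.Sum using (_⊎_; inj₁; inj₂; [_,_]′)
  open import Data.Unit using (tt)
  open import Relation.Binary using (DecidableEquality; Tri; tri<; tri≈; tri>)
  open import Relation.Nullary using (Dec; yes; no; does)
  open import Relation.Nullary.Decidable using (True; toWitness; map′; ¬?; _×-dec_; _→-dec_)
  open import Relation.Binary.PropositionalEquality
    using (_≢_; refl; trans; cong; cong₂; subst; subst₂) renaming (sym to ≡-sym)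
  open import Algebra.Properties.AbelianGroup ℤₚ.+-0-abelianGroup using (∙-cancelˡ)
  open import Algebra.Properties.Semiring.Sum ℤₚ.+-*-semiring
    using (sum; sum-cong-≗; sum-remove; ∑-distrib-+; *-distribˡ-sum; ∑-comm; ∑-permute)

  -- Certificates of nonnegativity over the integers

  Pos : ℤ → Set
  Pos x = 0ℤ ≤ x

  infixl 6 _⊕_
  infixl 7 _⊗_

  _⊕_ : ∀ {x y} → Pos x → Pos y → Pos (x + y)
  _⊕_ = ℤₚ.+-mono-≤

  _⊗_ : ∀ {x y} → Pos x → Pos y → Pos (x * y)
  _⊗_ {+ m} {+ n} _ _ = subst Pos (ℤₚ.pos-* m n) (_≤_.+≤+ ℕ.z≤n)

  pos : ∀ m → Pos (+ m)
  pos m = _≤_.+≤+ ℕ.z≤n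

  infixl 5 _∴_
  -- The last step of a certificate: a nonnegative expression is assembled from known ones by `⊕`
  -- and `⊗`, and a ring identity carries it to the goal.
  _∴_ : ∀ {x y} → 0ℤ ≤ x → x ≡ y → 0ℤ ≤ y
  h ∴ e = subst Pos e h

  Pos-sq : ∀ x → Pos (x * x)
  Pos-sq (+ m) = pos m ⊗ pos m
  Pos-sq -[1+ m ] = pos _

  -- Over the integers the negation of `0 ≤ x` is `0 ≤ - x - 1`. In the same way strict inequalities
  -- are written `Pos (x - 1ℤ)` throughout.
  ¬Pos : ∀ {x} → Pos (- x - 1ℤ) → Pos x → ⊥
  ¬Pos {x} h k = absurd (h ⊕ k ∴ solve (x ∷ []))
    where
    absurd : Pos -1ℤ → ⊥
    absurd ()

  Pos? : ∀ x → Pos x ⊎ Pos (- x - 1ℤ)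
  Pos? (+ m) = inj₁ (pos m)
  Pos? -[1+ m ] = inj₂ (pos m)

  Pos-split : ∀ {C : Set} x → (Pos x → C) → (0ℤ ≤ - x - 1ℤ → C) → C
  Pos-split x f g = [ f , g ]′ (Pos? x)

  Pos-antisym : ∀ {x} → Pos x → Pos (- x) → x ≡ 0ℤ
  Pos-antisym {x} h k = ℤₚ.≤-antisym (subst₂ _≤_ (lem₁ x) (lem₂ x) (ℤₚ.+-monoʳ-≤ x k)) h
    where
    lem₁ : ∀ x → x + 0ℤ ≡ x
    lem₁ x = solve (x ∷ [])
    lem₂ : ∀ x → x + - x ≡ 0ℤ
    lem₂ x = solve (x ∷ [])

  -- Used to clear denominators: a bound with rational coefficients is certified after
  -- multiplication by a positive `x`.
  Pos-cancel : ∀ {x y} → Pos (x - 1ℤ) → Pos (x * y) → Pos y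
  Pos-cancel {x} {y} hx hxy with Pos? y
  ... | inj₁ h = h
  ... | inj₂ h = ⊥-elim (¬Pos {x * y} (hx ⊗ h ⊕ hx ⊕ h ∴ solve (x ∷ y ∷ [])) hxy)

  ≤⇒Pos : ∀ {x y} → x ≤ y → Pos (y - x)
  ≤⇒Pos = ℤₚ.i≤j⇒0≤j-i

  ≡⇒Pos : ∀ {x y} → x ≡ y → Pos (x - y)
  ≡⇒Pos {x} refl = pos 0 ∴ solve (x ∷ [])

  ≡0⇒≡ : ∀ {x y} → y - x ≡ 0ℤ → x ≡ y
  ≡0⇒≡ {x} {y} h = ≡-sym (ℤₚ.i-j≡0⇒i≡j y x h)

  -- Finite sums as positive linear functionals

  record Summation (I : Set) : Set₁ where
    field
      Φ    : (I → ℤ) → ℤ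
      cong-Φ : ∀ {f g} → (∀ i → f i ≡ g i) → Φ f ≡ Φ g
      add  : ∀ f g → Φ (λ i → f i + g i) ≡ Φ f + Φ g
      scale : ∀ c f → Φ (λ i → c * f i) ≡ c * Φ f
      positive : ∀ {f} → (∀ i → Pos (f i)) → Pos (Φ f)
      definite : ∀ {f} → (∀ i → Pos (f i)) → Φ f ≡ 0ℤ → ∀ i → f i ≡ 0ℤ

  Terms : Set → Set
  Terms I = List (ℤ × (I → ℤ))

  at : ∀ {I} → Terms I → I → ℤ
  at [] i = 0ℤ
  at ((c , f) ∷ L) i = c * f i + at L i

  module _ {I : Set} (S : Summation I) where
    open Summation S

    total : Terms I → ℤ
    total [] = 0ℤ
    total ((c , f) ∷ L) = c * Φ f + total L

    Φ-total : ∀ L → Φ (at L) ≡ total L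
    Φ-total [] = trans (scale 0ℤ (λ _ → 0ℤ)) (ℤₚ.*-zeroˡ (Φ (λ _ → 0ℤ)))
    Φ-total ((c , f) ∷ L) = trans (add (λ i → c * f i) (at L)) (cong₂ _+_ (scale c f) (Φ-total L))

    -- Reduces an inequality between sums to one between their integrands. When these are products
    -- of class and adjacency indicators, the pointwise inequality is a finite check by `exhaust`.
    total-pos : ∀ L → (∀ i → Pos (at L i)) → Pos (total L)
    total-pos L h = positive h ∴ Φ-total L

    total-zero : ∀ L → (∀ i → at L i ≡ 0ℤ) → total L ≡ 0ℤ
    total-zero L h = trans (≡-sym (Φ-total L)) (trans (cong-Φ h) (Φ-total []))

  open Summation

  ∑ : ∀ {n} → (Fin n → ℤ) → ℤ
  ∑ = sum

  ∑-positive : ∀ {n} {f : Fin n → ℤ} → (∀ i → Pos (f i)) → Pos (∑ f)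
  ∑-positive {ℕ.zero} h = pos 0
  ∑-positive {ℕ.suc n} h = h zero ⊕ ∑-positive (λ i → h (suc i))

  ∑-definite : ∀ {n} {f : Fin n → ℤ} → (∀ i → Pos (f i)) → ∑ f ≡ 0ℤ → ∀ i → f i ≡ 0ℤ
  ∑-definite {ℕ.suc n} {f} h e = go
    where
    tail-pos : Pos (∑ (λ i → f (suc i)))
    tail-pos = ∑-positive (λ i → h (suc i))
    neg₁ : ∀ a b → a + b ≡ 0ℤ → b ≡ - a
    neg₁ a b e = trans (lem a b) (trans (cong (_+ - a) e) (ℤₚ.+-identityˡ (- a)))
      where
      lem : ∀ a b → b ≡ a + b + - a
      lem a b = solve (a ∷ b ∷ [])
    head≡0 : f zero ≡ 0ℤ
    head≡0 = Pos-antisym (h zero) (tail-pos ∴ neg₁ _ _ e)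
    go : ∀ i → f i ≡ 0ℤ
    go zero = head≡0
    go (suc i) = ∑-definite (λ i → h (suc i))
      (trans (≡-sym (ℤₚ.+-identityˡ _)) (trans (cong (_+ ∑ (λ i → f (suc i))) (≡-sym head≡0)) e)) i

  ∑₁ : ∀ n → Summation (Fin n)
  ∑₁ n = record
    { Φ = ∑ ; cong-Φ = sum-cong-≗ ; add = ∑-distrib-+
    ; scale = λ c f → ≡-sym (*-distribˡ-sum c f)
    ; positive = ∑-positive ; definite = ∑-definite }

  _⊠_ : ∀ {I J} → Summation I → Summation J → Summation (I × J)
  S ⊠ T = record
    { Φ = λ f → Φ S (λ i → Φ T (λ j → f (i , j)))
    ; cong-Φ = λ h → cong-Φ S (λ i → cong-Φ T (λ j → h (i , j)))
    ; add = λ f g → trans (cong-Φ S (λ i → add T (λ j → f (i , j)) (λ j → g (i , j))))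
                          (add S (λ i → Φ T (λ j → f (i , j))) (λ i → Φ T (λ j → g (i , j))))
    ; scale = λ c f → trans (cong-Φ S (λ i → scale T c (λ j → f (i , j))))
                            (scale S c (λ i → Φ T (λ j → f (i , j))))
    ; positive = λ h → positive S (λ i → positive T (λ j → h (i , j)))
    ; definite = λ h e → λ { (i , j) → definite T (λ j → h (i , j))
                              (definite S (λ i → positive T (λ j → h (i , j))) e i) j } }

  ∑₂ : ∀ n → Summation (Fin n × Fin n)
  ∑₂ n = ∑₁ n ⊠ ∑₁ n

  ∑₃ : ∀ n → Summation (Fin n × Fin n × Fin n)
  ∑₃ n = ∑₁ n ⊠ ∑₂ n

  ∑∑-* : ∀ {n} (f g : Fin n → ℤ) → ∑ (λ i → ∑ (λ j → f i * g j)) ≡ ∑ f * ∑ g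
  ∑∑-* f g = trans (sum-cong-≗ (λ i → trans (≡-sym (*-distribˡ-sum (f i) g)) (ℤₚ.*-comm (f i) (∑ g))))
                   (trans (≡-sym (*-distribˡ-sum (∑ g) f)) (ℤₚ.*-comm (∑ g) (∑ f)))

  ∑-const : ∀ n c → ∑ {n} (λ _ → c) ≡ + n * c
  ∑-const ℕ.zero c = refl
  ∑-const (ℕ.suc n) c = trans (cong (λ z → c + z) (∑-const n c)) (≡-sym (ℤₚ.suc-* (+ n) c))

  ⟦_⟧ : Bool → ℤ
  ⟦ e ⟧ = + ind e

  data Cls : Set where
    A B X : Cls

  isA isB isX : Cls → ℤ
  isA A = 1ℤ
  isA _ = 0ℤ
  isB B = 1ℤ
  isB _ = 0ℤ
  isX X = 1ℤ
  isX _ = 0ℤ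

  all-Bool? : {P : Bool → Set} → (∀ e → Dec (P e)) → Dec (∀ e → P e)
  all-Bool? P? = map′ (λ { (t , f) → λ { true → t ; false → f } }) (λ h → h true , h false)
                      (P? true ×-dec P? false)

  all-Cls? : {P : Cls → Set} → (∀ c → Dec (P c)) → Dec (∀ c → P c)
  all-Cls? P? = map′ (λ { (a , b , x) → λ { A → a ; B → b ; X → x } }) (λ h → h A , h B , h X)
                     (P? A ×-dec P? B ×-dec P? X)

  exhaust : {P : Set} (P? : Dec P) {_ : True P?} → P
  exhaust P? {t} = toWitness {a? = P?} t

  -- Inequalities for a single exceptional vertex

  weaken : ∀ {x} → Pos (x - 1ℤ) → Pos x
  weaken {x} h = h ⊕ pos 1 ∴ solve (x ∷ [])

  -- For a vertex of X with b + α and b + γ neighbours in A and B, d in X, s as in the header, and ρ non-adjacent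
  -- pairs among its A × B neighbours (so t = (b + α)(b + γ) - ρ). The parameter ℓ is the weight of the edge count.
  surplus : (b d ℓ α γ s ρ : ℤ) → ℤ
  surplus b d ℓ α γ s ρ =
    + 4 * ((b + α) * (b + γ) - ρ) + + 2 * s - + 4 * (b * b) - ℓ * s + + 20 * (ℓ * ρ)
    - ℓ * ((α + γ) * (+ 4 * b - d))

  -- Factors of equal sign have a nonnegative product, so only the two mixed cases need an argument.
  product-bound : ∀ {m ρ α γ : ℤ} → Pos m → Pos ρ
    → (Pos α → Pos (- γ) → Pos (m * ρ + α * γ)) → (Pos γ → Pos (- α) → Pos (m * ρ + α * γ))
    → Pos (m * ρ + α * γ)
  product-bound {m} {ρ} {α} {γ} hm hρ f g =
    Pos-split α
      (λ hα → Pos-split γ (λ hγ → hm ⊗ hρ ⊕ hα ⊗ hγ) (λ hγ → f hα (weaken hγ)))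
      (λ hα → Pos-split γ (λ hγ → g hγ (weaken hα)) (λ hγ → both (weaken hα) (weaken hγ)))
    where
    both : Pos (- α) → Pos (- γ) → 0ℤ ≤ m * ρ + α * γ
    both hα hγ = hm ⊗ hρ ⊕ hα ⊗ hγ ∴ solve (m ∷ ρ ∷ α ∷ γ ∷ [])

  -- With `t = (b + α)(b + γ) - ρ`, the hypothesis `h₂` is the book bound `2t + s ≤ b (a + c)`,
  -- while `hα` and `hγ` are `t ≤ bc` and `t ≤ ba`. The last four hypotheses say that `a` and `c`
  -- lie between `b/10` and `8b/5`.
  module Genuine {b d ℓ α γ s ρ : ℤ}
    (hb : Pos (b - 1ℤ)) (hd : Pos d) (hd′ : Pos (b - + 9 * d)) (hℓ : Pos (ℓ - + 12))
    (hs : Pos s) (hρ : Pos ρ)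
    (h₂ : Pos (+ 2 * ρ - + 2 * (α * γ) - b * (α + γ) - s))
    (hα : Pos (ρ - α * (b + γ))) (hγ : Pos (ρ - γ * (b + α)))
    (α↓ : Pos (+ 10 * α + + 9 * b)) (γ↓ : Pos (+ 10 * γ + + 9 * b))
    (α↑ : Pos (+ 3 * b - + 5 * α)) (γ↑ : Pos (+ 3 * b - + 5 * γ)) where

    private
      b≥0 : Pos b
      b≥0 = weaken hb

      ℓ≥0 : Pos ℓ
      ℓ≥0 = hℓ ⊕ pos 12 ∴ solve (ℓ ∷ [])

      ℓ≥2 : Pos (ℓ - + 2)
      ℓ≥2 = hℓ ⊕ pos 10 ∴ solve (ℓ ∷ [])

      -- `surplus` is `ℓ - 2` times the slack of `h₂`, plus `2ℓ (9ρ + αγ)`, minus this coefficient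
      -- times `α + γ`. The weight 20 of `ℓρ` in `surplus` is thus 2 from `h₂` and 18 from
      -- `9ρ + αγ`.
      K≥1 : Pos ((+ 3 * ℓ - + 2) * b - ℓ * d - 1ℤ)
      K≥1 = ℓ≥0 ⊗ (hd′ ⊕ pos 8 ⊗ hd) ⊕ (pos 2 ⊗ hℓ ⊕ pos 21) ⊗ b≥0 ⊕ hb ∴ solve (b ∷ d ∷ ℓ ∷ [])

      -- If `α ≥ 0 ≥ γ`, then `hα` gives `9ρ + αγ ≥ α (9 (b + γ) + γ)`, and `9b + 10γ ≥ 0` is the
      -- lower bound on `γ`.
      9ρ+αγ≥0 : Pos (+ 9 * ρ + α * γ)
      9ρ+αγ≥0 = product-bound {+ 9} {ρ} {α} {γ} (pos 9) hρ
        (λ hα′ _ → pos 9 ⊗ hα ⊕ hα′ ⊗ γ↓ ∴ solve (b ∷ α ∷ γ ∷ ρ ∷ []))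
        (λ hγ′ _ → pos 9 ⊗ hγ ⊕ hγ′ ⊗ α↓ ∴ solve (b ∷ α ∷ γ ∷ ρ ∷ []))

      -- Now the negative factor is at least `-3b/5`, because the other one is at most `3b/5` and
      -- the sum is nonnegative; hence `3 (b + γ) + 2γ ≥ 0` when `γ` is the negative one.
      3ρ+2αγ≥0 : Pos (α + γ) → Pos (+ 3 * ρ + (+ 2 * α) * γ)
      3ρ+2αγ≥0 hσ = product-bound {+ 3} {ρ} {+ 2 * α} {γ} (pos 3) hρ
        (λ 2α≥0 _ → pos 3 ⊗ hα ⊕ Pos-cancel {+ 2} {α} (pos 1) 2α≥0 ⊗ (pos 5 ⊗ hσ ⊕ α↑) ∴ solve (b ∷ α ∷ γ ∷ ρ ∷ []))
        (λ hγ′ _ → pos 3 ⊗ hγ ⊕ hγ′ ⊗ (pos 5 ⊗ hσ ⊕ γ↑) ∴ solve (b ∷ α ∷ γ ∷ ρ ∷ []))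

    private
      -- Here the edge term counts against the vertex, so `h₂` is used with weight `4ℓ - 2`: the
      -- `b (α + γ)` in it then absorbs `4bℓ (α + γ)`.
      surplus-pos₁ : Pos (α + γ) → 0ℤ ≤ (+ 4 * ((b + α) * (b + γ) - ρ) + + 2 * s - + 4 * (b * b) - ℓ * s + + 20 * (ℓ * ρ)
        - ℓ * ((α + γ) * (+ 4 * b - d)))
      surplus-pos₁ hσ = (ℓ≥2 ⊕ pos 3 ⊗ ℓ≥0) ⊗ h₂ ⊕ pos 3 ⊗ ℓ≥0 ⊗ hs ⊕ pos 4 ⊗ ℓ≥0 ⊗ 3ρ+2αγ≥0 hσ
                    ⊕ hσ ⊗ (pos 2 ⊗ b≥0 ⊕ ℓ≥0 ⊗ hd)
                    ∴ solve (b ∷ d ∷ ℓ ∷ α ∷ γ ∷ s ∷ ρ ∷ [])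

      surplus-pos₂ : Pos (- (α + γ)) → 0ℤ ≤ (+ 4 * ((b + α) * (b + γ) - ρ) + + 2 * s - + 4 * (b * b) - ℓ * s + + 20 * (ℓ * ρ)
        - ℓ * ((α + γ) * (+ 4 * b - d)))
      surplus-pos₂ hσ = ℓ≥2 ⊗ h₂ ⊕ pos 2 ⊗ ℓ≥0 ⊗ 9ρ+αγ≥0 ⊕ hσ ⊗ weaken {(+ 3 * ℓ - + 2) * b - ℓ * d} K≥1
                    ∴ solve (b ∷ d ∷ ℓ ∷ α ∷ γ ∷ s ∷ ρ ∷ [])

    surplus-pos : Pos (surplus b d ℓ α γ s ρ)
    surplus-pos = Pos-split (α + γ - 1ℤ) (λ h → surplus-pos₁ (weaken h)) (λ h → surplus-pos₂ (h ∴ solve (α ∷ γ ∷ [])))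

    module _ (ρ≡0 : ρ ≡ 0ℤ) (surplus≡0 : surplus b d ℓ α γ s ρ ≡ 0ℤ) where
      private
        -- For `ρ = 0` the hypothesis reads `α (b + γ) ≤ 0`, and `b + γ` is positive by the lower
        -- bound on `γ`.
        nonpos : ∀ {α γ} → Pos (ρ - α * (b + γ)) → Pos (+ 10 * γ + + 9 * b) → Pos (- α)
        nonpos {α} {γ} h γ↓ = Pos-cancel {+ 10 * (b + γ)} { - α}
          (γ↓ ⊕ hb ∴ solve (b ∷ γ ∷ []))
          (pos 10 ⊗ h ∴ trans (cong (λ ρ → + 10 * (ρ - α * (b + γ))) ρ≡0) (solve (b ∷ α ∷ γ ∷ [])))

        α≤0 : Pos (- α)
        α≤0 = nonpos {α} {γ} hα γ↓

        γ≤0 : Pos (- γ)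
        γ≤0 = nonpos {γ} {α} hγ α↓

        -- With `surplus = 0`, the identity behind `K≥1` makes `α + γ` times a positive coefficient
        -- nonnegative. Together with `α, γ ≤ 0` both have to vanish.
        σ≥0 : Pos (α + γ)
        σ≥0 = Pos-cancel {(+ 3 * ℓ - + 2) * b - ℓ * d} {α + γ} K≥1
          (ℓ≥2 ⊗ h₂ ⊕ pos 2 ⊗ ℓ≥0 ⊗ 9ρ+αγ≥0 ∴ trans step (trans (cong (λ z → ((+ 3 * ℓ - + 2) * b - ℓ * d) * (α + γ) + z) surplus≡0)
             (solve (b ∷ d ∷ ℓ ∷ α ∷ γ ∷ []))))
          where
          step : (ℓ - + 2) * (+ 2 * ρ - + 2 * (α * γ) - b * (α + γ) - s) + + 2 * ℓ * (+ 9 * ρ + α * γ)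
            ≡ ((+ 3 * ℓ - + 2) * b - ℓ * d) * (α + γ) + (+ 4 * ((b + α) * (b + γ) - ρ) + + 2 * s - + 4 * (b * b) - ℓ * s + + 20 * (ℓ * ρ)
               - ℓ * ((α + γ) * (+ 4 * b - d)))
          step = solve (b ∷ d ∷ ℓ ∷ α ∷ γ ∷ s ∷ ρ ∷ [])

      α≡0 : α ≡ 0ℤ
      α≡0 = Pos-antisym (σ≥0 ⊕ γ≤0 ∴ solve (α ∷ γ ∷ [])) α≤0

      γ≡0 : γ ≡ 0ℤ
      γ≡0 = Pos-antisym (σ≥0 ⊕ α≤0 ∴ solve (α ∷ γ ∷ [])) γ≤0

      s≡0 : s ≡ 0ℤ
      s≡0 = Pos-antisym hs (h₂ ∴ trans (cong₂ (λ ρ α → + 2 * ρ - + 2 * (α * γ) - b * (α + γ) - s) ρ≡0 α≡0)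
        (trans (cong (λ γ → + 2 * 0ℤ - + 2 * (0ℤ * γ) - b * (0ℤ + γ) - s) γ≡0) (solve (b ∷ s ∷ []))))

  -- A vertex with `a + c ≤ 9b/5` wins through the edge term. In the extreme case
  -- `- ℓ (α + γ)(4b - d)` is at least `7ℓb²/9`, the loss `ℓs` is at most `ℓx (a + c) ≤ ℓb²/5`, and
  -- the remaining `26ℓb²/45` exceeds `4b²` since `ℓ ≥ 12`.
  degenerate-surplus : ∀ {b d ℓ x α γ s ρ : ℤ}
    → Pos (b - 1ℤ) → Pos d → Pos (b - + 9 * d) → Pos (b - + 9 * x) → Pos (ℓ - + 12)
    → Pos ρ → Pos ((b + α) * (b + γ) - ρ) → Pos (+ 2 * b + (α + γ)) → Pos (x * (+ 2 * b + (α + γ)) - s)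
    → Pos (- b - + 5 * (α + γ)) → Pos s
    → Pos (surplus b d ℓ α γ s ρ - 1ℤ)
  degenerate-surplus {b} {d} {ℓ} {x} {α} {γ} {s} {ρ} hb hd hd′ hx hℓ hρ ht h2b hsx hσ hs =
    Pos-cancel {+ 45} {surplus b d ℓ α γ s ρ - 1ℤ} (pos 44) expanded
    where
    b≥0 : Pos b
    b≥0 = weaken hb
    ℓ≥0 : Pos ℓ
    ℓ≥0 = hℓ ⊕ pos 12 ∴ solve (ℓ ∷ [])
    ℓ≥2 : Pos (ℓ - + 2)
    ℓ≥2 = hℓ ⊕ pos 10 ∴ solve (ℓ ∷ [])
    -σ≥0 : Pos (- (α + γ))
    -σ≥0 = Pos-cancel {+ 5} { - (α + γ)} (pos 4) (hσ ⊕ b≥0 ∴ solve (b ∷ α ∷ γ ∷ []))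
    expanded : 0ℤ ≤ + 45 * ((+ 4 * ((b + α) * (b + γ) - ρ) + + 2 * s - + 4 * (b * b) - ℓ * s + + 20 * (ℓ * ρ)
      - ℓ * ((α + γ) * (+ 4 * b - d))) - 1ℤ)
    expanded =
      pos 180 ⊗ ht ⊕ pos 45 ⊗ (ℓ≥2 ⊗ hsx ) ⊕ pos 5 ⊗ (ℓ≥2 ⊗ hx ⊗ h2b) ⊕ pos 900 ⊗ (ℓ≥0 ⊗ hρ)
       ⊕ pos 5 ⊗ (ℓ≥0 ⊗ -σ≥0 ⊗ hd′) ⊕ (pos 36 ⊗ ℓ≥2 ⊕ pos 70) ⊗ b≥0 ⊗ hσ ⊕ pos 26 ⊗ hℓ ⊗ b≥0 ⊗ b≥0
       ⊕ pos 150 ⊗ hb ⊗ (hb ⊕ pos 2) ⊕ pos 105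
       ∴ solve (b ∷ d ∷ ℓ ∷ x ∷ α ∷ γ ∷ s ∷ ρ ∷ [])

  -- The weights `4`, `4bℓ` and `ℓ` on the triangle bound, the edge bound and the double count are
  -- those for which `Tt`, `C`, `S`, `Sd` and `e₂` all cancel against `4H`.
  combine : ∀ {b n ℓ T Tt C H S Sd e₂ p q x r R Z Y : ℤ}
    → Pos ℓ → Pos b
    → Pos (+ 4 * T - (+ 4 * Tt + + 2 * C))
    → H ≡ + 4 * Tt + + 2 * C - + 4 * (b * b) * x - ℓ * C + + 20 * (ℓ * R) - ℓ * (+ 4 * b * S - Sd)
    → Pos (+ 4 * S + + 2 * e₂ + x * x - (p - q) * (p - q) - + 2 * x * (n - + 4 * b) - + 4 * r)
    → + 8 * b * e₂ + + 4 * Sd - + 4 * C + + 2 * Z + Y ≡ (n - x) * (x * x)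
    → Pos (+ 16 * T - + 16 * (b * b) * (n - + 4 * b)
           - ((x - (n - + 4 * b)) * (+ 16 * (b * b) - + 8 * b * ℓ * x + ℓ * (x * x))
              + + 4 * H + + 4 * b * ℓ * ((p - q) * (p - q)) + ℓ * (+ 16 * b * r - + 80 * R) + ℓ * (+ 2 * Z + Y)))
  combine {b} {n} {ℓ} {T} {Tt} {C} {H} {S} {Sd} {e₂} {p} {q} {x} {r} {R} {Z} {Y} hℓ hb hT refl h₁ h₃ =
    pos 4 ⊗ hT ⊕ pos 4 ⊗ (hb ⊗ hℓ ⊗ h₁) ⊕ hℓ ⊗ ≡⇒Pos {(n - x) * (x * x)} {+ 8 * b * e₂ + + 4 * Sd - + 4 * C + + 2 * Z + Y} (≡-sym h₃) ∴
      solve (b ∷ n ∷ ℓ ∷ T ∷ Tt ∷ C ∷ S ∷ Sd ∷ e₂ ∷ p ∷ q ∷ x ∷ r ∷ R ∷ Z ∷ Y ∷ [])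

  one-side : ∀ {n b a c t ρ : ℤ} → Pos (+ 101 * b - + 25 * n) → Pos (+ 5 * b - n) → Pos b → Pos c
    → a * c ≡ t + ρ → Pos (b * c - t) → Pos (+ 23 * n * c - + 200 * ρ)
    → Pos (+ 89 * n + + 200 * c - + 200 * a)
    → Pos (- b - + 5 * ((a - b) + (c - b)))
      ⊎ (Pos (+ 10 * (c - b) + + 9 * b) × Pos (+ 3 * b - + 5 * (a - b)))
  one-side {n} {b} {a} {c} {t} {ρ} hn hn′ hb hc e ht hρ hac =
    Pos-split (c - 1ℤ)
      (λ c≥1 → Pos-split (+ 10 * (c - b) + + 9 * b)
        (λ h → inj₂ (h , a-small c≥1))
        (λ h → inj₁ (small-c c≥1 h)))
      (λ h → inj₁ (no-c (Pos-antisym hc (h ∴ solve (c ∷ [])))))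
    where
    a-bound : Pos (c - 1ℤ) → Pos (+ 23 * n - + 200 * (a - b))
    a-bound c≥1 = Pos-cancel {c} {+ 23 * n - + 200 * (a - b)} c≥1
      (hρ ⊕ pos 200 ⊗ ht ⊕ pos 200 ⊗ ≡⇒Pos {t + ρ} {a * c} (≡-sym e)
        ∴ solve (n ∷ b ∷ a ∷ c ∷ t ∷ ρ ∷ []))
    a-small : Pos (c - 1ℤ) → Pos (+ 3 * b - + 5 * (a - b))
    a-small c≥1 = Pos-cancel {+ 40} {+ 3 * b - + 5 * (a - b)} (pos 39)
      (a-bound c≥1 ⊕ pos 23 ⊗ hn′ ⊕ pos 5 ⊗ hb ∴ solve (n ∷ b ∷ a ∷ []))
    small-c : Pos (c - 1ℤ) → 0ℤ ≤ - (+ 10 * (c - b) + + 9 * b) - 1ℤ → Pos (- b - + 5 * ((a - b) + (c - b)))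
    small-c c≥1 h = Pos-cancel {+ 40} { - b - + 5 * ((a - b) + (c - b))} (pos 39)
      (a-bound c≥1 ⊕ pos 20 ⊗ h ⊕ pos 23 ⊗ hn′ ⊕ pos 25 ⊗ hb ⊕ pos 20 ∴ solve (n ∷ b ∷ a ∷ c ∷ []))
    -- Nothing can be divided by `c` here. Instead `a ≤ 89n/200` and `25n ≤ 101b` give
    -- `a ≤ 8989b/5000`, just below `9b/5`.
    no-c : c ≡ 0ℤ → Pos (- b - + 5 * ((a - b) + (c - b)))
    no-c refl = Pos-cancel {+ 1000} { - b - + 5 * ((a - b) + (0ℤ - b))} (pos 999)
      (pos 25 ⊗ hac ⊕ pos 89 ⊗ hn ⊕ pos 11 ⊗ hb ∴ solve (n ∷ b ∷ a ∷ []))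

  -- Records rather than bare inequalities, so that comparing two such bounds never unfolds their literals.
  record Few-missing (n y ρ : ℤ) : Set where
    constructor few-missing
    field bound : Pos (+ 23 * n * y - + 200 * ρ)

  record One-sided (n y z : ℤ) : Set where
    constructor one-sided
    field bound : Pos (+ 89 * n + + 200 * z - + 200 * y)

  record VertexBounds (n b d ℓ x a c t s ρ : ℤ) : Set where
    field
      n-bound : Pos (+ 101 * b - + 25 * n)
      n≤5b : Pos (+ 5 * b - n)
      b≥1 : Pos (b - 1ℤ)
      x-bound : Pos (b - + 9 * x)
      d≥0 : Pos d
      d≤x : Pos (x - d)
      ℓ≥12 : Pos (ℓ - + 12)
      a≥0 : Pos a
      c≥0 : Pos c
      t≥0 : Pos t
      s≥0 : Pos s
      ρ≥0 : Pos ρ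
      s≤ : Pos (x * (a + c) - s)
      ac≡ : a * c ≡ t + ρ
      t≤bc : Pos (b * c - t)
      t≤ba : Pos (b * a - t)
      2t+s≤ : Pos (b * (a + c) - (+ 2 * t + s))
      ρ≤c : Few-missing n c ρ
      ρ≤a : Few-missing n a ρ
      a≤c : One-sided n a c
      c≤a : One-sided n c a

  module Vertex {n b d ℓ x a c t s ρ : ℤ} (B : VertexBounds n b d ℓ x a c t s ρ) where
    open VertexBounds B

    private
      d-bound : Pos (b - + 9 * d)
      d-bound = x-bound ⊕ pos 9 ⊗ d≤x ∴ solve (b ∷ x ∷ d ∷ [])

      H : ℤ
      H = surplus b d ℓ (a - b) (c - b) s ρ

      t≡ : t ≡ a * c - ρ
      t≡ = trans (lem t ρ) (cong (λ z → z - ρ) (≡-sym ac≡))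
        where
        lem : ∀ t ρ → t ≡ t + ρ - ρ
        lem t ρ = solve (t ∷ ρ ∷ [])

      Degenerate : Set
      Degenerate = Pos (- b - + 5 * ((a - b) + (c - b)))

      degenerate : Degenerate → Pos (H - 1ℤ)
      degenerate h = degenerate-surplus {b} {d} {ℓ} {x} {a - b} {c - b} {s} {ρ} b≥1 d≥0 d-bound x-bound ℓ≥12 ρ≥0
        (t≥0 ∴ trans t≡ (solve (a ∷ b ∷ c ∷ ρ ∷ [])))
        (a≥0 ⊕ c≥0 ∴ solve (a ∷ b ∷ c ∷ []))
        (s≤ ∴ solve (a ∷ b ∷ c ∷ x ∷ s ∷ []))
        h s≥0

      module G (α↓ : Pos (+ 10 * (a - b) + + 9 * b)) (γ↓ : Pos (+ 10 * (c - b) + + 9 * b))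
               (α↑ : Pos (+ 3 * b - + 5 * (a - b))) (γ↑ : Pos (+ 3 * b - + 5 * (c - b))) =
        Genuine {b} {d} {ℓ} {a - b} {c - b} {s} {ρ} b≥1 d≥0 d-bound ℓ≥12 s≥0 ρ≥0
          (2t+s≤ ∴ trans (cong (λ z → b * (a + c) - (+ 2 * z + s)) t≡) (solve (a ∷ b ∷ c ∷ s ∷ ρ ∷ [])))
          (t≤bc ∴ trans (cong (λ z → b * c - z) t≡) (solve (a ∷ b ∷ c ∷ ρ ∷ [])))
          (t≤ba ∴ trans (cong (λ z → b * a - z) t≡) (solve (a ∷ b ∷ c ∷ ρ ∷ [])))
          α↓ γ↓ α↑ γ↑

      data Kind : Set where
        deg : Degenerate → Kind
        gen : Pos (+ 10 * (a - b) + + 9 * b) → Pos (+ 10 * (c - b) + + 9 * b) →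
              Pos (+ 3 * b - + 5 * (a - b)) → Pos (+ 3 * b - + 5 * (c - b)) → Kind

      kind : Kind
      kind = [ deg , (λ (γ↓ , α↑) →
        [ (λ h → deg (subst (λ z → Pos (- b - + 5 * z)) (ℤₚ.+-comm (c - b) (a - b)) h))
        , (λ (α↓ , γ↑) → gen α↓ γ↓ α↑ γ↑) ]′
          (one-side {n} {b} {c} {a} {t} {ρ} n-bound n≤5b (weaken b≥1) a≥0
                  (trans (ℤₚ.*-comm c a) ac≡) t≤ba (Few-missing.bound ρ≤a) (One-sided.bound c≤a))) ]′
        (one-side {n} {b} {a} {c} {t} {ρ} n-bound n≤5b (weaken b≥1) c≥0 ac≡ t≤bc (Few-missing.bound ρ≤c) (One-sided.bound a≤c))

    surplus≥0 : Pos H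
    surplus≥0 = go kind
      where
      go : Kind → Pos H
      go (deg h) = weaken {H} (degenerate h)
      go (gen α↓ γ↓ α↑ γ↑) = G.surplus-pos α↓ γ↓ α↑ γ↑

    tight : ρ ≡ 0ℤ → H ≡ 0ℤ → a ≡ b × c ≡ b × s ≡ 0ℤ
    tight ρ≡0 H≡0 = go kind
      where
      go : Kind → a ≡ b × c ≡ b × s ≡ 0ℤ
      go (deg h) = ⊥-elim (¬Pos { -1ℤ} (pos 0) (subst (λ z → Pos (z - 1ℤ)) H≡0 (degenerate h)))
      go (gen α↓ γ↓ α↑ γ↑) = ≡-sym (≡0⇒≡ {b} {a} (G.α≡0 α↓ γ↓ α↑ γ↑ ρ≡0 H≡0))
        , ≡-sym (≡0⇒≡ {b} {c} (G.γ≡0 α↓ γ↓ α↑ γ↑ ρ≡0 H≡0)) , G.s≡0 α↓ γ↓ α↑ γ↑ ρ≡0 H≡0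

  -- The two choices of ℓ and the case of equality

  Excess : (b n ℓ T H p q x r R Z Y : ℤ) → ℤ
  Excess b n ℓ T H p q x r R Z Y =
    + 16 * T - + 16 * (b * b) * (n - + 4 * b)
      - ((x - (n - + 4 * b)) * (+ 16 * (b * b) - + 8 * b * ℓ * x + ℓ * (x * x))
         + + 4 * H + + 4 * b * ℓ * ((p - q) * (p - q)) + ℓ * (+ 16 * b * r - + 80 * R) + ℓ * (+ 2 * Z + Y))

  module Few-exceptional {b n T p q x r R Z Y : ℤ}
    (b≥1 : Pos (b - 1ℤ)) (x≥1 : Pos (x - 1ℤ)) (x-bound : Pos (b - + 9 * x))
    (T≤ : Pos (b * b * (n - + 4 * b) - T))
    (r≥0 : Pos r) (R≤ : Pos (x * r - R)) (Z≥0 : Pos Z) (Y≥0 : Pos Y) where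

    private
      k : ℤ
      k = n - + 4 * b
      b≥0 : Pos b
      b≥0 = weaken b≥1
      x≥0 : Pos x
      x≥0 = weaken x≥1
      -- A missing A-B pair brings `16b ≥ 144x` and is charged at most 80 by each of the `x`
      -- exceptional vertices; `64x ≥ 64` is left over.
      rR : Pos (+ 16 * b * r - + 80 * R - + 64 * r)
      rR = pos 80 ⊗ R≤ ⊕ (pos 16 ⊗ x-bound ⊕ pos 64 ⊗ x≥1) ⊗ r≥0 ∴ solve (b ∷ x ∷ r ∷ R ∷ [])
      rR≥0 : Pos (+ 16 * b * r - + 80 * R)
      rR≥0 = rR ⊕ pos 64 ⊗ r≥0 ∴ solve (b ∷ r ∷ R ∷ [])

    -- For `ℓ = 4b` the factor of `x - k` is `4b (4b - 8bx + x²)`, which is negative for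
    -- `1 ≤ x ≤ b/9`. If also `x < k`, the product is positive and contradicts `T ≤ b²k`.
    x≥k : ∀ {H} → Pos H → Pos (Excess b n (+ 4 * b) T H p q x r R Z Y) → Pos (x - (n - + 4 * b))
    x≥k {H} H≥0 h = Pos-split (x - (n - + 4 * b)) (λ h → h) (λ h′ → ⊥-elim (impossible h′))
      where
      impossible : 0ℤ ≤ - (x - (n - + 4 * b)) - 1ℤ → ⊥
      impossible h′ = ¬Pos { -1ℤ} (pos 0) (contra h)
        where
        contra : 0ℤ ≤ + 16 * T - + 16 * (b * b) * (n - + 4 * b)
           - ((x - (n - + 4 * b)) * (+ 16 * (b * b) - + 8 * b * (+ 4 * b) * x + + 4 * b * (x * x))
           + + 4 * H + + 4 * b * (+ 4 * b) * ((p - q) * (p - q)) + + 4 * b * (+ 16 * b * r - + 80 * R) + + 4 * b * (+ 2 * Z + Y))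
           → 0ℤ ≤ -1ℤ
        contra h = h ⊕ pos 16 ⊗ T≤ ⊕ pos 4 ⊗ H≥0 ⊕ pos 16 ⊗ b≥0 ⊗ b≥0 ⊗ Pos-sq (p - q)
          ⊕ pos 4 ⊗ b≥0 ⊗ rR≥0 ⊕ pos 4 ⊗ b≥0 ⊗ (pos 2 ⊗ Z≥0 ⊕ Y≥0)
          ⊕ (h′ ⊕ pos 1) ⊗ (pos 4 ⊗ b≥0 ⊗ x≥0 ⊗ (x-bound ⊕ pos 8 ⊗ x≥0) ⊕ pos 28 ⊗ b≥0 ⊗ b≥0 ⊗ x≥1)
          ⊕ pos 12 ⊗ b≥0 ⊗ b≥0 ⊗ h′ ⊕ pos 12 ⊗ b≥1 ⊗ (b≥1 ⊕ pos 2) ⊕ pos 11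
          ∴ solve (b ∷ n ∷ T ∷ H ∷ p ∷ q ∷ x ∷ r ∷ R ∷ Z ∷ Y ∷ [])

    module Tight {H} (H≥0 : Pos H) (x≥k′ : Pos (x - (n - + 4 * b)))
                 (h : 0ℤ ≤ + 16 * T - + 16 * (b * b) * (n - + 4 * b)
                   - ((x - (n - + 4 * b)) * (+ 16 * (b * b) - + 8 * b * + 12 * x + + 12 * (x * x))
                     + + 4 * H + + 4 * b * + 12 * ((p - q) * (p - q)) + + 12 * (+ 16 * b * r - + 80 * R) + + 12 * (+ 2 * Z + Y))) where
      private
        -- For `ℓ = 12` the negative term is `96bx ≤ 32b²/3`, which stays below `16b²`.
        slope : Pos (+ 16 * (b * b) - + 8 * b * + 12 * x + + 12 * (x * x) - 1ℤ)
        slope = pos 10 ⊗ b≥0 ⊗ x-bound ⊕ pos 6 ⊗ b≥0 ⊗ (x-bound ⊕ pos 8 ⊗ x≥0 ) ⊕ pos 12 ⊗ x≥1 ⊗ (x≥1 ⊕ pos 2)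
                ⊕ pos 11 ∴ solve (b ∷ x ∷ [])
        part₁ : Pos ((x - (n - + 4 * b)) * (+ 16 * (b * b) - + 8 * b * + 12 * x + + 12 * (x * x)))
        part₁ = x≥k′ ⊗ weaken {+ 16 * (b * b) - + 8 * b * + 12 * x + + 12 * (x * x)} slope
        part₃ : Pos (+ 48 * b * ((p - q) * (p - q)))
        part₃ = pos 48 ⊗ b≥0 ⊗ Pos-sq (p - q)

      T≡ : T ≡ b * b * (n - + 4 * b)
      T≡ = ≡0⇒≡ (Pos-antisym T≤ (Pos-cancel {+ 16} { - (b * b * (n - + 4 * b) - T)} (pos 15)
        (h ⊕ part₁ ⊕ pos 4 ⊗ H≥0 ⊕ part₃ ⊕ pos 12 ⊗ rR≥0 ⊕ pos 12 ⊗ (pos 2 ⊗ Z≥0 ⊕ Y≥0)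
          ∴ solve (b ∷ n ∷ T ∷ H ∷ p ∷ q ∷ x ∷ r ∷ R ∷ Z ∷ Y ∷ []))))

      x≡k : x ≡ n - + 4 * b
      x≡k = ≡-sym (≡0⇒≡ (Pos-antisym x≥k′
        (Pos-cancel {+ 16 * (b * b) - + 8 * b * + 12 * x + + 12 * (x * x)} { - (x - (n - + 4 * b))} slope
        (h ⊕ pos 16 ⊗ T≤ ⊕ pos 4 ⊗ H≥0 ⊕ part₃ ⊕ pos 12 ⊗ rR≥0 ⊕ pos 12 ⊗ (pos 2 ⊗ Z≥0 ⊕ Y≥0)
          ∴ solve (b ∷ n ∷ T ∷ H ∷ p ∷ q ∷ x ∷ r ∷ R ∷ Z ∷ Y ∷ [])))))

      H≡0 : H ≡ 0ℤ
      H≡0 = Pos-antisym H≥0 (Pos-cancel {+ 4} { - H} (pos 3)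
        (h ⊕ part₁ ⊕ pos 16 ⊗ T≤ ⊕ part₃ ⊕ pos 12 ⊗ rR≥0 ⊕ pos 12 ⊗ (pos 2 ⊗ Z≥0 ⊕ Y≥0)
          ∴ solve (b ∷ n ∷ T ∷ H ∷ p ∷ q ∷ x ∷ r ∷ R ∷ Z ∷ Y ∷ [])))

      r≡0 : r ≡ 0ℤ
      -- `768 = 12 * 64`: the margin `64 r` in `rR`, which `rR≥0` gives away, is kept here.
      r≡0 = Pos-antisym r≥0 (Pos-cancel {+ 768} { - r} (pos 767)
        (h ⊕ part₁ ⊕ pos 16 ⊗ T≤ ⊕ pos 4 ⊗ H≥0 ⊕ part₃ ⊕ pos 12 ⊗ rR ⊕ pos 12 ⊗ (pos 2 ⊗ Z≥0 ⊕ Y≥0)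
          ∴ solve (b ∷ n ∷ T ∷ H ∷ p ∷ q ∷ x ∷ r ∷ R ∷ Z ∷ Y ∷ [])))

      Z≡0 : Z ≡ 0ℤ
      Z≡0 = Pos-antisym Z≥0 (Pos-cancel {+ 24} { - Z} (pos 23)
        (h ⊕ part₁ ⊕ pos 16 ⊗ T≤ ⊕ pos 4 ⊗ H≥0 ⊕ part₃ ⊕ pos 12 ⊗ rR≥0 ⊕ pos 12 ⊗ Y≥0
          ∴ solve (b ∷ n ∷ T ∷ H ∷ p ∷ q ∷ x ∷ r ∷ R ∷ Z ∷ Y ∷ [])))

      Y≡0 : Y ≡ 0ℤ
      Y≡0 = Pos-antisym Y≥0 (Pos-cancel {+ 12} { - Y} (pos 11)
        (h ⊕ part₁ ⊕ pos 16 ⊗ T≤ ⊕ pos 4 ⊗ H≥0 ⊕ part₃ ⊕ pos 12 ⊗ rR≥0 ⊕ pos 24 ⊗ Z≥0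
          ∴ solve (b ∷ n ∷ T ∷ H ∷ p ∷ q ∷ x ∷ r ∷ R ∷ Z ∷ Y ∷ [])))

      [p-q]²≡0 : (p - q) * (p - q) ≡ 0ℤ
      [p-q]²≡0 = Pos-antisym (Pos-sq (p - q)) (Pos-cancel {+ 48} { - ((p - q) * (p - q))} (pos 47)
        (h ⊕ part₁ ⊕ pos 16 ⊗ T≤ ⊕ pos 4 ⊗ H≥0 ⊕ pos 48 ⊗ b≥1 ⊗ Pos-sq (p - q) ⊕ pos 12 ⊗ rR≥0 ⊕ pos 12 ⊗ (pos 2 ⊗ Z≥0 ⊕ Y≥0)
          ∴ solve (b ∷ n ∷ T ∷ H ∷ p ∷ q ∷ x ∷ r ∷ R ∷ Z ∷ Y ∷ [])))

  -- Counting in a graph split into classes A, B and X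

  isN : Cls → ℤ
  isN c = isA c + isB c

  module _ {n : ℕ} where

    Σ₂ : (Fin n × Fin n → ℤ) → ℤ
    Σ₂ = Φ (∑₂ n)

    Σ₃ : (Fin n × Fin n × Fin n → ℤ) → ℤ
    Σ₃ = Φ (∑₃ n)

    Σ₂-swap : ∀ f → Σ₂ f ≡ Σ₂ (λ (u , v) → f (v , u))
    Σ₂-swap f = ∑-comm {n} {n} (λ u v → f (u , v))

    Σ₃-swap₁₂ : ∀ f → Σ₃ f ≡ Σ₃ (λ (u , v , w) → f (v , u , w))
    Σ₃-swap₁₂ f = ∑-comm {n} {n} (λ u v → ∑ (λ w → f (u , v , w)))

    Σ₃-swap₂₃ : ∀ f → Σ₃ f ≡ Σ₃ (λ (u , v , w) → f (u , w , v))
    Σ₃-swap₂₃ f = sum-cong-≗ (λ u → Σ₂-swap (λ (v , w) → f (u , v , w)))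

  compatible : Cls → Cls → Bool → Bool
  compatible A A true = false
  compatible B B true = false
  compatible _ _ _ = true

  module Partition {n : ℕ} (adj : Fin n → Fin n → Bool) (adj-sym : ∀ u v → adj u v ≡ adj v u)
    (cls : Fin n → Cls) where

    inA inB inX inN : Fin n → ℤ
    inA u = isA (cls u)
    inB u = isB (cls u)
    inX u = isX (cls u)
    inN u = isN (cls u)

    E : Fin n → Fin n → ℤ
    E u v = ⟦ adj u v ⟧

    F : Fin n → Fin n → Fin n → ℤ
    F u v w = E u v * (E v w * E u w)

    E-sym : ∀ u v → E u v ≡ E v u
    E-sym u v = cong ⟦_⟧ (adj-sym u v)

    F-swap₁₂ : ∀ u v w → F u v w ≡ F v u w
    F-swap₁₂ u v w = cong₂ _*_ (E-sym u v) (ℤₚ.*-comm (E v w) (E u w))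

    F-swap₂₃ : ∀ u v w → F u v w ≡ F u w v
    F-swap₂₃ u v w = trans (cong (λ z → E u v * (z * E u w)) (E-sym v w)) (lem (E u v) (E w v) (E u w))
      where
      lem : ∀ a b c → a * (b * c) ≡ c * (b * a)
      lem a b c = solve (a ∷ b ∷ c ∷ [])

    p q x : ℤ
    p = ∑ inA
    q = ∑ inB
    x = ∑ inX

    a c d : Fin n → ℤ
    a u = ∑ (λ w → inA w * E u w)
    c u = ∑ (λ w → inB w * E u w)
    d u = ∑ (λ w → inX w * E u w)

    t ρ s : Fin n → ℤ
    t u = Σ₂ (λ (v , w) → (inA v * inB w) * F u v w)
    ρ u = Σ₂ (λ (v , w) → (inA v * inB w) * (E u v * E u w * (1ℤ - E v w)))
    s u = Σ₂ (λ (v , w) → (inX v * inN w) * F u v w)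

    -- All counts are of ordered tuples. `Z` counts non-adjacent `u`, `v` in X together with a `w`
    -- in A ∪ B that is adjacent to exactly one of them; `Y` measures how far the vertices of A ∪ B
    -- are from seeing half of X.
    M τ r e₂ C Z Y : ℤ
    M = Σ₂ (λ (u , v) → E u v)
    τ = Σ₃ (λ (u , v , w) → F u v w)
    r = Σ₂ (λ (v , w) → (inA v * inB w) * (1ℤ - E v w))
    e₂ = ∑ (λ u → inX u * d u)
    C = ∑ (λ u → inX u * s u)
    Z = Σ₃ (λ (u , v , w) → (inX u * inX v * inN w) * ((1ℤ - E u v) * (E w u + E w v - + 2 * (E w u * E w v))))
    Y = ∑ (λ w → inN w * ((x - + 2 * d w) * (x - + 2 * d w)))

    classes-total : p + q + x ≡ + n
    classes-total = trans (≡-sym (total-zero′ )) (trans (∑-const n 1ℤ) (ℤₚ.*-identityʳ (+ n)))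
      where
      total-zero′ : ∑ {n} (λ _ → 1ℤ) ≡ p + q + x
      total-zero′ = trans (sum-cong-≗ (λ u → pt (cls u)))
                    (trans (∑-distrib-+ (λ u → inA u + inB u) inX) (cong (λ z → z + x) (∑-distrib-+ inA inB)))
        where
        pt : ∀ c → 1ℤ ≡ isA c + isB c + isX c
        pt = exhaust (all-Cls? λ _ → _ ≟ _)

    a+c : ∀ u → a u + c u ≡ ∑ (λ w → inN w * E u w)
    a+c u = ≡-sym (trans (sum-cong-≗ (λ w → ℤₚ.*-distribʳ-+ (E u w) (inA w) (inB w)))
                         (∑-distrib-+ (λ w → inA w * E u w) (λ w → inB w * E u w)))

    t-pos : ∀ u → Pos (t u)
    t-pos u = positive (∑₂ n) (λ (v , w) → pt (cls v) (cls w) (adj u v) (adj v w) (adj u w))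
      where
      pt : ∀ c c′ e e′ e″ → Pos ((isA c * isB c′) * (⟦ e ⟧ * (⟦ e′ ⟧ * ⟦ e″ ⟧)))
      pt = exhaust (all-Cls? λ _ → all-Cls? λ _ → all-Bool? λ _ → all-Bool? λ _ → all-Bool? λ _ → _ ≤? _)

    s-pos : ∀ u → Pos (s u)
    s-pos u = positive (∑₂ n) (λ (v , w) → pt (cls v) (cls w) (adj u v) (adj v w) (adj u w))
      where
      pt : ∀ c c′ e e′ e″ → Pos ((isX c * isN c′) * (⟦ e ⟧ * (⟦ e′ ⟧ * ⟦ e″ ⟧)))
      pt = exhaust (all-Cls? λ _ → all-Cls? λ _ → all-Bool? λ _ → all-Bool? λ _ → all-Bool? λ _ → _ ≤? _)

    ρ-pos : ∀ u → Pos (ρ u)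
    ρ-pos u = positive (∑₂ n) (λ (v , w) → pt (cls v) (cls w) (adj u v) (adj v w) (adj u w))
      where
      pt : ∀ c c′ e e′ e″ → Pos ((isA c * isB c′) * (⟦ e ⟧ * ⟦ e″ ⟧ * (1ℤ - ⟦ e′ ⟧)))
      pt = exhaust (all-Cls? λ _ → all-Cls? λ _ → all-Bool? λ _ → all-Bool? λ _ → all-Bool? λ _ → _ ≤? _)

    ρ≤r : ∀ u → Pos (r - ρ u)
    ρ≤r u = total-pos (∑₂ n)
        ((1ℤ , (λ (v , w) → (inA v * inB w) * (1ℤ - E v w)))
        ∷ (-1ℤ , (λ (v , w) → (inA v * inB w) * (E u v * E u w * (1ℤ - E v w)))) ∷ [])
        (λ (v , w) → pt (cls v) (cls w) (adj u v) (adj v w) (adj u w)) ∴ lem r (ρ u)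
      where
      pt : ∀ c c′ e e′ e″ → Pos (1ℤ * ((isA c * isB c′) * (1ℤ - ⟦ e′ ⟧))
                                + (-1ℤ * ((isA c * isB c′) * (⟦ e ⟧ * ⟦ e″ ⟧ * (1ℤ - ⟦ e′ ⟧))) + 0ℤ))
      pt = exhaust (all-Cls? λ _ → all-Cls? λ _ → all-Bool? λ _ → all-Bool? λ _ → all-Bool? λ _ → _ ≤? _)
      lem : ∀ r ρ → 1ℤ * r + (-1ℤ * ρ + 0ℤ) ≡ r - ρ
      lem r ρ = solve (r ∷ ρ ∷ [])

    ac≡t+ρ : ∀ u → a u * c u ≡ t u + ρ u
    ac≡t+ρ u = trans (≡-sym (∑∑-* (λ v → inA v * E u v) (λ w → inB w * E u w)))
      (trans (cong-Φ (∑₂ n) (λ (v , w) → pt (cls v) (cls w) (adj u v) (adj v w) (adj u w)))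
             (add (∑₂ n) (λ (v , w) → (inA v * inB w) * F u v w)
                         (λ (v , w) → (inA v * inB w) * (E u v * E u w * (1ℤ - E v w)))))
      where
      pt : ∀ c c′ e e′ e″ → isA c * ⟦ e ⟧ * (isB c′ * ⟦ e″ ⟧)
         ≡ (isA c * isB c′) * (⟦ e ⟧ * (⟦ e′ ⟧ * ⟦ e″ ⟧)) + (isA c * isB c′) * (⟦ e ⟧ * ⟦ e″ ⟧ * (1ℤ - ⟦ e′ ⟧))
      pt = exhaust (all-Cls? λ _ → all-Cls? λ _ → all-Bool? λ _ → all-Bool? λ _ → all-Bool? λ _ → _ ≟ _)

    s≤x[a+c] : ∀ u → Pos (x * (a u + c u) - s u)
    s≤x[a+c] u = total-pos (∑₂ n)
        ((1ℤ , (λ (v , w) → inX v * (inN w * E u w))) ∷ (-1ℤ , (λ (v , w) → (inX v * inN w) * F u v w)) ∷ [])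
        (λ (v , w) → pt (cls v) (cls w) (adj u v) (adj v w) (adj u w))
        ∴ trans (cong (λ z → 1ℤ * z + (-1ℤ * s u + 0ℤ))
                  (trans (∑∑-* inX (λ w → inN w * E u w)) (cong (λ z → x * z) (≡-sym (a+c u)))))
                (lem (x * (a u + c u)) (s u))
      where
      pt : ∀ c c′ e e′ e″ → Pos (1ℤ * (isX c * (isN c′ * ⟦ e″ ⟧))
                                + (-1ℤ * ((isX c * isN c′) * (⟦ e ⟧ * (⟦ e′ ⟧ * ⟦ e″ ⟧))) + 0ℤ))
      pt = exhaust (all-Cls? λ _ → all-Cls? λ _ → all-Bool? λ _ → all-Bool? λ _ → all-Bool? λ _ → _ ≤? _)
      lem : ∀ y z → 1ℤ * y + (-1ℤ * z + 0ℤ) ≡ y - z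
      lem y z = solve (y ∷ z ∷ [])

    degree-pos : ∀ (k : Fin n → ℤ) → (∀ v → Pos (k v)) → ∀ u → Pos (∑ (λ w → k w * E u w))
    degree-pos k hk u = ∑-positive (λ w → hk w ⊗ pos (ind (adj u w)))

    degree≤ : ∀ (k : Fin n → ℤ) → (∀ v → Pos (k v)) → ∀ u → Pos (∑ k - ∑ (λ w → k w * E u w))
    degree≤ k hk u = total-pos (∑₁ n) ((1ℤ , k) ∷ (-1ℤ , (λ w → k w * E u w)) ∷ [])
                       (λ w → pt (adj u w) (hk w)) ∴ lem (∑ k) (∑ (λ w → k w * E u w))
      where
      pt : ∀ e {k} → Pos k → Pos (1ℤ * k + (-1ℤ * (k * ⟦ e ⟧) + 0ℤ))
      pt true {k} h = pos 0 ∴ solve (k ∷ [])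
      pt false {k} h = h ∴ solve (k ∷ [])
      lem : ∀ y z → 1ℤ * y + (-1ℤ * z + 0ℤ) ≡ y - z
      lem y z = solve (y ∷ z ∷ [])

    inA-pos : ∀ u → Pos (inA u)
    inA-pos u = pt (cls u)
      where
      pt : ∀ c → Pos (isA c)
      pt = exhaust (all-Cls? λ _ → _ ≤? _)

    inB-pos : ∀ u → Pos (inB u)
    inB-pos u = pt (cls u)
      where
      pt : ∀ c → Pos (isB c)
      pt = exhaust (all-Cls? λ _ → _ ≤? _)

    inX-pos : ∀ u → Pos (inX u)
    inX-pos u = pt (cls u)
      where
      pt : ∀ c → Pos (isX c)
      pt = exhaust (all-Cls? λ _ → _ ≤? _)

    inN-pos : ∀ u → Pos (inN u)
    inN-pos u = inA-pos u ⊕ inB-pos u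

    module Triangles where

      -- Summed over the six orders of a triangle, this is at most 6.
      weight : Cls → Cls → Cls → ℤ
      weight c₁ c₂ c₃ = + 6 * (isX c₁ * (isA c₂ * isB c₃)) + + 3 * (isX c₁ * (isX c₂ * isN c₃))

      W : (Fin n → Fin n → Fin n → ℤ) → ℤ
      W k = Σ₃ (λ (u , v , w) → k u v w * F u v w)

      W-swap₁₂ : ∀ k → W k ≡ W (λ u v w → k v u w)
      W-swap₁₂ k = trans (Σ₃-swap₁₂ (λ (u , v , w) → k u v w * F u v w))
                         (cong-Φ (∑₃ n) (λ (u , v , w) → cong (λ z → k v u w * z) (F-swap₁₂ v u w)))

      W-swap₂₃ : ∀ k → W k ≡ W (λ u v w → k u w v)
      W-swap₂₃ k = trans (Σ₃-swap₂₃ (λ (u , v , w) → k u v w * F u v w))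
                         (cong-Φ (∑₃ n) (λ (u , v , w) → cong (λ z → k u w v * z) (F-swap₂₃ u w v)))

      k₁₂₃ k₁₃₂ k₂₁₃ k₂₃₁ k₃₁₂ k₃₂₁ : Fin n → Fin n → Fin n → ℤ
      k₁₂₃ u v w = weight (cls u) (cls v) (cls w)
      k₁₃₂ u v w = weight (cls u) (cls w) (cls v)
      k₂₁₃ u v w = weight (cls v) (cls u) (cls w)
      k₂₃₁ u v w = weight (cls v) (cls w) (cls u)
      k₃₁₂ u v w = weight (cls w) (cls u) (cls v)
      k₃₂₁ u v w = weight (cls w) (cls v) (cls u)

      W₁₃₂ : W k₁₂₃ ≡ W k₁₃₂
      W₁₃₂ = W-swap₂₃ k₁₂₃
      W₂₁₃ : W k₁₂₃ ≡ W k₂₁₃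
      W₂₁₃ = W-swap₁₂ k₁₂₃
      W₂₃₁ : W k₁₂₃ ≡ W k₂₃₁
      W₂₃₁ = trans W₁₃₂ (W-swap₁₂ k₁₃₂)
      W₃₁₂ : W k₁₂₃ ≡ W k₃₁₂
      W₃₁₂ = trans W₂₁₃ (W-swap₂₃ k₂₁₃)
      W₃₂₁ : W k₁₂₃ ≡ W k₃₂₁
      W₃₂₁ = trans W₂₃₁ (W-swap₂₃ k₂₃₁)

      -- The six permuted sums are equal, so six times the claim is a single sum over ordered
      -- triangles, whose integrand is nonnegative for every choice of classes.
      W≤τ : Pos (τ - W k₁₂₃)
      W≤τ = Pos-cancel {+ 6} {τ - W k₁₂₃} (pos 5)
          (total-pos (∑₃ n)
            ((+ 6 , (λ (u , v , w) → F u v w))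
            ∷ (-1ℤ , (λ (u , v , w) → k₁₂₃ u v w * F u v w)) ∷ (-1ℤ , (λ (u , v , w) → k₁₃₂ u v w * F u v w))
            ∷ (-1ℤ , (λ (u , v , w) → k₂₁₃ u v w * F u v w)) ∷ (-1ℤ , (λ (u , v , w) → k₂₃₁ u v w * F u v w))
            ∷ (-1ℤ , (λ (u , v , w) → k₃₁₂ u v w * F u v w)) ∷ (-1ℤ , (λ (u , v , w) → k₃₂₁ u v w * F u v w)) ∷ [])
            (λ (u , v , w) → pt (cls u) (cls v) (cls w) (adj u v) (adj v w) (adj u w))
          ∴ lem τ (W k₁₂₃) W₁₃₂ W₂₁₃ W₂₃₁ W₃₁₂ W₃₂₁)
        where
        pt : ∀ c₁ c₂ c₃ e e′ e″ →
          Pos (+ 6 * (⟦ e ⟧ * (⟦ e′ ⟧ * ⟦ e″ ⟧))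
            + (-1ℤ * (weight c₁ c₂ c₃ * (⟦ e ⟧ * (⟦ e′ ⟧ * ⟦ e″ ⟧))) + (-1ℤ * (weight c₁ c₃ c₂ * (⟦ e ⟧ * (⟦ e′ ⟧ * ⟦ e″ ⟧)))
            + (-1ℤ * (weight c₂ c₁ c₃ * (⟦ e ⟧ * (⟦ e′ ⟧ * ⟦ e″ ⟧))) + (-1ℤ * (weight c₂ c₃ c₁ * (⟦ e ⟧ * (⟦ e′ ⟧ * ⟦ e″ ⟧)))
            + (-1ℤ * (weight c₃ c₁ c₂ * (⟦ e ⟧ * (⟦ e′ ⟧ * ⟦ e″ ⟧))) + (-1ℤ * (weight c₃ c₂ c₁ * (⟦ e ⟧ * (⟦ e′ ⟧ * ⟦ e″ ⟧))) + 0ℤ)))))))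
        pt = exhaust (all-Cls? λ _ → all-Cls? λ _ → all-Cls? λ _ →
                      all-Bool? λ _ → all-Bool? λ _ → all-Bool? λ _ → _ ≤? _)
        lem : ∀ t w {w₁ w₂ w₃ w₄ w₅} → w ≡ w₁ → w ≡ w₂ → w ≡ w₃ → w ≡ w₄ → w ≡ w₅ →
          + 6 * t + (-1ℤ * w + (-1ℤ * w₁ + (-1ℤ * w₂ + (-1ℤ * w₃ + (-1ℤ * w₄ + (-1ℤ * w₅ + 0ℤ)))))) ≡ + 6 * (t - w)
        lem t w refl refl refl refl refl = solve (t ∷ w ∷ [])

      W≡ : W k₁₂₃ ≡ + 6 * ∑ (λ u → inX u * t u) + + 3 * C
      W≡ = trans (cong-Φ (∑₃ n) (λ (u , v , w) → pt (cls u) (cls v) (cls w) (F u v w)))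
           (trans (Φ-total (∑₃ n) L)
           (trans (cong₂ (λ y z → + 6 * y + (+ 3 * z + 0ℤ))
              (sum-cong-≗ (λ u → scale (∑₂ n) (inX u) (λ (v , w) → (inA v * inB w) * F u v w)))
              (sum-cong-≗ (λ u → scale (∑₂ n) (inX u) (λ (v , w) → (inX v * inN w) * F u v w))))
           (lem (∑ (λ u → inX u * t u)) C)))
        where
        L : Terms (Fin n × Fin n × Fin n)
        L = (+ 6 , (λ (u , v , w) → inX u * ((inA v * inB w) * F u v w)))
          ∷ (+ 3 , (λ (u , v , w) → inX u * ((inX v * inN w) * F u v w))) ∷ []
        pt′ : ∀ x₁ x₂ a b m f → (+ 6 * (x₁ * (a * b)) + + 3 * (x₁ * (x₂ * m))) * f
          ≡ + 6 * (x₁ * ((a * b) * f)) + (+ 3 * (x₁ * ((x₂ * m) * f)) + 0ℤ)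
        pt′ x₁ x₂ a b m f = solve (x₁ ∷ x₂ ∷ a ∷ b ∷ m ∷ f ∷ [])
        pt : ∀ c₁ c₂ c₃ f → weight c₁ c₂ c₃ * f
          ≡ + 6 * (isX c₁ * ((isA c₂ * isB c₃) * f)) + (+ 3 * (isX c₁ * ((isX c₂ * isN c₃) * f)) + 0ℤ)
        pt c₁ c₂ c₃ f = pt′ (isX c₁) (isX c₂) (isA c₂) (isB c₃) (isN c₃) f
        lem : ∀ y z → + 6 * y + (+ 3 * z + 0ℤ) ≡ + 6 * y + + 3 * z
        lem y z = solve (y ∷ z ∷ [])

    triangles : Pos (τ - (+ 6 * ∑ (λ u → inX u * t u) + + 3 * C))
    triangles = Triangles.W≤τ ∴ cong (λ z → τ - z) Triangles.W≡

    module Book (b : ℤ) (book : ∀ u w → Pos (E u w * (b - ∑ (λ v → E w v * E u v)))) where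

      private
        paths : (Fin n → ℤ) → Fin n → ℤ
        paths k u = Σ₂ (λ (w , v) → k w * F u w v)

        -- `paths k u` adds up the codegrees of the edges from `u` to the class `k`, each of which
        -- is at most `b`.
        paths≤ : ∀ k → (∀ w → Pos (k w)) → ∀ u → Pos (b * ∑ (λ w → k w * E u w) - paths k u)
        paths≤ k hk u = ∑-positive (λ w → hk w ⊗ book u w)
          ∴ trans (sum-cong-≗ (λ w → trans (lem (k w) (E u w) (cod w))
                     (cong (λ z → b * (k w * E u w) + (-1ℤ * z + 0ℤ))
                       (trans (cong (λ z → k w * z) (*-distribˡ-sum (E u w) (λ v → E w v * E u v)))
                              (*-distribˡ-sum (k w) (λ v → F u w v))))))
            (trans (Φ-total (∑₁ n) ((b , (λ w → k w * E u w)) ∷ (-1ℤ , (λ w → ∑ (λ v → k w * F u w v))) ∷ []))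
                   (lem′ (b * ∑ (λ w → k w * E u w)) (paths k u)))
          where
          cod : Fin n → ℤ
          cod w = ∑ (λ v → E w v * E u v)
          lem : ∀ k e z → k * (e * (b - z)) ≡ b * (k * e) + (-1ℤ * (k * (e * z)) + 0ℤ)
          lem k e z = solve (b ∷ k ∷ e ∷ z ∷ [])
          lem′ : ∀ y z → y + (-1ℤ * z + 0ℤ) ≡ y - z
          lem′ y z = solve (y ∷ z ∷ [])

        sA sB : Fin n → ℤ
        sA u = Σ₂ (λ (w , v) → (inA w * inX v) * F u w v)
        sB u = Σ₂ (λ (w , v) → (inB w * inX v) * F u w v)

        lem₃ : ∀ y z w → 1ℤ * y + (-1ℤ * z + (-1ℤ * w + 0ℤ)) ≡ y - z - w
        lem₃ y z w = solve (y ∷ z ∷ w ∷ [])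

        pathsA : ∀ u → Pos (paths inA u - t u - sA u)
        pathsA u = total-pos (∑₂ n)
          ((1ℤ , (λ (w , v) → inA w * F u w v)) ∷ (-1ℤ , (λ (w , v) → (inA w * inB v) * F u w v))
            ∷ (-1ℤ , (λ (w , v) → (inA w * inX v) * F u w v)) ∷ [])
          (λ (w , v) → pt (cls w) (cls v) (adj u w) (adj w v) (adj u v)) ∴ lem₃ (paths inA u) (t u) (sA u)
          where
          pt : ∀ c c′ e e′ e″ → Pos (1ℤ * (isA c * (⟦ e ⟧ * (⟦ e′ ⟧ * ⟦ e″ ⟧)))
            + (-1ℤ * ((isA c * isB c′) * (⟦ e ⟧ * (⟦ e′ ⟧ * ⟦ e″ ⟧))) + (-1ℤ * ((isA c * isX c′) * (⟦ e ⟧ * (⟦ e′ ⟧ * ⟦ e″ ⟧))) + 0ℤ)))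
          pt = exhaust (all-Cls? λ _ → all-Cls? λ _ → all-Bool? λ _ → all-Bool? λ _ → all-Bool? λ _ → _ ≤? _)

        pathsB : ∀ u → Pos (paths inB u - t u - sB u)
        pathsB u = total-pos (∑₂ n)
          ((1ℤ , (λ (w , v) → inB w * F u w v)) ∷ (-1ℤ , (λ (w , v) → (inB w * inA v) * F u w v))
            ∷ (-1ℤ , (λ (w , v) → (inB w * inX v) * F u w v)) ∷ [])
          (λ (w , v) → pt (cls w) (cls v) (adj u w) (adj w v) (adj u v))
          ∴ trans (cong (λ z → 1ℤ * paths inB u + (-1ℤ * z + (-1ℤ * sB u + 0ℤ))) t-swap)
                  (lem₃ (paths inB u) (t u) (sB u))
          where
          pt : ∀ c c′ e e′ e″ → Pos (1ℤ * (isB c * (⟦ e ⟧ * (⟦ e′ ⟧ * ⟦ e″ ⟧)))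
            + (-1ℤ * ((isB c * isA c′) * (⟦ e ⟧ * (⟦ e′ ⟧ * ⟦ e″ ⟧))) + (-1ℤ * ((isB c * isX c′) * (⟦ e ⟧ * (⟦ e′ ⟧ * ⟦ e″ ⟧))) + 0ℤ)))
          pt = exhaust (all-Cls? λ _ → all-Cls? λ _ → all-Bool? λ _ → all-Bool? λ _ → all-Bool? λ _ → _ ≤? _)
          t-swap : Σ₂ (λ (w , v) → (inB w * inA v) * F u w v) ≡ t u
          t-swap = trans (Σ₂-swap (λ (w , v) → (inB w * inA v) * F u w v))
            (cong-Φ (∑₂ n) (λ (v , w) → cong₂ _*_ (ℤₚ.*-comm (inB w) (inA v)) (F-swap₂₃ u w v)))

        s≡sA+sB : ∀ u → s u ≡ sA u + sB u
        s≡sA+sB u = trans (Σ₂-swap (λ (v , w) → (inX v * inN w) * F u v w))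
          (trans (cong-Φ (∑₂ n) (λ (w , v) → trans (cong (λ z → (inX v * inN w) * z) (F-swap₂₃ u v w))
                                                   (lem (inX v) (inA w) (inB w) (F u w v))))
                 (add (∑₂ n) (λ (w , v) → (inA w * inX v) * F u w v) (λ (w , v) → (inB w * inX v) * F u w v)))
          where
          lem : ∀ x a b f → (x * (a + b)) * f ≡ (a * x) * f + (b * x) * f
          lem x a b f = solve (x ∷ a ∷ b ∷ f ∷ [])

        sub-sum : ∀ {y z k w} → Pos (y - z) → Pos (z - k - w) → Pos (y - k - w)
        sub-sum {y} {z} {k} {w} h h′ = h ⊕ h′ ∴ solve (y ∷ z ∷ k ∷ w ∷ [])

        book-A : ∀ u → Pos (b * a u - t u - sA u)
        book-A u = sub-sum {b * a u} {paths inA u} {t u} {sA u} (paths≤ inA inA-pos u) (pathsA u)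

        book-B : ∀ u → Pos (b * c u - t u - sB u)
        book-B u = sub-sum {b * c u} {paths inB u} {t u} {sB u} (paths≤ inB inB-pos u) (pathsB u)

        nonneg : ∀ (k k′ : Cls → ℤ) → (∀ c c′ e e′ e″ → Pos ((k c * k′ c′) * (⟦ e ⟧ * (⟦ e′ ⟧ * ⟦ e″ ⟧)))) →
          ∀ u → Pos (Σ₂ (λ (w , v) → (k (cls w) * k′ (cls v)) * F u w v))
        nonneg k k′ pt u = positive (∑₂ n) (λ (w , v) → pt (cls w) (cls v) (adj u w) (adj w v) (adj u v))

        sA-pos : ∀ u → Pos (sA u)
        sA-pos = nonneg isA isX (exhaust (all-Cls? λ _ → all-Cls? λ _ → all-Bool? λ _ → all-Bool? λ _ → all-Bool? λ _ → _ ≤? _))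

        sB-pos : ∀ u → Pos (sB u)
        sB-pos = nonneg isB isX (exhaust (all-Cls? λ _ → all-Cls? λ _ → all-Bool? λ _ → all-Bool? λ _ → all-Bool? λ _ → _ ≤? _))

        drop : ∀ {y z w} → Pos (y - z - w) → Pos w → Pos (y - z)
        drop {y} {z} {w} h h′ = h ⊕ h′ ∴ solve (y ∷ z ∷ w ∷ [])

      t≤ba : ∀ u → Pos (b * a u - t u)
      t≤ba u = drop {b * a u} {t u} {sA u} (book-A u) (sA-pos u)

      t≤bc : ∀ u → Pos (b * c u - t u)
      t≤bc u = drop {b * c u} {t u} {sB u} (book-B u) (sB-pos u)

      -- Summing the codegrees of the edges from `u` to A and to B meets an A × B triangle twice,
      -- once from each end, and an X × (A ∪ B) triangle once, from its end outside X.
      2t+s≤b[a+c] : ∀ u → Pos (b * (a u + c u) - (+ 2 * t u + s u))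
      2t+s≤b[a+c] u = book-A u ⊕ book-B u ∴ lem (a u) (c u) (t u) (s≡sA+sB u)
        where
        lem : ∀ a c t {s y z} → s ≡ y + z → b * a - t - y + (b * c - t - z) ≡ b * (a + c) - (+ 2 * t + s)
        lem a c t {s} {y} {z} refl = solve (b ∷ a ∷ c ∷ t ∷ y ∷ z ∷ [])

    module Edges (indep : ∀ u v → compatible (cls u) (cls v) (adj u v) ≡ true) where

      private
        weight : Cls → Cls → ℤ
        weight c c′ = + 2 * (isA c * isB c′) + + 2 * (isX c * isN c′) + isX c * isX c′

        W : (Fin n → Fin n → ℤ) → ℤ
        W k = Σ₂ (λ (u , v) → k u v * E u v)

        k₁₂ k₂₁ : Fin n → Fin n → ℤ
        k₁₂ u v = weight (cls u) (cls v)
        k₂₁ u v = weight (cls v) (cls u)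

        W₂₁ : W k₁₂ ≡ W k₂₁
        W₂₁ = trans (Σ₂-swap (λ (u , v) → k₁₂ u v * E u v))
                    (cong-Φ (∑₂ n) (λ (u , v) → cong (λ z → k₁₂ v u * z) (E-sym v u)))

        -- Independence of A and B leaves only edges A-B, X-(A ∪ B) and X-X. Adding the weights for
        -- both orders of an edge gives 2 for each kind, and the two weighted sums agree by
        -- symmetry.
        M≡W : M ≡ W k₁₂
        M≡W = ≡-sym (≡0⇒≡ (ℤₚ.*-cancelˡ-≡ (+ 2) (M - W k₁₂) 0ℤ (trans (≡-sym (lem M (W k₁₂) W₂₁))
           (total-zero (∑₂ n) ((+ 2 , (λ (u , v) → E u v)) ∷ (-1ℤ , (λ (u , v) → k₁₂ u v * E u v))
                               ∷ (-1ℤ , (λ (u , v) → k₂₁ u v * E u v)) ∷ [])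
                              (λ (u , v) → pt (cls u) (cls v) (adj u v) (indep u v))))))
          where
          pt : ∀ c c′ e → compatible c c′ e ≡ true →
            + 2 * ⟦ e ⟧ + (-1ℤ * (weight c c′ * ⟦ e ⟧) + (-1ℤ * (weight c′ c * ⟦ e ⟧) + 0ℤ)) ≡ 0ℤ
          pt = exhaust (all-Cls? λ _ → all-Cls? λ _ → all-Bool? λ _ → (_ Boolₚ.≟ _) →-dec (_ ≟ _))
          lem : ∀ m w {w′} → w ≡ w′ → + 2 * m + (-1ℤ * w + (-1ℤ * w′ + 0ℤ)) ≡ + 2 * (m - w)
          lem m w refl = solve (m ∷ w ∷ [])

        Q : ℤ
        Q = ∑ (λ u → inX u * (a u + c u))

        W≡ : W k₁₂ ≡ + 2 * (p * q - r) + + 2 * Q + e₂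
        W≡ = trans (cong-Φ (∑₂ n) (λ (u , v) → pt (inA u) (inB v) (inX u) (inN v) (inX v) (E u v)))
          (trans (Φ-total (∑₂ n) L)
          (trans (cong₂ (λ y z → + 2 * y + (- + 2 * r + (+ 2 * z + (1ℤ * Σ₂ (λ (u , v) → inX u * (inX v * E u v)) + 0ℤ))))
                   (∑∑-* inA inB)
                   (sum-cong-≗ (λ u → trans (≡-sym (*-distribˡ-sum (inX u) (λ v → inN v * E u v)))
                                            (cong (λ z → inX u * z) (≡-sym (a+c u))))))
          (trans (cong (λ z → + 2 * (p * q) + (- + 2 * r + (+ 2 * Q + (1ℤ * z + 0ℤ))))
                   (sum-cong-≗ (λ u → ≡-sym (*-distribˡ-sum (inX u) (λ v → inX v * E u v)))))
                 (lem (p * q) r Q e₂))))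
          where
          L : Terms (Fin n × Fin n)
          L = (+ 2 , (λ (u , v) → inA u * inB v)) ∷ (- + 2 , (λ (v , w) → (inA v * inB w) * (1ℤ - E v w)))
            ∷ (+ 2 , (λ (u , v) → inX u * (inN v * E u v))) ∷ (1ℤ , (λ (u , v) → inX u * (inX v * E u v))) ∷ []
          pt : ∀ a b x m y e → (+ 2 * (a * b) + + 2 * (x * m) + x * y) * e
            ≡ + 2 * (a * b) + (- + 2 * ((a * b) * (1ℤ - e)) + (+ 2 * (x * (m * e)) + (1ℤ * (x * (y * e)) + 0ℤ)))
          pt a b x m y e = solve (a ∷ b ∷ x ∷ m ∷ y ∷ e ∷ [])
          lem : ∀ y r q e → + 2 * y + (- + 2 * r + (+ 2 * q + (1ℤ * e + 0ℤ))) ≡ + 2 * (y - r) + + 2 * q + e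
          lem y r q e = solve (y ∷ r ∷ q ∷ e ∷ [])

      -- With `n = p + q + x`, the term `4pq` of `2M` meets `(p + q)²` from `n²` and leaves
      -- `- (p - q)²`. This is where imbalance and missing A-B pairs become a cost.
      edges : ∀ b → Pos (+ 2 * M - + n * + n) →
        Pos (+ 4 * ∑ (λ u → inX u * (a u + c u - + 2 * b)) + + 2 * e₂ + x * x - (p - q) * (p - q)
             - + 2 * x * (+ n - + 4 * b) - + 4 * r)
      edges b h = h ∴ trans (cong₂ (λ y z → + 2 * y - z * z) (trans M≡W W≡) (≡-sym classes-total))
         (trans (lem p q r Q e₂ x b)
          (cong₂ (λ y z → + 4 * y + + 2 * e₂ + x * x - (p - q) * (p - q) - + 2 * x * (z - + 4 * b) - + 4 * r)
            (≡-sym S≡) classes-total))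
        where
        S≡ : ∑ (λ u → inX u * (a u + c u - + 2 * b)) ≡ Q - + 2 * b * x
        S≡ = trans (sum-cong-≗ (λ u → pt (inX u) (a u + c u) b))
               (trans (Φ-total (∑₁ n) ((1ℤ , (λ u → inX u * (a u + c u))) ∷ (- (+ 2 * b) , inX) ∷ []))
                      (lem₂ Q b x))
          where
          pt : ∀ x m b → x * (m - + 2 * b) ≡ 1ℤ * (x * m) + (- (+ 2 * b) * x + 0ℤ)
          pt x m b = solve (x ∷ m ∷ b ∷ [])
          lem₂ : ∀ q b x → 1ℤ * q + (- (+ 2 * b) * x + 0ℤ) ≡ q - + 2 * b * x
          lem₂ q b x = solve (q ∷ b ∷ x ∷ [])
        lem : ∀ p q r Q e₂ x b → + 2 * (+ 2 * (p * q - r) + + 2 * Q + e₂) - (p + q + x) * (p + q + x)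
          ≡ + 4 * (Q - + 2 * b * x) + + 2 * e₂ + x * x - (p - q) * (p - q) - + 2 * x * (p + q + x - + 4 * b) - + 4 * r
        lem p q r Q e₂ x b = solve (p ∷ q ∷ r ∷ Q ∷ e₂ ∷ x ∷ b ∷ [])

    -- Double counting of the (u , v , w) with u, v ∈ X and w ∈ A ∪ B adjacent to exactly one of u and v.
    neighbourhoods : ∀ b → + 8 * b * e₂ + + 4 * ∑ (λ u → inX u * ((a u + c u - + 2 * b) * d u)) - + 4 * C + + 2 * Z + Y
                     ≡ (+ n - x) * (x * x)
    neighbourhoods b =
      trans (lem b e₂ Sd C Z Y)
        (trans (cong (λ z → + 2 * z + Y) (trans (cong (λ z → Z + + 2 * z - + 2 * C) (≡-sym G≡)) (≡-sym D≡)))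
          (trans (cong (λ z → + 2 * z + Y) D≡′)
            (trans D+Y (cong (λ z → z * (x * x)) (trans (lem₂ p q x) (cong (λ z → z - x) classes-total))))))
      where
      Sd G D : ℤ
      Sd = ∑ (λ u → inX u * ((a u + c u - + 2 * b) * d u))
      G = ∑ (λ u → inX u * ((a u + c u) * d u))
      D = Σ₃ (λ (u , v , w) → (inX u * inX v * inN w) * (E w u + E w v - + 2 * (E w u * E w v)))

      lem : ∀ b e s c z y → + 8 * b * e + + 4 * s - + 4 * c + + 2 * z + y ≡ + 2 * (z + + 2 * (s + + 2 * b * e) - + 2 * c) + y
      lem b e s c z y = solve (b ∷ e ∷ s ∷ c ∷ z ∷ y ∷ [])

      lem₂ : ∀ p q x → p + q ≡ p + q + x - x
      lem₂ p q x = solve (p ∷ q ∷ x ∷ [])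

      G≡ : G ≡ Sd + + 2 * b * e₂
      G≡ = trans (sum-cong-≗ (λ u → pt (inX u) (a u + c u) b (d u)))
           (trans (Φ-total (∑₁ n) ((1ℤ , (λ u → inX u * ((a u + c u - + 2 * b) * d u))) ∷ (+ 2 * b , (λ u → inX u * d u)) ∷ []))
                  (lem₃ Sd b e₂))
        where
        pt : ∀ x m b d → x * (m * d) ≡ 1ℤ * (x * ((m - + 2 * b) * d)) + (+ 2 * b * (x * d) + 0ℤ)
        pt x m b d = solve (x ∷ m ∷ b ∷ d ∷ [])
        lem₃ : ∀ s b e → 1ℤ * s + (+ 2 * b * e + 0ℤ) ≡ s + + 2 * b * e
        lem₃ s b e = solve (s ∷ b ∷ e ∷ [])

      XXN : Fin n × Fin n × Fin n → ℤ
      XXN (u , v , w) = inX u * inX v * inN w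

      common : Σ₃ (λ (u , v , w) → XXN (u , v , w) * (E u v * (E w u * E w v))) ≡ C
      common = trans (cong-Φ (∑₃ n) (λ (u , v , w) →
          trans (cong₂ (λ y z → XXN (u , v , w) * (E u v * (y * z))) (E-sym w u) (E-sym w v))
                (pt (inX u) (inX v) (inN w) (E u v) (E u w) (E v w))))
        (sum-cong-≗ (λ u → scale (∑₂ n) (inX u) (λ (v , w) → (inX v * inN w) * F u v w)))
        where
        pt : ∀ x y m e f g → x * y * m * (e * (f * g)) ≡ x * ((y * m) * (e * (g * f)))
        pt x y m e f g = solve (x ∷ y ∷ m ∷ e ∷ f ∷ g ∷ [])

      first : Σ₃ (λ (u , v , w) → XXN (u , v , w) * (E u v * E w u)) ≡ G
      first = trans (cong-Φ (∑₃ n) (λ (u , v , w) →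
          trans (cong (λ y → XXN (u , v , w) * (E u v * y)) (E-sym w u))
                (pt (inX u) (inX v) (inN w) (E u v) (E u w))))
        (sum-cong-≗ (λ u → trans (scale (∑₂ n) (inX u) (λ (v , w) → (inX v * E u v) * (inN w * E u w)))
          (cong (λ z → inX u * z) (trans (∑∑-* (λ v → inX v * E u v) (λ w → inN w * E u w))
            (trans (ℤₚ.*-comm (d u) (∑ (λ w → inN w * E u w))) (cong (λ z → z * d u) (≡-sym (a+c u))))))))
        where
        pt : ∀ x y m e f → x * y * m * (e * f) ≡ x * ((y * e) * (m * f))
        pt x y m e f = solve (x ∷ y ∷ m ∷ e ∷ f ∷ [])

      second : Σ₃ (λ (u , v , w) → XXN (u , v , w) * (E u v * E w v)) ≡ G
      second = trans (Σ₃-swap₁₂ (λ (u , v , w) → XXN (u , v , w) * (E u v * E w v)))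
        (trans (cong-Φ (∑₃ n) (λ (u , v , w) →
           cong₂ (λ y z → y * inN w * (z * E w u)) (ℤₚ.*-comm (inX v) (inX u)) (E-sym v u))) first)

      -- Split by whether `u` and `v` are adjacent: non-adjacent pairs give `Z`, adjacent ones give
      -- `2G - 2C` by inclusion and exclusion on their neighbourhoods in A ∪ B.
      D≡ : D ≡ Z + + 2 * G - + 2 * C
      D≡ = trans (cong-Φ (∑₃ n) (λ (u , v , w) → pt (XXN (u , v , w)) (E u v) (E w u) (E w v)))
           (trans (Φ-total (∑₃ n) L)
           (trans (cong₂ (λ y z → 1ℤ * Z + (1ℤ * y + (1ℤ * z + (- + 2 * C′ + 0ℤ)))) first second)
           (trans (cong (λ z → 1ℤ * Z + (1ℤ * G + (1ℤ * G + (- + 2 * z + 0ℤ)))) common) (lem₃ Z G C))))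
        where
        C′ : ℤ
        C′ = Σ₃ (λ (u , v , w) → XXN (u , v , w) * (E u v * (E w u * E w v)))
        L : Terms (Fin n × Fin n × Fin n)
        L = (1ℤ , (λ (u , v , w) → (inX u * inX v * inN w) * ((1ℤ - E u v) * (E w u + E w v - + 2 * (E w u * E w v)))))
          ∷ (1ℤ , (λ (u , v , w) → XXN (u , v , w) * (E u v * E w u)))
          ∷ (1ℤ , (λ (u , v , w) → XXN (u , v , w) * (E u v * E w v)))
          ∷ (- + 2 , (λ (u , v , w) → XXN (u , v , w) * (E u v * (E w u * E w v)))) ∷ []
        pt : ∀ y e f g → y * (f + g - + 2 * (f * g))
          ≡ 1ℤ * (y * ((1ℤ - e) * (f + g - + 2 * (f * g)))) + (1ℤ * (y * (e * f)) + (1ℤ * (y * (e * g)) + (- + 2 * (y * (e * (f * g))) + 0ℤ)))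
        pt y e f g = solve (y ∷ e ∷ f ∷ g ∷ [])
        lem₃ : ∀ z g c → 1ℤ * z + (1ℤ * g + (1ℤ * g + (- + 2 * c + 0ℤ))) ≡ z + + 2 * g - + 2 * c
        lem₃ z g c = solve (z ∷ g ∷ c ∷ [])

      -- Seen from `w`, the ordered pairs in X of which `w` is adjacent to exactly one number
      -- `2 d (x - d)`.
      D≡′ : D ≡ ∑ (λ w → inN w * (+ 2 * (x * d w) - + 2 * (d w * d w)))
      D≡′ = trans (Σ₃-swap₂₃ (λ (u , v , w) → (inX u * inX v * inN w) * (E w u + E w v - + 2 * (E w u * E w v))))
        (trans (Σ₃-swap₁₂ (λ (u , w , v) → (inX u * inX v * inN w) * (E w u + E w v - + 2 * (E w u * E w v))))
        (sum-cong-≗ (λ w → trans (cong-Φ (∑₂ n) (λ (u , v) → pt (inX u) (inX v) (inN w) (E w u) (E w v)))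
          (trans (scale (∑₂ n) (inN w) (λ (u , v) → at (L w) (u , v)))
            (cong (λ z → inN w * z) (trans (Φ-total (∑₂ n) (L w))
              (trans (cong₂ (λ y z → 1ℤ * y + (1ℤ * z + (- + 2 * Σ₂ (λ (u , v) → (inX u * E w u) * (inX v * E w v)) + 0ℤ)))
                        (∑∑-* (λ u → inX u * E w u) inX) (∑∑-* inX (λ v → inX v * E w v)))
              (trans (cong (λ z → 1ℤ * (d w * x) + (1ℤ * (x * d w) + (- + 2 * z + 0ℤ)))
                       (∑∑-* (λ u → inX u * E w u) (λ v → inX v * E w v)))
                     (lem₃ x (d w))))))))))
        where
        L : Fin n → Terms (Fin n × Fin n)
        L w = (1ℤ , (λ (u , v) → (inX u * E w u) * inX v)) ∷ (1ℤ , (λ (u , v) → inX u * (inX v * E w v)))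
            ∷ (- + 2 , (λ (u , v) → (inX u * E w u) * (inX v * E w v))) ∷ []
        pt : ∀ x y m e f → (x * y * m) * (e + f - + 2 * (e * f))
          ≡ m * (1ℤ * ((x * e) * y) + (1ℤ * (x * (y * f)) + (- + 2 * ((x * e) * (y * f)) + 0ℤ)))
        pt x y m e f = solve (x ∷ y ∷ m ∷ e ∷ f ∷ [])
        lem₃ : ∀ x d → 1ℤ * (d * x) + (1ℤ * (x * d) + (- + 2 * (d * d) + 0ℤ)) ≡ + 2 * (x * d) - + 2 * (d * d)
        lem₃ x d = solve (x ∷ d ∷ [])

      -- Completing the square: `4d (x - d) + (x - 2d)² = x²` for each `w` in A ∪ B.
      D+Y : + 2 * ∑ (λ w → inN w * (+ 2 * (x * d w) - + 2 * (d w * d w))) + Y ≡ (p + q) * (x * x)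
      D+Y = trans (lem₃ (∑ (λ w → inN w * (+ 2 * (x * d w) - + 2 * (d w * d w)))) Y)
        (trans (≡-sym (Φ-total (∑₁ n) ((+ 2 , (λ w → inN w * (+ 2 * (x * d w) - + 2 * (d w * d w))))
                                  ∷ (1ℤ , (λ w → inN w * ((x - + 2 * d w) * (x - + 2 * d w)))) ∷ [])))
        (trans (sum-cong-≗ (λ w → pt x (inN w) (d w)))
        (trans (≡-sym (*-distribˡ-sum (x * x) inN))
        (trans (ℤₚ.*-comm (x * x) (∑ inN)) (cong (λ z → z * (x * x)) (∑-distrib-+ inA inB))))))
        where
        pt : ∀ x m d → + 2 * (m * (+ 2 * (x * d) - + 2 * (d * d))) + (1ℤ * (m * ((x - + 2 * d) * (x - + 2 * d))) + 0ℤ) ≡ (x * x) * m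
        pt x m d = solve (x ∷ m ∷ d ∷ [])
        lem₃ : ∀ y z → + 2 * y + z ≡ + 2 * y + (1ℤ * z + 0ℤ)
        lem₃ y z = solve (y ∷ z ∷ [])

  -- Edges, triangles and books as sums

  sumF≡∑ : ∀ {n} (f : Fin n → ℕ) → + sumF f ≡ ∑ (λ i → + f i)
  sumF≡∑ {ℕ.zero} f = refl
  sumF≡∑ {ℕ.suc n} f = cong (λ z → + f zero + z) (sumF≡∑ (λ i → f (suc i)))

  ≤maxF : ∀ {n} (f : Fin n → ℕ) i → f i ℕ.≤ maxF f
  ≤maxF f zero = ℕₚ.m≤m⊔n (f zero) (maxF (λ i → f (suc i)))
  ≤maxF f (suc i) = ℕₚ.≤-trans (≤maxF (λ i → f (suc i)) i) (ℕₚ.m≤n⊔m (f zero) (maxF (λ i → f (suc i))))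

  <ᵇ-true : ∀ {m n} → m ℕ.< n → (m <ᵇ n) ≡ true
  <ᵇ-true {m} {n} h with m <ᵇ n | ℕₚ.<⇒<ᵇ h
  ... | true | _ = refl

  <ᵇ-false : ∀ {m n} → n ℕ.≤ m → (m <ᵇ n) ≡ false
  <ᵇ-false {m} {n} h with m <ᵇ n in e
  ... | false = refl
  ... | true = ⊥-elim (ℕₚ.<⇒≱ (ℕₚ.<ᵇ⇒< m n (subst IsTrue (≡-sym e) tt)) h)

  <ᵇ⇒< : ∀ {m n} → (m <ᵇ n) ≡ true → m ℕ.< n
  <ᵇ⇒< {m} {n} e = ℕₚ.<ᵇ⇒< m n (subst IsTrue (≡-sym e) tt)

  <ᵇ-trans : ∀ i j k → (i <ᵇ j) ≡ true → (j <ᵇ k) ≡ true → (i <ᵇ k) ≡ true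
  <ᵇ-trans i j k h h′ = <ᵇ-true (ℕₚ.<-trans (<ᵇ⇒< {i} {j} h) (<ᵇ⇒< {j} {k} h′))

  module Counting {n : ℕ} (G : Graph n) where

    private
      lt : Fin n → Fin n → Bool
      lt i j = toℕ i <ᵇ toℕ j

      lt-flip : ∀ i j → adj G i j ≡ true → lt j i ≡ not (lt i j)
      lt-flip i j e = go (ℕₚ.<-cmp (toℕ i) (toℕ j))
        where
        go : Tri (toℕ i ℕ.< toℕ j) (toℕ i ≡ toℕ j) (toℕ j ℕ.< toℕ i) → lt j i ≡ not (lt i j)
        go (tri< h _ _) = trans (<ᵇ-false (ℕₚ.<⇒≤ h)) (cong not (≡-sym (<ᵇ-true h)))
        go (tri> _ _ h) = trans (<ᵇ-true h) (cong not (≡-sym (<ᵇ-false (ℕₚ.<⇒≤ h))))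
        go (tri≈ _ h _) with Finₚ.toℕ-injective h
        ... | refl with trans (≡-sym e) (irrefl G i)
        ... | ()

      lt-trans : ∀ i j k → lt i j ≡ true → lt j k ≡ true → lt i k ≡ true
      lt-trans i j k = <ᵇ-trans (toℕ i) (toℕ j) (toℕ k)

    edges-twice : + 2 * + edgeCount G ≡ Σ₂ {n} (λ (u , v) → ⟦ adj G u v ⟧)
    edges-twice = trans (cong (λ z → + 2 * z) count)
      (trans (lem (Σ₂ e) swap) (trans (≡-sym (add (∑₂ n) e e′)) (cong-Φ (∑₂ n) (λ (i , j) →
        pt (adj G i j) (adj G j i) (lt i j) (lt j i) (sym G i j) (lt-flip i j)))))
      where
      e e′ : Fin n × Fin n → ℤ
      e (i , j) = ⟦ lt i j ∧ adj G i j ⟧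
      e′ (i , j) = ⟦ lt j i ∧ adj G j i ⟧
      count : + edgeCount G ≡ Σ₂ e
      count = trans (sumF≡∑ (λ i → sumF (λ j → ind (lt i j ∧ adj G i j))))
                    (sum-cong-≗ (λ i → sumF≡∑ (λ j → ind (lt i j ∧ adj G i j))))
      swap : Σ₂ e ≡ Σ₂ e′
      swap = Σ₂-swap e
      lem : ∀ y {z} → y ≡ z → + 2 * y ≡ y + z
      lem y refl = solve (y ∷ [])
      pt : ∀ a a′ l l′ → a ≡ a′ → (a ≡ true → l′ ≡ not l) → ⟦ l ∧ a ⟧ + ⟦ l′ ∧ a′ ⟧ ≡ ⟦ a ⟧
      pt true .true true l′ refl h with h refl
      ... | refl = refl
      pt true .true false l′ refl h with h refl
      ... | refl = refl
      pt false .false true true refl h = refl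
      pt false .false true false refl h = refl
      pt false .false false true refl h = refl
      pt false .false false false refl h = refl

    triangles-sixfold : + 6 * + triangleCount G
      ≡ Σ₃ {n} (λ (u , v , w) → ⟦ adj G u v ⟧ * (⟦ adj G v w ⟧ * ⟦ adj G u w ⟧))
    triangles-sixfold = trans (cong (λ z → + 6 * z) count)
      (trans (lem (Σ₃ t₁₂₃) t₁₃₂≡ t₂₁₃≡ t₂₃₁≡ t₃₁₂≡ t₃₂₁≡)
      (trans (≡-sym (Φ-total (∑₃ n) ((1ℤ , t₁₂₃) ∷ (1ℤ , t₁₃₂) ∷ (1ℤ , t₂₁₃) ∷ (1ℤ , t₂₃₁) ∷ (1ℤ , t₃₁₂) ∷ (1ℤ , t₃₂₁) ∷ [])))
        (cong-Φ (∑₃ n) pointwise)))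
      where
      tri : Fin n → Fin n → Fin n → ℤ
      tri i j k = ⟦ lt i j ∧ lt j k ∧ adj G i j ∧ adj G j k ∧ adj G i k ⟧
      t₁₂₃ t₁₃₂ t₂₁₃ t₂₃₁ t₃₁₂ t₃₂₁ : Fin n × Fin n × Fin n → ℤ
      t₁₂₃ (i , j , k) = tri i j k
      t₁₃₂ (i , j , k) = tri i k j
      t₂₁₃ (i , j , k) = tri j i k
      t₂₃₁ (i , j , k) = tri j k i
      t₃₁₂ (i , j , k) = tri k i j
      t₃₂₁ (i , j , k) = tri k j i
      count : + triangleCount G ≡ Σ₃ t₁₂₃
      count = trans (sumF≡∑ (λ i → sumF λ j → sumF λ k → f i j k))
        (sum-cong-≗ (λ i → trans (sumF≡∑ (λ j → sumF λ k → f i j k)) (sum-cong-≗ (λ j → sumF≡∑ (f i j)))))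
        where
        f : Fin n → Fin n → Fin n → ℕ
        f i j k = ind (lt i j ∧ lt j k ∧ adj G i j ∧ adj G j k ∧ adj G i k)
      t₁₃₂≡ : Σ₃ t₁₂₃ ≡ Σ₃ t₁₃₂
      t₁₃₂≡ = Σ₃-swap₂₃ t₁₂₃
      t₂₁₃≡ : Σ₃ t₁₂₃ ≡ Σ₃ t₂₁₃
      t₂₁₃≡ = Σ₃-swap₁₂ t₁₂₃
      t₂₃₁≡ : Σ₃ t₁₂₃ ≡ Σ₃ t₂₃₁
      t₂₃₁≡ = trans t₁₃₂≡ (Σ₃-swap₁₂ t₁₃₂)
      t₃₁₂≡ : Σ₃ t₁₂₃ ≡ Σ₃ t₃₁₂
      t₃₁₂≡ = trans t₂₁₃≡ (Σ₃-swap₂₃ t₂₁₃)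
      t₃₂₁≡ : Σ₃ t₁₂₃ ≡ Σ₃ t₃₂₁
      t₃₂₁≡ = trans t₂₃₁≡ (Σ₃-swap₂₃ t₂₃₁)
      lem : ∀ t {t₁ t₂ t₃ t₄ t₅} → t ≡ t₁ → t ≡ t₂ → t ≡ t₃ → t ≡ t₄ → t ≡ t₅ →
        + 6 * t ≡ 1ℤ * t + (1ℤ * t₁ + (1ℤ * t₂ + (1ℤ * t₃ + (1ℤ * t₄ + (1ℤ * t₅ + 0ℤ)))))
      lem t refl refl refl refl refl = solve (t ∷ [])
      six : (a b c l l′ m m′ o o′ : Bool) → ℤ
      six a b c l l′ m m′ o o′ =
        1ℤ * ⟦ l ∧ m ∧ a ∧ b ∧ c ⟧ + (1ℤ * ⟦ o ∧ m′ ∧ c ∧ b ∧ a ⟧ + (1ℤ * ⟦ l′ ∧ o ∧ a ∧ c ∧ b ⟧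
        + (1ℤ * ⟦ m ∧ o′ ∧ b ∧ c ∧ a ⟧ + (1ℤ * ⟦ o′ ∧ l ∧ c ∧ a ∧ b ⟧ + (1ℤ * ⟦ m′ ∧ l′ ∧ b ∧ a ∧ c ⟧ + 0ℤ)))))
      -- Only consecutive comparisons are tested, so a cyclic orientation of the three vertices
      -- would be counted three times; the two transitivity hypotheses exclude it, and exactly one
      -- of the six orders is increasing.
      all-true : ∀ l m o → (l ≡ true → m ≡ true → o ≡ true) → (not m ≡ true → not l ≡ true → not o ≡ true) →
        six true true true l (not l) m (not m) o (not o) ≡ 1ℤ
      all-true = exhaust (all-Bool? λ _ → all-Bool? λ _ → all-Bool? λ _ →
        ((_ Boolₚ.≟ _) →-dec ((_ Boolₚ.≟ _) →-dec (_ Boolₚ.≟ _))) →-dec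
        (((_ Boolₚ.≟ _) →-dec ((_ Boolₚ.≟ _) →-dec (_ Boolₚ.≟ _))) →-dec (_ ≟ _)))
      a-false : ∀ b c l l′ m m′ o o′ → six false b c l l′ m m′ o o′ ≡ 0ℤ
      a-false = exhaust (all-Bool? λ _ → all-Bool? λ _ → all-Bool? λ _ → all-Bool? λ _ → all-Bool? λ _ →
        all-Bool? λ _ → all-Bool? λ _ → all-Bool? λ _ → _ ≟ _)
      b-false : ∀ c l l′ m m′ o o′ → six true false c l l′ m m′ o o′ ≡ 0ℤ
      b-false = exhaust (all-Bool? λ _ → all-Bool? λ _ → all-Bool? λ _ → all-Bool? λ _ →
        all-Bool? λ _ → all-Bool? λ _ → all-Bool? λ _ → _ ≟ _)
      c-false : ∀ l l′ m m′ o o′ → six true true false l l′ m m′ o o′ ≡ 0ℤ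
      c-false = exhaust (all-Bool? λ _ → all-Bool? λ _ → all-Bool? λ _ →
        all-Bool? λ _ → all-Bool? λ _ → all-Bool? λ _ → _ ≟ _)
      pt : ∀ a b c l l′ m m′ o o′ → (a ≡ true → l′ ≡ not l) → (b ≡ true → m′ ≡ not m) → (c ≡ true → o′ ≡ not o) →
        (l ≡ true → m ≡ true → o ≡ true) → (m′ ≡ true → l′ ≡ true → o′ ≡ true) →
        six a b c l l′ m m′ o o′ ≡ ⟦ a ⟧ * (⟦ b ⟧ * ⟦ c ⟧)
      pt false b c l l′ m m′ o o′ _ _ _ _ _ = trans (a-false b c l l′ m m′ o o′) (≡-sym (ℤₚ.*-zeroˡ (⟦ b ⟧ * ⟦ c ⟧)))
      pt true false c l l′ m m′ o o′ _ _ _ _ _ = trans (b-false c l l′ m m′ o o′) (cong (λ z → 1ℤ * z) (≡-sym (ℤₚ.*-zeroˡ ⟦ c ⟧)))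
      pt true true false l l′ m m′ o o′ _ _ _ _ _ = c-false l l′ m m′ o o′
      pt true true true l l′ m m′ o o′ ha hb hc h h′ with ha refl | hb refl | hc refl
      ... | refl | refl | refl = all-true l m o h h′
      pointwise : ∀ z → at ((1ℤ , t₁₂₃) ∷ (1ℤ , t₁₃₂) ∷ (1ℤ , t₂₁₃) ∷ (1ℤ , t₂₃₁) ∷ (1ℤ , t₃₁₂) ∷ (1ℤ , t₃₂₁) ∷ []) z
        ≡ ⟦ adj G (proj₁ z) (proj₁ (proj₂ z)) ⟧ * (⟦ adj G (proj₁ (proj₂ z)) (proj₂ (proj₂ z)) ⟧ * ⟦ adj G (proj₁ z) (proj₂ (proj₂ z)) ⟧)
      pointwise (i , j , k) rewrite sym G k j | sym G j i | sym G k i =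
        pt (adj G i j) (adj G j k) (adj G i k) (lt i j) (lt j i) (lt j k) (lt k j) (lt i k) (lt k i)
          (lt-flip i j) (lt-flip j k) (lt-flip i k) (lt-trans i j k) (lt-trans k j i)

    book : ∀ b → bookNumber G ℕ.≤ b → ∀ u w →
      Pos (⟦ adj G u w ⟧ * (+ b - ∑ (λ v → ⟦ adj G w v ⟧ * ⟦ adj G u v ⟧)))
    book b h u w with adj G u w in e
    ... | false = pos 0
    ... | true = ≤⇒Pos (subst (λ z → z ≤ + b) cod (_≤_.+≤+ bound)) ∴ ≡-sym (ℤₚ.*-identityˡ _)
      where
      row : Fin n → Fin n → ℕ
      row u w = if adj G u w then codegree G u w else 0
      bound : codegree G u w ℕ.≤ b
      bound = subst (λ e → (if e then codegree G u w else 0) ℕ.≤ b) e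
        (ℕₚ.≤-trans (≤maxF (row u) w) (ℕₚ.≤-trans (≤maxF (λ u → maxF (row u)) u) h))
      cod : + codegree G u w ≡ ∑ (λ v → ⟦ adj G w v ⟧ * ⟦ adj G u v ⟧)
      cod = trans (sumF≡∑ (λ v → ind (adj G u v ∧ adj G w v))) (sum-cong-≗ (λ v → pt (adj G u v) (adj G w v)))
        where
        pt : ∀ a b → ⟦ a ∧ b ⟧ ≡ ⟦ b ⟧ * ⟦ a ⟧
        pt = exhaust (all-Bool? λ _ → all-Bool? λ _ → _ ≟ _)

  -- A cut given by a neighbourhood

  not-Pos : ∀ {x} → ¬ Pos x → Pos (- x - 1ℤ)
  not-Pos {x} h = [ (λ p → ⊥-elim (h p)) , (λ p → p) ]′ (Pos? x)

  below-average : ∀ {n} (f : Fin n → ℤ) s → Pos (+ n - 1ℤ) → Pos (s - ∑ f) → ∃ λ v → Pos (s - + n * f v)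
  below-average {n} f s n≥1 h with Finₚ.any? (λ v → 0ℤ ≤? s - + n * f v)
  ... | yes found = found
  ... | no none = ⊥-elim (¬Pos {s - ∑ f} (contra (positive (∑₁ n) (λ v → not-Pos (λ p → none (v , p))))) h)
    where
    eq : ∑ (λ v → - (s - + n * f v) - 1ℤ) ≡ + n * ∑ f + (-1ℤ * (+ n * (s + 1ℤ)) + 0ℤ)
    eq = trans (sum-cong-≗ (λ v → lem s (+ n) (f v)))
      (trans (Φ-total (∑₁ n) ((+ n , f) ∷ (-1ℤ , (λ _ → s + 1ℤ)) ∷ []))
             (cong (λ z → + n * ∑ f + (-1ℤ * z + 0ℤ)) (∑-const n (s + 1ℤ))))
      where
      lem : ∀ s m f → - (s - m * f) - 1ℤ ≡ m * f + (-1ℤ * (s + 1ℤ) + 0ℤ)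
      lem s m f = solve (s ∷ m ∷ f ∷ [])
    contra : Pos (∑ (λ v → - (s - + n * f v) - 1ℤ)) → Pos (- (s - ∑ f) - 1ℤ)
    contra k = Pos-cancel {+ n} { - (s - ∑ f) - 1ℤ} n≥1 (k ∴ trans eq (lem (+ n) (∑ f) s))
      where
      lem : ∀ m y s → m * y + (-1ℤ * (m * (s + 1ℤ)) + 0ℤ) ≡ m * (- (s - y) - 1ℤ)
      lem m y s = solve (m ∷ y ∷ s ∷ [])

  module Neighbourhood-cuts {n : ℕ} (adj : Fin n → Fin n → Bool) (adj-sym : ∀ u v → adj u v ≡ adj v u) where

    private
      E : Fin n → Fin n → ℤ
      E u v = ⟦ adj u v ⟧
      E-sym : ∀ u v → E u v ≡ E v u
      E-sym u v = cong ⟦_⟧ (adj-sym u v)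

    -- The factor `1 - e - f + 2ef` is 1 exactly when `u` and `w` lie on the same side of the cut
    -- into N(v) and its complement.
    deg same : Fin n → ℤ
    deg v = ∑ (E v)
    same v = Σ₂ (λ (u , w) → E u w * (1ℤ - E v u - E v w + + 2 * (E v u * E v w)))

    M τ : ℤ
    M = Σ₂ (λ (u , v) → E u v)
    τ = Σ₃ (λ (u , v , w) → E u v * (E v w * E u w))

    private
      D² : ℤ
      D² = ∑ (λ v → deg v * deg v)

      D²≥ : Pos (+ 4 * D² - + 4 * + n * M + + n * (+ n * + n))
      D²≥ = positive (∑₁ n) (λ v → Pos-sq (+ 2 * deg v - + n))
        ∴ trans (sum-cong-≗ (λ v → lem (deg v) (+ n)))
          (trans (Φ-total (∑₁ n) ((+ 4 , (λ v → deg v * deg v)) ∷ (- (+ 4 * + n) , deg) ∷ (1ℤ , (λ _ → + n * + n)) ∷ []))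
          (trans (cong (λ z → + 4 * D² + (- (+ 4 * + n) * M + (1ℤ * z + 0ℤ))) (∑-const n (+ n * + n)))
            (lem′ D² (+ n) M)))
        where
        lem : ∀ d m → (+ 2 * d - m) * (+ 2 * d - m) ≡ + 4 * (d * d) + (- (+ 4 * m) * d + (1ℤ * (m * m) + 0ℤ))
        lem d m = solve (d ∷ m ∷ [])
        lem′ : ∀ d m e → + 4 * d + (- (+ 4 * m) * e + (1ℤ * (m * (m * m)) + 0ℤ)) ≡ + 4 * d - + 4 * m * e + m * (m * m)
        lem′ d m e = solve (d ∷ m ∷ e ∷ [])

      paths : Σ₃ (λ (v , u , w) → E v u * E u w) ≡ D²
      paths = trans (Σ₃-swap₁₂ (λ (v , u , w) → E v u * E u w))
        (sum-cong-≗ (λ u → trans (cong-Φ (∑₂ n) (λ (v , w) → cong (λ z → z * E u w) (E-sym v u))) (∑∑-* (E u) (E u))))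

      ∑same : ∑ same ≡ + n * M - + 2 * D² + + 2 * τ
      ∑same = trans (cong-Φ (∑₃ n) (λ (v , u , w) → lem (E u w) (E v u) (E v w)))
        (trans (Φ-total (∑₃ n) L)
        (trans (cong₂ (λ y z → 1ℤ * y + (-1ℤ * z + (-1ℤ * Σ₃ (λ (v , u , w) → E v w * E u w) + (+ 2 * τ + 0ℤ))))
                      (∑-const n M) paths)
        (trans (cong (λ z → 1ℤ * (+ n * M) + (-1ℤ * D² + (-1ℤ * z + (+ 2 * τ + 0ℤ)))) paths′)
               (lem′ (+ n * M) D² τ))))
        where
        L : Terms (Fin n × Fin n × Fin n)
        L = (1ℤ , (λ (v , u , w) → E u w)) ∷ (-1ℤ , (λ (v , u , w) → E v u * E u w))
          ∷ (-1ℤ , (λ (v , u , w) → E v w * E u w)) ∷ (+ 2 , (λ (v , u , w) → E v u * (E u w * E v w))) ∷ []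
        lem : ∀ e f g → e * (1ℤ - f - g + + 2 * (f * g)) ≡ 1ℤ * e + (-1ℤ * (f * e) + (-1ℤ * (g * e) + (+ 2 * (f * (e * g)) + 0ℤ)))
        lem e f g = solve (e ∷ f ∷ g ∷ [])
        lem′ : ∀ m d t → 1ℤ * m + (-1ℤ * d + (-1ℤ * d + (+ 2 * t + 0ℤ))) ≡ m - + 2 * d + + 2 * t
        lem′ m d t = solve (m ∷ d ∷ t ∷ [])
        paths′ : Σ₃ (λ (v , u , w) → E v w * E u w) ≡ D²
        paths′ = trans (Σ₃-swap₂₃ (λ (v , u , w) → E v w * E u w))
          (trans (cong-Φ (∑₃ n) (λ (v , w , u) → cong (λ z → E v w * z) (E-sym u w))) paths)

    -- Summed over all vertices, `same` is `nM - 2 Σ deg² + 2τ`. The degree squares and `2M ≥ n²`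
    -- make this at most `2τ`, and some vertex does no worse than the average.
    good-cut : Pos (+ n - 1ℤ) → Pos (+ 2 * M - + n * + n) → ∃ λ v → Pos (+ 2 * τ - + n * same v)
    good-cut n≥1 h = below-average same (+ 2 * τ) n≥1
      (Pos-cancel {+ 2} {+ 2 * τ - ∑ same} (pos 1)
        (D²≥ ⊕ pos n ⊗ h ∴ trans (lem D² (+ n) M τ) (cong (λ z → + 2 * (+ 2 * τ - z)) (≡-sym ∑same))))
      where
      lem : ∀ d m e t → + 4 * d - + 4 * m * e + m * (m * m) + m * (+ 2 * e - m * m) ≡ + 2 * (+ 2 * t - (m * e - + 2 * d + + 2 * t))
      lem d m e t = solve (d ∷ m ∷ e ∷ t ∷ [])

  -- f is the size of the symmetric difference of a neighbourhood and N(v), hence n - f that with the complement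
  -- of N(v). The threshold 11/100 keeps the classes independent: both sides exceed 0.4725 n, and
  -- 0.4725 - 2 · 0.11 > 1/4.
  data Spec (n f : ℤ) : Cls → Set where
    B-like : Pos (+ 11 * n - + 100 * f) → Spec n f B
    A-like : Pos (+ 11 * n - + 100 * (n - f)) → Spec n f A
    neither : Pos (+ 100 * f - + 11 * n) → Pos (+ 100 * (n - f) - + 11 * n) → Spec n f X

  classify : ∀ n f → ∃ (Spec n f)
  classify n f = Pos-split (+ 11 * n - + 100 * f) (λ h → B , B-like h)
    (λ h → Pos-split (+ 11 * n - + 100 * (n - f)) (λ h′ → A , A-like h′)
      (λ h′ → X , neither (weaken {+ 100 * f - + 11 * n} (h ∴ solve (n ∷ f ∷ [])))
        (weaken {+ 100 * (n - f) - + 11 * n} (h′ ∴ solve (n ∷ f ∷ [])))))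

  module Cut {n : ℕ} (adj : Fin n → Fin n → Bool) (adj-sym : ∀ u v → adj u v ≡ adj v u)
    (n≥1 : Pos (+ n - 1ℤ))
    (many-edges : Pos (+ 2 * Neighbourhood-cuts.M adj adj-sym - + n * + n))
    (v : Fin n)
    (few-bad : Pos (+ 3 * (+ n * + n) - + 2000 * Neighbourhood-cuts.same adj adj-sym v)) where

    open Neighbourhood-cuts adj adj-sym using (M; same; deg)

    ε f : Fin n → ℤ
    ε u = ⟦ adj v u ⟧
    f u = ∑ (λ w → ⟦ adj v w ⟧ + ⟦ adj u w ⟧ - + 2 * (⟦ adj v w ⟧ * ⟦ adj u w ⟧))

    cls : Fin n → Cls
    cls u = proj₁ (classify (+ n) (f u))

    spec : ∀ u → Spec (+ n) (f u) (cls u)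
    spec u = proj₂ (classify (+ n) (f u))

    open Partition adj adj-sym cls hiding (M)

    D bad : ℤ
    D = deg v
    bad = same v

    -- The class A is meant to approximate N(v), whose vertices see mostly the complement, and B to
    -- approximate that complement. `yA` and `yB` count the vertices of A and B on the wrong side.
    yA yB : ℤ
    yA = ∑ (λ u → inA u * (1ℤ - ε u))
    yB = ∑ (λ u → inB u * ε u)

    -- The summand is `1 - E` across the cut and `E` inside a side: `W` is the distance, in ordered
    -- pairs, from the complete bipartite graph between N(v) and its complement.
    W : ℤ
    W = Σ₂ (λ (u , w) → ε u + ε w - + 2 * (ε u * ε w) - E u w + + 2 * (E u w * (1ℤ - ε u - ε w + + 2 * (ε u * ε w))))

    W≡ : W ≡ + 2 * (D * (+ n - D)) - M + + 2 * bad
    W≡ = trans (cong-Φ (∑₂ n) (λ (u , w) → lem (ε u) (ε w) (E u w)))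
      (trans (Φ-total (∑₂ n) ((+ 2 , (λ (u , w) → ε u * (1ℤ - ε w))) ∷ (1ℤ , (λ (u , w) → ε w)) ∷ (-1ℤ , (λ (u , w) → ε u))
           ∷ (-1ℤ , (λ (u , w) → E u w)) ∷ (+ 2 , (λ (u , w) → E u w * (1ℤ - ε u - ε w + + 2 * (ε u * ε w)))) ∷ []))
      (trans (cong₂ (λ y z → + 2 * y + (1ℤ * z + (-1ℤ * Σ₂ (λ (u , w) → ε u) + (-1ℤ * M + (+ 2 * bad + 0ℤ)))))
                (trans (∑∑-* ε (λ w → 1ℤ - ε w)) (cong (λ z → D * z) ∑1-ε))
                (Σ₂-swap (λ (u , w) → ε w)))
             (lem′ (D * (+ n - D)) (Σ₂ (λ (u , w) → ε u)) M bad)))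
      where
      ∑1-ε : ∑ (λ w → 1ℤ - ε w) ≡ + n - D
      ∑1-ε = trans (sum-cong-≗ (λ w → lem₁ (ε w)))
        (trans (Φ-total (∑₁ n) ((1ℤ , (λ _ → 1ℤ)) ∷ (-1ℤ , ε) ∷ []))
        (trans (cong (λ z → 1ℤ * z + (-1ℤ * D + 0ℤ)) (∑-const n 1ℤ)) (lem₂ (+ n) D)))
        where
        lem₁ : ∀ e → 1ℤ - e ≡ 1ℤ * 1ℤ + (-1ℤ * e + 0ℤ)
        lem₁ e = solve (e ∷ [])
        lem₂ : ∀ m d → 1ℤ * (m * 1ℤ) + (-1ℤ * d + 0ℤ) ≡ m - d
        lem₂ m d = solve (m ∷ d ∷ [])
      lem : ∀ a b e → a + b - + 2 * (a * b) - e + + 2 * (e * (1ℤ - a - b + + 2 * (a * b)))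
        ≡ + 2 * (a * (1ℤ - b)) + (1ℤ * b + (-1ℤ * a + (-1ℤ * e + (+ 2 * (e * (1ℤ - a - b + + 2 * (a * b))) + 0ℤ))))
      lem a b e = solve (a ∷ b ∷ e ∷ [])
      lem′ : ∀ y z m s → + 2 * y + (1ℤ * z + (-1ℤ * z + (-1ℤ * m + (+ 2 * s + 0ℤ)))) ≡ + 2 * y - m + + 2 * s
      lem′ y z m s = solve (y ∷ z ∷ m ∷ s ∷ [])

    W≤ : Pos (+ 3 * (+ n * + n) - + 1000 * W)
    W≤ = few-bad ⊕ pos 500 ⊗ many-edges ⊕ pos 500 ⊗ Pos-sq (+ n - + 2 * D)
      ∴ trans (lem (+ n) D M bad) (cong (λ z → + 3 * (+ n * + n) - + 1000 * z) (≡-sym W≡))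
      where
      lem : ∀ m d e s → + 3 * (m * m) - + 2000 * s + + 500 * (+ 2 * e - m * m) + + 500 * ((m - + 2 * d) * (m - + 2 * d))
        ≡ + 3 * (m * m) - + 1000 * (+ 2 * (d * (m - d)) - e + + 2 * s)
      lem m d e s = solve (m ∷ d ∷ e ∷ s ∷ [])

    -- Apart from `bad`, `W` counts missing pairs across the cut. Their number being nonnegative
    -- bounds `M` by `2D (n - D) + bad`, and hence the imbalance of the cut.
    missing≥0 : Pos (+ 2 * (D * (+ n - D)) - M + bad)
    missing≥0 = positive (∑₂ n) (λ (u , w) → pt (adj v u) (adj v w) (adj u w))
      ∴ trans (cong-Φ (∑₂ n) (λ (u , w) → lem (ε u) (ε w) (E u w)))
        (trans (Φ-total (∑₂ n) ((1ℤ , (λ (u , w) → ε u + ε w - + 2 * (ε u * ε w) - E u w + + 2 * (E u w * (1ℤ - ε u - ε w + + 2 * (ε u * ε w)))))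
                              ∷ (-1ℤ , (λ (u , w) → E u w * (1ℤ - ε u - ε w + + 2 * (ε u * ε w)))) ∷ []))
        (trans (cong (λ z → 1ℤ * z + (-1ℤ * bad + 0ℤ)) W≡) (lem′ (+ 2 * (D * (+ n - D)) - M) bad)))
      where
      pt : ∀ a b e → Pos ((1ℤ - ⟦ e ⟧) * (⟦ a ⟧ + ⟦ b ⟧ - + 2 * (⟦ a ⟧ * ⟦ b ⟧)))
      pt = exhaust (all-Bool? λ _ → all-Bool? λ _ → all-Bool? λ _ → _ ≤? _)
      lem : ∀ a b e → (1ℤ - e) * (a + b - + 2 * (a * b))
        ≡ 1ℤ * (a + b - + 2 * (a * b) - e + + 2 * (e * (1ℤ - a - b + + 2 * (a * b)))) + (-1ℤ * (e * (1ℤ - a - b + + 2 * (a * b))) + 0ℤ)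
      lem a b e = solve (a ∷ b ∷ e ∷ [])
      lem′ : ∀ y s → 1ℤ * (y + + 2 * s) + (-1ℤ * s + 0ℤ) ≡ y + s
      lem′ y s = solve (y ∷ s ∷ [])

    -- By few-bad and missing≥0, (200 (n - 2D))² ≤ 120 n² < (11 n)².
    balanced : ∀ z → z * z ≡ (+ n - + 2 * D) * (+ n - + 2 * D) → Pos (+ 11 * + n - + 200 * z)
    balanced z e = Pos-split (+ 11 * + n - + 200 * z) (λ h → h) (λ h → ⊥-elim (¬Pos { -1ℤ} (pos 0) (contra h)))
      where
      square≤ : Pos (+ 3 * (+ n * + n) - + 1000 * (z * z))
      square≤ = few-bad ⊕ pos 1000 ⊗ many-edges ⊕ pos 2000 ⊗ missing≥0
        ∴ trans (lem (+ n) D M bad) (cong (λ y → + 3 * (+ n * + n) - + 1000 * y) (≡-sym e))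
        where
        lem : ∀ m d e s → + 3 * (m * m) - + 2000 * s + + 1000 * (+ 2 * e - m * m) + + 2000 * (+ 2 * (d * (m - d)) - e + s)
          ≡ + 3 * (m * m) - + 1000 * ((m - + 2 * d) * (m - + 2 * d))
        lem m d e s = solve (m ∷ d ∷ e ∷ s ∷ [])
      contra : 0ℤ ≤ - (+ 11 * + n - + 200 * z) - 1ℤ → 0ℤ ≤ -1ℤ
      contra h = lem (+ n) z (pos n) square≤ h
        where
        lem : ∀ m z → Pos m → Pos (+ 3 * (m * m) - + 1000 * (z * z)) → Pos (- (+ 11 * m - + 200 * z) - 1ℤ) → 0ℤ ≤ -1ℤ
        lem m z hm h₁ h₂ = pos 40 ⊗ h₁ ⊕ h₂ ⊗ (h₂ ⊕ pos 22 ⊗ hm ⊕ pos 1) ⊕ h₂ ⊕ pos 22 ⊗ hm ⊕ hm ⊗ hm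
          ∴ solve (m ∷ z ∷ [])

    private
      ∑-sub : ∀ (g h : Fin n → ℤ) → ∑ (λ w → g w - h w) ≡ ∑ g - ∑ h
      ∑-sub g h = trans (sum-cong-≗ (λ w → lem (g w) (h w)))
        (trans (Φ-total (∑₁ n) ((1ℤ , g) ∷ (-1ℤ , h) ∷ [])) (lem′ (∑ g) (∑ h)))
        where
        lem : ∀ y z → y - z ≡ 1ℤ * y + (-1ℤ * z + 0ℤ)
        lem y z = solve (y ∷ z ∷ [])
        lem′ : ∀ y z → 1ℤ * y + (-1ℤ * z + 0ℤ) ≡ y - z
        lem′ y z = solve (y ∷ z ∷ [])

      ∑-sub-const : ∀ (g : Fin n → ℤ) → ∑ (λ w → 1ℤ - g w) ≡ + n - ∑ g
      ∑-sub-const g = trans (∑-sub (λ _ → 1ℤ) g)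
                            (cong (λ z → z - ∑ g) (trans (∑-const n 1ℤ) (ℤₚ.*-identityʳ (+ n))))

      δ : Bool → Bool → ℤ
      δ e e′ = ⟦ e ⟧ + ⟦ e′ ⟧ - + 2 * (⟦ e ⟧ * ⟦ e′ ⟧)

      f≥0 : ∀ u → Pos (f u)
      f≥0 u = ∑-positive (λ w → pt (adj v w) (adj u w))
        where
        pt : ∀ e e′ → Pos (δ e e′)
        pt = exhaust (all-Bool? λ _ → all-Bool? λ _ → _ ≤? _)

      f≤n : ∀ u → Pos (+ n - f u)
      f≤n u = ∑-positive (λ w → pt (adj v w) (adj u w)) ∴ ∑-sub-const (λ w → δ (adj v w) (adj u w))
        where
        pt : ∀ e e′ → Pos (1ℤ - δ e e′)
        pt = exhaust (all-Bool? λ _ → all-Bool? λ _ → _ ≤? _)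

      -- What a vertex contributes to `W` is at least `11m/100` if it is exceptional, since both
      -- distances are that large, and at least `89m/100` if it lies on the wrong side for its
      -- class, since it is then compared with the side it is far from.
      weigh : ∀ {m F c} e → Spec m F c → Pos F → Pos (m - F) →
        0ℤ ≤ + 100 * ((1ℤ - ⟦ e ⟧) * F + ⟦ e ⟧ * (m - F)) + (- (+ 11 * m) * isX c
               + (- (+ 89 * m) * (isA c * (1ℤ - ⟦ e ⟧)) + (- (+ 89 * m) * (isB c * ⟦ e ⟧) + 0ℤ)))
      weigh {m} {F} true (B-like h) h₀ h₁ = h ∴ solve (m ∷ F ∷ [])
      weigh {m} {F} false (B-like h) h₀ h₁ = pos 100 ⊗ h₀ ∴ solve (m ∷ F ∷ [])
      weigh {m} {F} true (A-like h) h₀ h₁ = pos 100 ⊗ h₁ ∴ solve (m ∷ F ∷ [])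
      weigh {m} {F} false (A-like h) h₀ h₁ = h ∴ solve (m ∷ F ∷ [])
      weigh {m} {F} true (neither h h′) h₀ h₁ = h′ ∴ solve (m ∷ F ∷ [])
      weigh {m} {F} false (neither h h′) h₀ h₁ = h ∴ solve (m ∷ F ∷ [])

      -- The part of `W` at `u`: outside N(v), the neighbourhood of `u` is compared with N(v);
      -- inside, with the complement.
      wrong : Fin n → ℤ
      wrong u = (1ℤ - ε u) * f u + ε u * (+ n - f u)

      W≡wrong : W ≡ ∑ wrong
      W≡wrong = sum-cong-≗ (λ u → trans (sum-cong-≗ (λ w → lem (ε u) (ε w) (E u w)))
        (trans (Φ-total (∑₁ n) ((1ℤ - ε u , (λ w → δ (adj v w) (adj u w))) ∷ (ε u , (λ w → 1ℤ - δ (adj v w) (adj u w))) ∷ []))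
        (trans (cong (λ z → (1ℤ - ε u) * f u + (ε u * z + 0ℤ)) (∑-sub-const (λ w → δ (adj v w) (adj u w))))
               (lem′ ((1ℤ - ε u) * f u) (ε u * (+ n - f u))))))
        where
        lem : ∀ a b e → a + b - + 2 * (a * b) - e + + 2 * (e * (1ℤ - a - b + + 2 * (a * b)))
          ≡ (1ℤ - a) * (b + e - + 2 * (b * e)) + (a * (1ℤ - (b + e - + 2 * (b * e))) + 0ℤ)
        lem a b e = solve (a ∷ b ∷ e ∷ [])
        lem′ : ∀ y z → y + (z + 0ℤ) ≡ y + z
        lem′ y z = solve (y ∷ z ∷ [])

    few-exceptional : Pos (+ 3 * + n - (+ 110 * x + + 890 * (yA + yB)))
    few-exceptional = Pos-cancel {+ n} {+ 3 * + n - (+ 110 * x + + 890 * (yA + yB))} n≥1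
      (pos 10 ⊗ total-pos (∑₁ n) ((+ 100 , wrong) ∷ (- (+ 11 * + n) , inX)
          ∷ (- (+ 89 * + n) , (λ u → inA u * (1ℤ - ε u))) ∷ (- (+ 89 * + n) , (λ u → inB u * ε u)) ∷ [])
          (λ u → weigh (adj v u) (spec u) (f≥0 u) (f≤n u))
        ⊕ W≤
        ∴ trans (cong (λ z → + 10 * (+ 100 * ∑ wrong + (- (+ 11 * + n) * x + (- (+ 89 * + n) * yA + (- (+ 89 * + n) * yB + 0ℤ))))
                              + (+ 3 * (+ n * + n) - + 1000 * z)) W≡wrong)
                (lem (∑ wrong) (+ n) x yA yB))
      where
      lem : ∀ w m x y z → + 10 * (+ 100 * w + (- (+ 11 * m) * x + (- (+ 89 * m) * y + (- (+ 89 * m) * z + 0ℤ)))) + (+ 3 * (m * m) - + 1000 * w)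
        ≡ m * (+ 3 * m - (+ 110 * x + + 890 * (y + z)))
      lem w m x y z = solve (w ∷ m ∷ x ∷ y ∷ z ∷ [])

    yA≥0 : Pos yA
    yA≥0 = ∑-positive (λ u → pt (cls u) (adj v u))
      where
      pt : ∀ c e → Pos (isA c * (1ℤ - ⟦ e ⟧))
      pt = exhaust (all-Cls? λ _ → all-Bool? λ _ → _ ≤? _)

    yB≥0 : Pos yB
    yB≥0 = ∑-positive (λ u → pt (cls u) (adj v u))
      where
      pt : ∀ c e → Pos (isB c * ⟦ e ⟧)
      pt = exhaust (all-Cls? λ _ → all-Bool? λ _ → _ ≤? _)

    x≥0 : Pos x
    x≥0 = ∑-positive inX-pos

    200yA≤n : Pos (+ n - + 200 * yA)
    200yA≤n = Pos-cancel {+ 3} {+ n - + 200 * yA} (pos 2)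
      (few-exceptional ⊕ pos 110 ⊗ x≥0 ⊕ pos 290 ⊗ yA≥0 ⊕ pos 890 ⊗ yB≥0 ∴ lem (+ n) x yA yB)
      where
      lem : ∀ m x y z → + 3 * m - (+ 110 * x + + 890 * (y + z)) + + 110 * x + + 290 * y + + 890 * z ≡ + 3 * (m - + 200 * y)
      lem m x y z = solve (m ∷ x ∷ y ∷ z ∷ [])

    200yB≤n : Pos (+ n - + 200 * yB)
    200yB≤n = Pos-cancel {+ 3} {+ n - + 200 * yB} (pos 2)
      (few-exceptional ⊕ pos 110 ⊗ x≥0 ⊕ pos 890 ⊗ yA≥0 ⊕ pos 290 ⊗ yB≥0 ∴ lem (+ n) x yA yB)
      where
      lem : ∀ m x y z → + 3 * m - (+ 110 * x + + 890 * (y + z)) + + 110 * x + + 890 * y + + 290 * z ≡ + 3 * (m - + 200 * z)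
      lem m x y z = solve (m ∷ x ∷ y ∷ z ∷ [])

    A-like⁻ : ∀ {u} → cls u ≡ A → Pos (+ 11 * + n - + 100 * (+ n - f u))
    A-like⁻ {u} e = go (spec u) e
      where
      go : ∀ {c} → Spec (+ n) (f u) c → c ≡ A → Pos (+ 11 * + n - + 100 * (+ n - f u))
      go (A-like h) refl = h

    B-like⁻ : ∀ {u} → cls u ≡ B → Pos (+ 11 * + n - + 100 * f u)
    B-like⁻ {u} e = go (spec u) e
      where
      go : ∀ {c} → Spec (+ n) (f u) c → c ≡ B → Pos (+ 11 * + n - + 100 * f u)
      go (B-like h) refl = h

    missA missB : Fin n → ℤ
    missA w = ∑ (λ u → inA u * (1ℤ - E w u))
    missB w = ∑ (λ u → inB u * (1ℤ - E w u))

    -- A vertex of B missed by `w` either lies in N(v), and is counted by `yB`, or lies outside both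
    -- neighbourhoods, where N(w) deviates from the complement of N(v). This gives
    -- `n/200 + 11n/100`.
    missB≤ : ∀ w → cls w ≡ A → Pos (+ 23 * + n - + 200 * missB w)
    missB≤ w e = pos 2 ⊗ A-like⁻ e ⊕ 200yB≤n ⊕ pos 200 ⊗
        (total-pos (∑₁ n) ((1ℤ , (λ u → 1ℤ - δ (adj v u) (adj w u))) ∷ (1ℤ , (λ u → inB u * ε u)) ∷ (-1ℤ , (λ u → inB u * (1ℤ - E w u))) ∷ [])
          (λ u → pt (cls u) (adj v u) (adj w u)))
        ∴ trans (cong (λ z → + 2 * (+ 11 * + n - + 100 * (+ n - f w)) + (+ n - + 200 * yB) + + 200 * (1ℤ * z + (1ℤ * yB + (-1ℤ * missB w + 0ℤ))))
                  (∑-sub-const (λ u → δ (adj v u) (adj w u))))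
                (lem (+ n) (f w) yB (missB w))
      where
      pt : ∀ c e e′ → Pos (1ℤ * (1ℤ - δ e e′) + (1ℤ * (isB c * ⟦ e ⟧) + (-1ℤ * (isB c * (1ℤ - ⟦ e′ ⟧)) + 0ℤ)))
      pt = exhaust (all-Cls? λ _ → all-Bool? λ _ → all-Bool? λ _ → _ ≤? _)
      lem : ∀ m f y z → + 2 * (+ 11 * m - + 100 * (m - f)) + (m - + 200 * y) + + 200 * (1ℤ * (m - f) + (1ℤ * y + (-1ℤ * z + 0ℤ)))
        ≡ + 23 * m - + 200 * z
      lem m f y z = solve (m ∷ f ∷ y ∷ z ∷ [])

    missA≤ : ∀ w → cls w ≡ B → Pos (+ 23 * + n - + 200 * missA w)
    missA≤ w e = pos 2 ⊗ B-like⁻ e ⊕ 200yA≤n ⊕ pos 200 ⊗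
        (total-pos (∑₁ n) ((1ℤ , (λ u → δ (adj v u) (adj w u))) ∷ (1ℤ , (λ u → inA u * (1ℤ - ε u))) ∷ (-1ℤ , (λ u → inA u * (1ℤ - E w u))) ∷ [])
          (λ u → pt (cls u) (adj v u) (adj w u)))
        ∴ lem (+ n) (f w) yA (missA w)
      where
      pt : ∀ c e e′ → Pos (1ℤ * δ e e′ + (1ℤ * (isA c * (1ℤ - ⟦ e ⟧)) + (-1ℤ * (isA c * (1ℤ - ⟦ e′ ⟧)) + 0ℤ)))
      pt = exhaust (all-Cls? λ _ → all-Bool? λ _ → all-Bool? λ _ → _ ≤? _)
      lem : ∀ m f y z → + 2 * (+ 11 * m - + 100 * f) + (m - + 200 * y) + + 200 * (1ℤ * f + (1ℤ * y + (-1ℤ * z + 0ℤ)))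
        ≡ + 23 * m - + 200 * z
      lem m f y z = solve (m ∷ f ∷ y ∷ z ∷ [])

    private
      weighted-miss : ∀ {c c₀ : Cls} (k : Cls → ℤ) (z : ℤ) → (c ≡ c₀ → Pos z) → (∀ c → c ≡ c₀ ⊎ k c ≡ 0ℤ) →
        (∀ c → Pos (k c)) → ∀ e → Pos (k c * ⟦ e ⟧ * z)
      weighted-miss {c} k z h dich kpos e = [ (λ p → kpos c ⊗ pos (ind e) ⊗ h p)
        , (λ p → pos 0 ∴ ≡-sym (trans (cong (λ y → y * ⟦ e ⟧ * z) p) (lem ⟦ e ⟧ z))) ]′ (dich c)
        where
        lem : ∀ e z → 0ℤ * e * z ≡ 0ℤ
        lem e z = solve (e ∷ z ∷ [])

    -- Every pair counted by `ρ u` starts at one of the `a u` neighbours of `u` in A, each of which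
    -- misses at most `23n/200` vertices of B.
    ρ≤a : ∀ u → Few-missing (+ n) (a u) (ρ u)
    ρ≤a u = few-missing (add-up (+ 23 * + n * a u) (∑ (λ w → (inA w * E u w) * missB w)) (ρ u) misses contained)
      where
      add-up : ∀ y s r → Pos (y - + 200 * s) → Pos (s - r) → Pos (y - + 200 * r)
      add-up y s r h h′ = h ⊕ pos 200 ⊗ h′ ∴ solve (y ∷ s ∷ r ∷ [])
      lem : ∀ y m z → y * (+ 23 * m - + 200 * z) ≡ + 23 * m * y + (- + 200 * (y * z) + 0ℤ)
      lem y m z = solve (y ∷ m ∷ z ∷ [])
      pt : ∀ c c′ e e′ e″ → Pos (1ℤ * ((isA c * ⟦ e ⟧) * (isB c′ * (1ℤ - ⟦ e″ ⟧)))
                                + (-1ℤ * ((isA c * isB c′) * (⟦ e ⟧ * ⟦ e′ ⟧ * (1ℤ - ⟦ e″ ⟧))) + 0ℤ))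
      pt = exhaust (all-Cls? λ _ → all-Cls? λ _ → all-Bool? λ _ → all-Bool? λ _ → all-Bool? λ _ → _ ≤? _)
      misses : Pos (+ 23 * + n * a u - + 200 * ∑ (λ w → (inA w * E u w) * missB w))
      misses = total-pos (∑₁ n)
        ((+ 23 * + n , (λ w → inA w * E u w)) ∷ (- + 200 , (λ w → (inA w * E u w) * missB w)) ∷ [])
        (λ w → weighted-miss {cls w} {A} isA (+ 23 * + n - + 200 * missB w) (missB≤ w)
                 (λ { A → inj₁ refl ; B → inj₂ refl ; X → inj₂ refl }) (exhaust (all-Cls? λ _ → _ ≤? _)) (adj u w)
               ∴ lem (inA w * E u w) (+ n) (missB w))
        ∴ lem₁ (+ 23 * + n * a u) (∑ (λ w → (inA w * E u w) * missB w))
        where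
        lem₁ : ∀ y s → y + (- + 200 * s + 0ℤ) ≡ y - + 200 * s
        lem₁ y s = solve (y ∷ s ∷ [])
      contained : Pos (∑ (λ w → (inA w * E u w) * missB w) - ρ u)
      contained = total-pos (∑₂ n)
        ((1ℤ , (λ (w , z) → (inA w * E u w) * (inB z * (1ℤ - E w z)))) ∷ (-1ℤ , (λ (w , z) → (inA w * inB z) * (E u w * E u z * (1ℤ - E w z)))) ∷ [])
        (λ (w , z) → pt (cls w) (cls z) (adj u w) (adj u z) (adj w z))
        ∴ trans (cong (λ y → 1ℤ * y + (-1ℤ * ρ u + 0ℤ))
                (sum-cong-≗ (λ w → ≡-sym (*-distribˡ-sum (inA w * E u w) (λ z → inB z * (1ℤ - E w z))))))
                (lem₂ (∑ (λ w → (inA w * E u w) * missB w)) (ρ u))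
        where
        lem₂ : ∀ s r → 1ℤ * s + (-1ℤ * r + 0ℤ) ≡ s - r
        lem₂ s r = solve (s ∷ r ∷ [])

    ρ≤c : ∀ u → Few-missing (+ n) (c u) (ρ u)
    ρ≤c u = few-missing (add-up (+ 23 * + n * c u) (∑ (λ w → (inB w * E u w) * missA w)) (ρ u) misses contained)
      where
      add-up : ∀ y s r → Pos (y - + 200 * s) → Pos (s - r) → Pos (y - + 200 * r)
      add-up y s r h h′ = h ⊕ pos 200 ⊗ h′ ∴ solve (y ∷ s ∷ r ∷ [])
      lem : ∀ y m z → y * (+ 23 * m - + 200 * z) ≡ + 23 * m * y + (- + 200 * (y * z) + 0ℤ)
      lem y m z = solve (y ∷ m ∷ z ∷ [])
      ρ-swap : Σ₂ (λ (w , z) → (inA z * inB w) * (E u z * E u w * (1ℤ - E w z))) ≡ ρ u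
      ρ-swap = trans (Σ₂-swap (λ (w , z) → (inA z * inB w) * (E u z * E u w * (1ℤ - E w z))))
        (cong-Φ (∑₂ n) (λ (z , w) → cong (λ e → (inA z * inB w) * (E u z * E u w * (1ℤ - e))) (E-sym w z)))
      pt : ∀ c c′ e e′ e″ → Pos (1ℤ * ((isB c * ⟦ e ⟧) * (isA c′ * (1ℤ - ⟦ e″ ⟧)))
                                + (-1ℤ * ((isA c′ * isB c) * (⟦ e′ ⟧ * ⟦ e ⟧ * (1ℤ - ⟦ e″ ⟧))) + 0ℤ))
      pt = exhaust (all-Cls? λ _ → all-Cls? λ _ → all-Bool? λ _ → all-Bool? λ _ → all-Bool? λ _ → _ ≤? _)
      misses : Pos (+ 23 * + n * c u - + 200 * ∑ (λ w → (inB w * E u w) * missA w))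
      misses = total-pos (∑₁ n)
        ((+ 23 * + n , (λ w → inB w * E u w)) ∷ (- + 200 , (λ w → (inB w * E u w) * missA w)) ∷ [])
        (λ w → weighted-miss {cls w} {B} isB (+ 23 * + n - + 200 * missA w) (missA≤ w)
                 (λ { B → inj₁ refl ; A → inj₂ refl ; X → inj₂ refl }) (exhaust (all-Cls? λ _ → _ ≤? _)) (adj u w)
               ∴ lem (inB w * E u w) (+ n) (missA w))
        ∴ lem₁ (+ 23 * + n * c u) (∑ (λ w → (inB w * E u w) * missA w))
        where
        lem₁ : ∀ y s → y + (- + 200 * s + 0ℤ) ≡ y - + 200 * s
        lem₁ y s = solve (y ∷ s ∷ [])
      contained : Pos (∑ (λ w → (inB w * E u w) * missA w) - ρ u)
      contained = total-pos (∑₂ n)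
        ((1ℤ , (λ (w , z) → (inB w * E u w) * (inA z * (1ℤ - E w z)))) ∷ (-1ℤ , (λ (w , z) → (inA z * inB w) * (E u z * E u w * (1ℤ - E w z)))) ∷ [])
        (λ (w , z) → pt (cls w) (cls z) (adj u w) (adj u z) (adj w z))
        ∴ trans (cong₂ (λ y r → 1ℤ * y + (-1ℤ * r + 0ℤ))
                (sum-cong-≗ (λ w → ≡-sym (*-distribˡ-sum (inB w * E u w) (λ z → inA z * (1ℤ - E w z))))) ρ-swap)
                (lem₂ (∑ (λ w → (inB w * E u w) * missA w)) (ρ u))
        where
        lem₂ : ∀ s r → 1ℤ * s + (-1ℤ * r + 0ℤ) ≡ s - r
        lem₂ s r = solve (s ∷ r ∷ [])

    private
      exceptional : ∀ {u} → cls u ≡ X → Pos (+ 100 * f u - + 11 * + n) × Pos (+ 100 * (+ n - f u) - + 11 * + n)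
      exceptional {u} e = go (spec u) e
        where
        go : ∀ {c} → Spec (+ n) (f u) c → c ≡ X → Pos (+ 100 * f u - + 11 * + n) × Pos (+ 100 * (+ n - f u) - + 11 * + n)
        go (neither h h′) refl = h , h′

      -- The bounds on `d` and `f` give `d - f ≤ 167m/400`, and `x + 2y ≤ 3m/110` fits into the
      -- `11m/400` left below `89m/200`. The factor 2 of `y` is due to neighbours in the first class
      -- on the wrong side, which raise both `a` and `f`.
      one-class : ∀ m d f y y′ x a c → Pos (+ 211 * m - + 400 * d) → Pos (+ 100 * f - + 11 * m)
        → Pos (+ 3 * m - (+ 110 * x + + 890 * (y + y′))) → Pos x → Pos y → Pos y′ → Pos (d - f + + 2 * y + x + c - a)
        → Pos (+ 89 * m + + 200 * c - + 200 * a)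
      one-class m d f y y′ x a c hd hf hx x≥0 hy hy′ h = Pos-cancel {+ 2} {+ 89 * m + + 200 * c - + 200 * a} (pos 1)
        (pos 400 ⊗ h ⊕ hd ⊕ pos 4 ⊗ hf ⊕ small ∴ solve (m ∷ d ∷ f ∷ y ∷ x ∷ a ∷ c ∷ []))
        where
        small₀ : Pos (+ 3 * m - + 110 * (x + + 2 * y))
        small₀ = hx ⊕ pos 670 ⊗ hy ⊕ pos 890 ⊗ hy′ ∴ solve (m ∷ x ∷ y ∷ y′ ∷ [])
        small : Pos (+ 11 * m - + 400 * (x + + 2 * y))
        small = Pos-cancel {+ 3} {+ 11 * m - + 400 * (x + + 2 * y)} (pos 2)
          (pos 11 ⊗ small₀ ⊕ pos 10 ⊗ (x≥0 ⊕ pos 2 ⊗ hy) ∴ solve (m ∷ x ∷ y ∷ []))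

      D-upper : Pos (+ 211 * + n - + 400 * D)
      D-upper = balanced (- (+ n - + 2 * D)) (neg-sq (+ n - + 2 * D)) ∴ lem (+ n) D
        where
        neg-sq : ∀ z → - z * - z ≡ z * z
        neg-sq z = solve (z ∷ [])
        lem : ∀ m d → + 11 * m - + 200 * - (m - + 2 * d) ≡ + 211 * m - + 400 * d
        lem m d = solve (m ∷ d ∷ [])

      D-lower : Pos (+ 211 * + n - + 400 * (+ n - D))
      D-lower = balanced (+ n - + 2 * D) refl ∴ lem (+ n) D
        where
        lem : ∀ m d → + 11 * m - + 200 * (m - + 2 * d) ≡ + 211 * m - + 400 * (m - d)
        lem m d = solve (m ∷ d ∷ [])

    a≤c : ∀ u → cls u ≡ X → One-sided (+ n) (a u) (c u)
    a≤c u e = one-sided (one-class (+ n) D (f u) yA yB x (a u) (c u) D-upper (proj₁ (exceptional e)) few-exceptional x≥0 yA≥0 yB≥0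
      (total-pos (∑₁ n) ((1ℤ , ε) ∷ (-1ℤ , (λ w → δ (adj v w) (adj u w))) ∷ (+ 2 , (λ w → inA w * (1ℤ - ε w))) ∷ (1ℤ , inX)
          ∷ (1ℤ , (λ w → inB w * E u w)) ∷ (-1ℤ , (λ w → inA w * E u w)) ∷ [])
        (λ w → pt (cls w) (adj v w) (adj u w))
      ∴ lem D (f u) yA x (c u) (a u)))
      where
      pt : ∀ k e e′ → Pos (1ℤ * ⟦ e ⟧ + (-1ℤ * δ e e′ + (+ 2 * (isA k * (1ℤ - ⟦ e ⟧)) + (1ℤ * isX k
             + (1ℤ * (isB k * ⟦ e′ ⟧) + (-1ℤ * (isA k * ⟦ e′ ⟧) + 0ℤ))))))
      pt = exhaust (all-Cls? λ _ → all-Bool? λ _ → all-Bool? λ _ → _ ≤? _)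
      lem : ∀ d f y x c a → 1ℤ * d + (-1ℤ * f + (+ 2 * y + (1ℤ * x + (1ℤ * c + (-1ℤ * a + 0ℤ))))) ≡ d - f + + 2 * y + x + c - a
      lem d f y x c a = solve (d ∷ f ∷ y ∷ x ∷ c ∷ a ∷ [])

    c≤a : ∀ u → cls u ≡ X → One-sided (+ n) (c u) (a u)
    c≤a u e = one-sided (one-class (+ n) (+ n - D) (+ n - f u) yB yA x (c u) (a u) D-lower (proj₂ (exceptional e))
      (few-exceptional ∴ cong (λ z → + 3 * + n - (+ 110 * x + + 890 * z)) (ℤₚ.+-comm yA yB)) x≥0 yB≥0 yA≥0
      (total-pos (∑₁ n) ((-1ℤ , ε) ∷ (1ℤ , (λ w → δ (adj v w) (adj u w))) ∷ (+ 2 , (λ w → inB w * ε w)) ∷ (1ℤ , inX)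
          ∷ (1ℤ , (λ w → inA w * E u w)) ∷ (-1ℤ , (λ w → inB w * E u w)) ∷ [])
        (λ w → pt (cls w) (adj v w) (adj u w))
      ∴ lem D (f u) yB x (a u) (c u) (+ n)))
      where
      pt : ∀ k e e′ → Pos (-1ℤ * ⟦ e ⟧ + (1ℤ * δ e e′ + (+ 2 * (isB k * ⟦ e ⟧) + (1ℤ * isX k
             + (1ℤ * (isA k * ⟦ e′ ⟧) + (-1ℤ * (isB k * ⟦ e′ ⟧) + 0ℤ))))))
      pt = exhaust (all-Cls? λ _ → all-Bool? λ _ → all-Bool? λ _ → _ ≤? _)
      lem : ∀ d f y x c a m → -1ℤ * d + (1ℤ * f + (+ 2 * y + (1ℤ * x + (1ℤ * c + (-1ℤ * a + 0ℤ)))))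
        ≡ (m - d) - (m - f) + + 2 * y + x + c - a
      lem d f y x c a m = solve (d ∷ f ∷ y ∷ x ∷ c ∷ a ∷ m ∷ [])

    module Independence (b : ℤ) (4b≤n : Pos (+ n - + 4 * b))
      (book : ∀ u w → Pos (E u w * (b - ∑ (λ v → E w v * E u v)))) where

      private
        cod : Fin n → Fin n → ℤ
        cod u w = ∑ (λ z → E w z * E u z)

        contradiction : ∀ m b d f g k → Pos (m - 1ℤ) → Pos (m - + 4 * b) → Pos (+ 211 * m - + 400 * (m - d))
          → Pos (+ 11 * m - + 100 * f) → Pos (+ 11 * m - + 100 * g) → Pos (1ℤ * (b - k)) → Pos (k - d + f + g) → ⊥
        contradiction m b d f g k hm h₀ h₁ h₂ h₃ h₄ h₅ = ¬Pos { -1ℤ} (pos 0)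
          (pos 400 ⊗ (h₄ ⊕ h₅) ⊕ pos 100 ⊗ h₀ ⊕ h₁ ⊕ pos 4 ⊗ (h₂ ⊕ h₃) ⊕ hm ∴ solve (m ∷ b ∷ d ∷ f ∷ g ∷ k ∷ []))

        A-A : ∀ {u w} → cls u ≡ A → cls w ≡ A → adj u w ≡ true → ⊥
        A-A {u} {w} hu hw e = contradiction (+ n) b (+ n - D) (+ n - f u) (+ n - f w) (cod u w) n≥1 4b≤n
          (D-upper ∴ lem₀ (+ n) D) (A-like⁻ hu) (A-like⁻ hw)
          (subst (λ e → Pos (⟦ e ⟧ * (b - cod u w))) e (book u w))
          (total-pos (∑₁ n) ((1ℤ , (λ z → E w z * E u z)) ∷ (-1ℤ , (λ z → 1ℤ - ε z))
             ∷ (1ℤ , (λ z → 1ℤ - δ (adj v z) (adj u z))) ∷ (1ℤ , (λ z → 1ℤ - δ (adj v z) (adj w z))) ∷ [])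
             (λ z → pt (adj v z) (adj u z) (adj w z))
           ∴ trans (cong₂ (λ y y′ → 1ℤ * cod u w + (-1ℤ * y + (1ℤ * y′ + (1ℤ * ∑ (λ z → 1ℤ - δ (adj v z) (adj w z)) + 0ℤ))))
                     (∑-sub-const ε) (∑-sub-const (λ z → δ (adj v z) (adj u z))))
             (trans (cong (λ y → 1ℤ * cod u w + (-1ℤ * (+ n - D) + (1ℤ * (+ n - f u) + (1ℤ * y + 0ℤ))))
                     (∑-sub-const (λ z → δ (adj v z) (adj w z))))
                    (lem (cod u w) (+ n - D) (+ n - f u) (+ n - f w))))
          where
          lem₀ : ∀ m d → + 211 * m - + 400 * d ≡ + 211 * m - + 400 * (m - (m - d))
          lem₀ m d = solve (m ∷ d ∷ [])
          lem : ∀ k d f g → 1ℤ * k + (-1ℤ * d + (1ℤ * f + (1ℤ * g + 0ℤ))) ≡ k - d + f + g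
          lem k d f g = solve (k ∷ d ∷ f ∷ g ∷ [])
          pt : ∀ e e′ e″ → Pos (1ℤ * (⟦ e″ ⟧ * ⟦ e′ ⟧) + (-1ℤ * (1ℤ - ⟦ e ⟧) + (1ℤ * (1ℤ - δ e e′) + (1ℤ * (1ℤ - δ e e″) + 0ℤ))))
          pt = exhaust (all-Bool? λ _ → all-Bool? λ _ → all-Bool? λ _ → _ ≤? _)

        B-B : ∀ {u w} → cls u ≡ B → cls w ≡ B → adj u w ≡ true → ⊥
        B-B {u} {w} hu hw e = contradiction (+ n) b D (f u) (f w) (cod u w) n≥1 4b≤n
          D-lower (B-like⁻ hu) (B-like⁻ hw)
          (subst (λ e → Pos (⟦ e ⟧ * (b - cod u w))) e (book u w))
          (total-pos (∑₁ n) ((1ℤ , (λ z → E w z * E u z)) ∷ (-1ℤ , ε)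
             ∷ (1ℤ , (λ z → δ (adj v z) (adj u z))) ∷ (1ℤ , (λ z → δ (adj v z) (adj w z))) ∷ [])
             (λ z → pt (adj v z) (adj u z) (adj w z))
           ∴ lem (cod u w) D (f u) (f w))
          where
          lem : ∀ k d f g → 1ℤ * k + (-1ℤ * d + (1ℤ * f + (1ℤ * g + 0ℤ))) ≡ k - d + f + g
          lem k d f g = solve (k ∷ d ∷ f ∷ g ∷ [])
          pt : ∀ e e′ e″ → Pos (1ℤ * (⟦ e″ ⟧ * ⟦ e′ ⟧) + (-1ℤ * ⟦ e ⟧ + (1ℤ * δ e e′ + (1ℤ * δ e e″ + 0ℤ))))
          pt = exhaust (all-Bool? λ _ → all-Bool? λ _ → all-Bool? λ _ → _ ≤? _)

      independent : ∀ u w → compatible (cls u) (cls w) (adj u w) ≡ true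
      independent u w = go (cls u) (cls w) (adj u w) A-A B-B
        where
        go : ∀ c c′ e → (c ≡ A → c′ ≡ A → e ≡ true → ⊥) → (c ≡ B → c′ ≡ B → e ≡ true → ⊥) → compatible c c′ e ≡ true
        go A A true h h′ = ⊥-elim (h refl refl refl)
        go A A false h h′ = refl
        go A B e h h′ = refl
        go A X e h h′ = refl
        go B A e h h′ = refl
        go B B true h h′ = ⊥-elim (h′ refl refl refl)
        go B B false h h′ = refl
        go B X e h h′ = refl
        go X c e h h′ = refl

  -- Combining the estimates

  module Range (n b : ℤ) (k≥1 : Pos (n - + 4 * b - 1ℤ)) (k-small : Pos (+ 4 * b - + 499 * (n - + 4 * b))) where

    private
      k≥0 : Pos (n - + 4 * b)
      k≥0 = k≥1 ⊕ pos 1 ∴ solve (n ∷ b ∷ [])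

    b≥124k : Pos (b - + 124 * (n - + 4 * b))
    b≥124k = Pos-cancel {+ 4} {b - + 124 * (n - + 4 * b)} (pos 3) (k-small ⊕ pos 3 ⊗ k≥0 ∴ solve (n ∷ b ∷ []))

    b≥124 : Pos (b - + 124)
    b≥124 = b≥124k ⊕ pos 124 ⊗ k≥1 ∴ solve (n ∷ b ∷ [])

    b≥1 : Pos (b - 1ℤ)
    b≥1 = b≥124 ⊕ pos 123 ∴ solve (b ∷ [])

    4b≥12 : Pos (+ 4 * b - + 12)
    4b≥12 = pos 4 ⊗ b≥124 ⊕ pos 484 ∴ solve (b ∷ [])

    n-bound : Pos (+ 101 * b - + 25 * n)
    n-bound = b≥124k ⊕ pos 99 ⊗ k≥0 ∴ solve (n ∷ b ∷ [])

    n≤5b : Pos (+ 5 * b - n)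
    n≤5b = b≥124k ⊕ pos 123 ⊗ k≥0 ∴ solve (n ∷ b ∷ [])

    x-bound : ∀ {x} → Pos (+ 3 * n - + 110 * x) → Pos (b - + 9 * x)
    x-bound {x} h = Pos-cancel {+ 110} {b - + 9 * x} (pos 109)
      (pos 9 ⊗ h ⊕ pos 2 ⊗ b≥124k ⊕ pos 221 ⊗ k≥0 ∴ solve (n ∷ b ∷ x ∷ []))

    -- `nS ≤ 2τ = 12T ≤ 12b²k`, which by `4b ≤ n` gives `S ≤ 3nk/4`; and `k-small` is `500k ≤ n` in
    -- another form.
    few-bad : ∀ {S T τ} → Pos (n - 1ℤ) → τ ≡ + 6 * T → Pos (b * b * (n - + 4 * b) - T) → Pos (+ 2 * τ - n * S)
      → Pos (+ 3 * (n * n) - + 2000 * S)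
    few-bad {S} {T} n≥1 refl hT hS = pos 500 ⊗ bad ⊕ pos 3 ⊗ n≥0 ⊗ (k-small)
        ∴ lem n b S
      where
      n≥0 : Pos n
      n≥0 = weaken n≥1
      b≥0 : Pos b
      b≥0 = weaken b≥1
      bad : Pos (+ 3 * n * (n - + 4 * b) - + 4 * S)
      bad = Pos-cancel {n} {+ 3 * n * (n - + 4 * b) - + 4 * S} n≥1
        (pos 4 ⊗ hS ⊕ pos 48 ⊗ hT ⊕ pos 3 ⊗ k≥0 ⊗ k≥0 ⊗ (n≥0 ⊕ pos 4 ⊗ b≥0) ∴ solve (n ∷ b ∷ S ∷ T ∷ []))
      lem : ∀ n b S → + 500 * (+ 3 * n * (n - + 4 * b) - + 4 * S) + + 3 * n * (+ 4 * b - + 499 * (n - + 4 * b))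
        ≡ + 3 * (n * n) - + 2000 * S
      lem n b S = solve (n ∷ b ∷ S ∷ [])

  record Hypotheses (n : ℕ) (b T : ℤ) (adj : Fin n → Fin n → Bool) : Set where
    field
      adj-sym : ∀ u v → adj u v ≡ adj v u
      k≥1 : Pos (+ n - + 4 * b - 1ℤ)
      k-small : Pos (+ 4 * b - + 499 * (+ n - + 4 * b))
      n≥1 : Pos (+ n - 1ℤ)
      many-edges : Pos (+ 2 * Neighbourhood-cuts.M adj adj-sym - + n * + n)
      six : Neighbourhood-cuts.τ adj adj-sym ≡ + 6 * T
      few-triangles : Pos (b * b * (+ n - + 4 * b) - T)
      book : ∀ u w → Pos (⟦ adj u w ⟧ * (b - ∑ (λ v → ⟦ adj w v ⟧ * ⟦ adj u v ⟧)))

  record Bipartition {n} (adj : Fin n → Fin n → Bool) (adj-sym : ∀ u v → adj u v ≡ adj v u) (cls : Fin n → Cls) : Set where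
    open Partition adj adj-sym cls
    field
      independent : ∀ u v → compatible (cls u) (cls v) (adj u v) ≡ true
      x≡0 : x ≡ 0ℤ
      p≡q : (p - q) * (p - q) ≡ 0ℤ
      r≡0 : r ≡ 0ℤ

  record Extremal {n} (b T : ℤ) (adj : Fin n → Fin n → Bool) (adj-sym : ∀ u v → adj u v ≡ adj v u) (cls : Fin n → Cls) : Set where
    open Partition adj adj-sym cls
    field
      independent : ∀ u v → compatible (cls u) (cls v) (adj u v) ≡ true
      T≡ : T ≡ b * b * (+ n - + 4 * b)
      x≡k : x ≡ + n - + 4 * b
      p≡q : (p - q) * (p - q) ≡ 0ℤ
      r≡0 : r ≡ 0ℤ
      Z≡0 : Z ≡ 0ℤ
      Y≡0 : Y ≡ 0ℤ
      tight : ∀ u → cls u ≡ X → a u ≡ b × c u ≡ b × s u ≡ 0ℤ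

  module Structure {n : ℕ} {b T : ℤ} {adj : Fin n → Fin n → Bool} (hyp : Hypotheses n b T adj) where

    open Hypotheses hyp
    open Range (+ n) b k≥1 k-small

    private
      cut : ∃ λ v → Pos (+ 2 * Neighbourhood-cuts.τ adj adj-sym - + n * Neighbourhood-cuts.same adj adj-sym v)
      cut = Neighbourhood-cuts.good-cut adj adj-sym n≥1 many-edges

      centre : Fin n
      centre = proj₁ cut

      module C = Cut adj adj-sym n≥1 many-edges centre
        (few-bad {Neighbourhood-cuts.same adj adj-sym centre} {T} n≥1 six few-triangles (proj₂ cut))

      b≥0 : Pos b
      b≥0 = weaken {b} b≥1

    cls : Fin n → Cls
    cls = C.cls

    open Partition adj adj-sym cls
    open Book b book

    private
      x≥0 : Pos x
      x≥0 = C.x≥0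

      k≥0 : Pos (+ n - + 4 * b)
      k≥0 = weaken {+ n - + 4 * b} k≥1

      independent : ∀ u v → compatible (cls u) (cls v) (adj u v) ≡ true
      independent = C.Independence.independent b k≥0 book

      9x≤b : Pos (b - + 9 * x)
      9x≤b = x-bound {x} (C.few-exceptional ⊕ pos 890 ⊗ (C.yA≥0 ⊕ C.yB≥0) ∴ lem (+ n) x (C.yA + C.yB))
        where
        lem : ∀ m x y → + 3 * m - (+ 110 * x + + 890 * y) + + 890 * y ≡ + 3 * m - + 110 * x
        lem m x y = solve (m ∷ x ∷ y ∷ [])

      vertex : ∀ {ℓ} → Pos (ℓ - + 12) → ∀ u → cls u ≡ X → VertexBounds (+ n) b (d u) ℓ x (a u) (c u) (t u) (s u) (ρ u)
      vertex hℓ u e = record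
        { n-bound = n-bound ; n≤5b = n≤5b ; b≥1 = b≥1 ; x-bound = 9x≤b
        ; d≥0 = degree-pos inX inX-pos u ; d≤x = degree≤ inX inX-pos u ; ℓ≥12 = hℓ
        ; a≥0 = degree-pos inA inA-pos u ; c≥0 = degree-pos inB inB-pos u
        ; t≥0 = t-pos u ; s≥0 = s-pos u ; ρ≥0 = ρ-pos u ; s≤ = s≤x[a+c] u ; ac≡ = ac≡t+ρ u
        ; t≤bc = t≤bc u ; t≤ba = t≤ba u ; 2t+s≤ = 2t+s≤b[a+c] u
        ; ρ≤c = C.ρ≤c u ; ρ≤a = C.ρ≤a u ; a≤c = C.a≤c u e ; c≤a = C.c≤a u e }

      h : ℤ → Fin n → ℤ
      h ℓ u = surplus b (d u) ℓ (a u - b) (c u - b) (s u) (ρ u)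

      isX-dichotomy : ∀ c → c ≡ X ⊎ isX c ≡ 0ℤ
      isX-dichotomy A = inj₂ refl
      isX-dichotomy B = inj₂ refl
      isX-dichotomy X = inj₁ refl

      term : ℤ → Fin n → ℤ
      term ℓ u = inX u * h ℓ u

      term-pos : ∀ {ℓ} → Pos (ℓ - + 12) → ∀ u → Pos (term ℓ u)
      term-pos {ℓ} hℓ u =
        [ (λ e → _⊗_ {inX u} {h ℓ u} (inX-pos u) (Vertex.surplus≥0 (vertex {ℓ} hℓ u e)))
        , (λ e → subst (λ z → Pos (z * h ℓ u)) (≡-sym e) (subst Pos (≡-sym (ℤₚ.*-zeroˡ (h ℓ u))) (pos 0))) ]′
        (isX-dichotomy (cls u))

      Tt R Sσ Sd : ℤ
      Tt = ∑ (λ u → inX u * t u)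
      R = ∑ (λ u → inX u * ρ u)
      Sσ = ∑ (λ u → inX u * (a u + c u - + 2 * b))
      Sd = ∑ (λ u → inX u * ((a u + c u - + 2 * b) * d u))

      H : ℤ → ℤ
      H ℓ = ∑ (term ℓ)

      H≡ : ∀ ℓ → H ℓ ≡ + 4 * Tt + + 2 * C - + 4 * (b * b) * x - ℓ * C + + 20 * (ℓ * R) - ℓ * (+ 4 * b * Sσ - Sd)
      H≡ ℓ = trans (sum-cong-≗ (λ u → pt (inX u) (d u) (a u) (c u) (s u) (t u) (ρ u) (ac≡t+ρ u)))
        (trans (Φ-total (∑₁ n) ((+ 4 , (λ u → inX u * t u)) ∷ (+ 2 - ℓ , (λ u → inX u * s u)) ∷ (- (+ 4 * (b * b)) , inX)
             ∷ (+ 20 * ℓ , (λ u → inX u * ρ u)) ∷ (- (ℓ * (+ 4 * b)) , (λ u → inX u * (a u + c u - + 2 * b)))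
             ∷ (ℓ , (λ u → inX u * ((a u + c u - + 2 * b) * d u))) ∷ []))
          (lem ℓ b Tt C x R Sσ Sd))
        where
        pt : ∀ i d a c s t ρ → a * c ≡ t + ρ → i * surplus b d ℓ (a - b) (c - b) s ρ
          ≡ + 4 * (i * t) + ((+ 2 - ℓ) * (i * s) + (- (+ 4 * (b * b)) * i + (+ 20 * ℓ * (i * ρ)
             + (- (ℓ * (+ 4 * b)) * (i * (a + c - + 2 * b)) + (ℓ * (i * ((a + c - + 2 * b) * d)) + 0ℤ)))))
        pt i d a c s t ρ e = trans (lem₁ b ℓ i d a c s ρ) (trans (cong (λ z → + 4 * (i * (z - ρ)) + ((+ 2 - ℓ) * (i * s) + (- (+ 4 * (b * b)) * i + (+ 20 * ℓ * (i * ρ)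
             + (- (ℓ * (+ 4 * b)) * (i * (a + c - + 2 * b)) + (ℓ * (i * ((a + c - + 2 * b) * d)) + 0ℤ)))))) e)
             (lem₂ t ρ i ((+ 2 - ℓ) * (i * s) + (- (+ 4 * (b * b)) * i + (+ 20 * ℓ * (i * ρ)
             + (- (ℓ * (+ 4 * b)) * (i * (a + c - + 2 * b)) + (ℓ * (i * ((a + c - + 2 * b) * d)) + 0ℤ)))))))
          where
          lem₁ : ∀ b ℓ i d a c s ρ → i * (+ 4 * ((b + (a - b)) * (b + (c - b)) - ρ) + + 2 * s - + 4 * (b * b) - ℓ * s + + 20 * (ℓ * ρ)
              - ℓ * (((a - b) + (c - b)) * (+ 4 * b - d)))
            ≡ + 4 * (i * (a * c - ρ)) + ((+ 2 - ℓ) * (i * s) + (- (+ 4 * (b * b)) * i + (+ 20 * ℓ * (i * ρ)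
             + (- (ℓ * (+ 4 * b)) * (i * (a + c - + 2 * b)) + (ℓ * (i * ((a + c - + 2 * b) * d)) + 0ℤ)))))
          lem₁ b ℓ i d a c s ρ = solve (b ∷ ℓ ∷ i ∷ d ∷ a ∷ c ∷ s ∷ ρ ∷ [])
          lem₂ : ∀ t ρ i z → + 4 * (i * (t + ρ - ρ)) + z ≡ + 4 * (i * t) + z
          lem₂ t ρ i z = solve (t ∷ ρ ∷ i ∷ z ∷ [])
        lem : ∀ ℓ b t c x r s d → + 4 * t + ((+ 2 - ℓ) * c + (- (+ 4 * (b * b)) * x + (+ 20 * ℓ * r + (- (ℓ * (+ 4 * b)) * s + (ℓ * d + 0ℤ)))))
          ≡ + 4 * t + + 2 * c - + 4 * (b * b) * x - ℓ * c + + 20 * (ℓ * r) - ℓ * (+ 4 * b * s - d)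
        lem ℓ b t c x r s d = solve (ℓ ∷ b ∷ t ∷ c ∷ x ∷ r ∷ s ∷ d ∷ [])

      few : Pos (+ 4 * T - (+ 4 * Tt + + 2 * C))
      few = Pos-cancel {+ 3} {+ 4 * T - (+ 4 * Tt + + 2 * C)} (pos 2)
        (pos 2 ⊗ triangles ∴ trans (cong (λ z → + 2 * (z - (+ 6 * Tt + + 3 * C))) six) (lem T Tt C))
        where
        lem : ∀ t u c → + 2 * (+ 6 * t - (+ 6 * u + + 3 * c)) ≡ + 3 * (+ 4 * t - (+ 4 * u + + 2 * c))
        lem t u c = solve (t ∷ u ∷ c ∷ [])

      edge-bound : Pos (+ 4 * Sσ + + 2 * e₂ + x * x - (p - q) * (p - q) - + 2 * x * (+ n - + 4 * b) - + 4 * r)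
      edge-bound = Edges.edges independent b many-edges

      excess : ∀ ℓ → Pos ℓ → Pos (Excess b (+ n) ℓ T (H ℓ) p q x r R Z Y)
      excess ℓ hℓ = combine {b} {+ n} {ℓ} {T} {Tt} {C} {H ℓ} {Sσ} {Sd} {e₂} {p} {q} {x} {r} {R} {Z} {Y}
        hℓ b≥0 few (H≡ ℓ) edge-bound (neighbourhoods b)

      r≥0 : Pos r
      r≥0 = positive (∑₂ n) (λ (v , w) → pt (cls v) (cls w) (adj v w))
        where
        pt : ∀ c c′ e → Pos ((isA c * isB c′) * (1ℤ - ⟦ e ⟧))
        pt = exhaust (all-Cls? λ _ → all-Cls? λ _ → all-Bool? λ _ → _ ≤? _)

      R≤ : Pos (x * r - R)
      R≤ = positive (∑₁ n) (λ u → inX-pos u ⊗ ρ≤r u)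
        ∴ trans (sum-cong-≗ (λ u → lem (inX u) r (ρ u)))
          (trans (Φ-total (∑₁ n) ((r , inX) ∷ (-1ℤ , (λ u → inX u * ρ u)) ∷ [])) (lem′ r x R))
        where
        lem : ∀ i r ρ → i * (r - ρ) ≡ r * i + (-1ℤ * (i * ρ) + 0ℤ)
        lem i r ρ = solve (i ∷ r ∷ ρ ∷ [])
        lem′ : ∀ r x y → r * x + (-1ℤ * y + 0ℤ) ≡ x * r - y
        lem′ r x y = solve (r ∷ x ∷ y ∷ [])

      Z≥0 : Pos Z
      Z≥0 = positive (∑₃ n) (λ (u , v , w) → pt (cls u) (cls v) (cls w) (adj u v) (adj w u) (adj w v))
        where
        pt : ∀ k k′ k″ e e′ e″ → Pos ((isX k * isX k′ * isN k″) * ((1ℤ - ⟦ e ⟧) * (⟦ e′ ⟧ + ⟦ e″ ⟧ - + 2 * (⟦ e′ ⟧ * ⟦ e″ ⟧))))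
        pt = exhaust (all-Cls? λ _ → all-Cls? λ _ → all-Cls? λ _ → all-Bool? λ _ → all-Bool? λ _ → all-Bool? λ _ → _ ≤? _)

      Y≥0 : Pos Y
      Y≥0 = ∑-positive (λ w → inN-pos w ⊗ Pos-sq (x - + 2 * d w))

    -- Without exceptional vertices all sums over X vanish, and the edge bound becomes
    -- `(p - q)² + 4r ≤ 0`.
    bipartition : x ≡ 0ℤ → Bipartition adj adj-sym cls
    bipartition x≡0 = record { independent = independent ; x≡0 = x≡0
      ; p≡q = Pos-antisym (Pos-sq (p - q)) (proj₁ bounds) ; r≡0 = Pos-antisym r≥0 (proj₂ bounds) }
      where
      none : ∀ u → inX u ≡ 0ℤ
      none = ∑-definite inX-pos x≡0
      vanish : ∀ (g : Fin n → ℤ) → ∑ (λ u → inX u * g u) ≡ 0ℤ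
      vanish g = trans (sum-cong-≗ (λ u → trans (cong (λ z → z * g u) (none u)) (ℤₚ.*-zeroˡ (g u))))
                       (trans (∑-const n 0ℤ) (ℤₚ.*-zeroʳ (+ n)))
      abstract-bounds : ∀ {S e x m b} p q r → S ≡ 0ℤ → e ≡ 0ℤ → x ≡ 0ℤ → Pos r →
        Pos (+ 4 * S + + 2 * e + x * x - (p - q) * (p - q) - + 2 * x * (m - + 4 * b) - + 4 * r) →
        Pos (- ((p - q) * (p - q))) × Pos (- r)
      abstract-bounds {m = m} {b} p q r refl refl refl hr h =
        (h ⊕ pos 4 ⊗ hr ∴ solve (m ∷ b ∷ p ∷ q ∷ r ∷ [])) ,
        Pos-cancel {+ 4} { - r} (pos 3) (h ⊕ Pos-sq (p - q) ∴ solve (m ∷ b ∷ p ∷ q ∷ r ∷ []))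
      bounds : Pos (- ((p - q) * (p - q))) × Pos (- r)
      bounds = abstract-bounds {Sσ} {e₂} {x} {+ n} {b} p q r (vanish (λ u → a u + c u - + 2 * b)) (vanish d) x≡0 r≥0 edge-bound

    extremal : Pos (x - 1ℤ) → Extremal b T adj adj-sym cls
    extremal x≥1 = record { independent = independent ; T≡ = T≡ ; x≡k = x≡k ; p≡q = [p-q]²≡0 ; r≡0 = r≡0 ; Z≡0 = Z≡0 ; Y≡0 = Y≡0
      ; tight = λ u e → Vertex.tight (vertex {+ 12} (pos 0) u e) (ρ≡0 u) (h≡0 u e) }
      where
      module Few = Few-exceptional {b} {+ n} {T} {p} {q} {x} {r} {R} {Z} {Y} b≥1 x≥1 9x≤b few-triangles r≥0 R≤ Z≥0 Y≥0
      H≥0 : ∀ {ℓ} → Pos (ℓ - + 12) → Pos (H ℓ)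
      H≥0 {ℓ} hℓ = ∑-positive (term-pos {ℓ} hℓ)
      open Few.Tight {H (+ 12)} (H≥0 {+ 12} (pos 0))
        (Few.x≥k {H (+ 4 * b)} (H≥0 {+ 4 * b} 4b≥12) (excess (+ 4 * b) (pos 4 ⊗ b≥0)))
        (excess (+ 12) (pos 12))
      ρ≡0 : ∀ u → ρ u ≡ 0ℤ
      ρ≡0 u = Pos-antisym (ρ-pos u) (ρ≤r u ∴ trans (cong (λ z → z - ρ u) r≡0) (ℤₚ.+-identityˡ (- ρ u)))
      h≡0 : ∀ u → cls u ≡ X → h (+ 12) u ≡ 0ℤ
      h≡0 u e = trans (≡-sym (ℤₚ.*-identityˡ (h (+ 12) u)))
        (trans (cong (λ k → isX k * h (+ 12) u) (≡-sym e)) (∑-definite (term-pos {+ 12} (pos 0)) H≡0 u))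

    outcome : Bipartition adj adj-sym cls ⊎ Extremal b T adj adj-sym cls
    outcome = Pos-split (x - 1ℤ) (λ x≥1 → inj₂ (extremal x≥1))
      (λ h → inj₁ (bipartition (Pos-antisym x≥0 (subst Pos (lem x) h))))
      where
      lem : ∀ x → - (x - 1ℤ) - 1ℤ ≡ - x
      lem x = solve (x ∷ [])

  -- Colourings with equal class sizes

  module Colouring {K : Set} (_≟ᴷ_ : DecidableEquality K) where

    [_≐_] : K → K → ℤ
    [ k ≐ k′ ] = ⟦ does (k ≟ᴷ k′) ⟧

    ≐-refl : ∀ k → [ k ≐ k ] ≡ 1ℤ
    ≐-refl k with k ≟ᴷ k
    ... | yes _ = refl
    ... | no h = ⊥-elim (h refl)

    size : ∀ {n} → (Fin n → K) → K → ℤ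
    size f k = ∑ (λ i → [ f i ≐ k ])

    present : ∀ {n} (f : Fin n → K) k → ¬ (size f k ≡ 0ℤ) → ∃ λ i → f i ≡ k
    present {n} f k h with Finₚ.any? (λ i → f i ≟ᴷ k)
    ... | yes found = found
    ... | no none = ⊥-elim (h (trans (sum-cong-≗ absent) (trans (∑-const n 0ℤ) (ℤₚ.*-zeroʳ (+ n)))))
      where
      absent : ∀ i → [ f i ≐ k ] ≡ 0ℤ
      absent i with f i ≟ᴷ k
      ... | yes e = ⊥-elim (none (i , e))
      ... | no _ = refl

    -- By induction: vertex 0 is matched with some `j` of the same colour, which exists because that
    -- colour class is nonempty for `f` and hence for `g`. After deleting both, the sizes still
    -- agree.
    recolour : ∀ {n} (f g : Fin n → K) → (∀ k → size f k ≡ size g k) →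
      ∃ λ (π : Permutation′ n) → ∀ i → f i ≡ g (π ⟨$⟩ʳ i)
    recolour {ℕ.zero} f g h = Perm.id , λ ()
    recolour {ℕ.suc n} f g h = Perm.insert zero j π , matches
      where
      tail-pos : Pos (size (λ i → f (suc i)) (f zero))
      tail-pos = ∑-positive (λ i → pos (ind (does (f (suc i) ≟ᴷ f zero))))
      nonempty : ¬ (size g (f zero) ≡ 0ℤ)
      nonempty e = ¬Pos { -1ℤ} (pos 0) (subst Pos (shift (size (λ i → f (suc i)) (f zero)) [ f zero ≐ f zero ] (≐-refl (f zero)) (trans (h (f zero)) e)) tail-pos)
        where
        shift : ∀ y z → z ≡ 1ℤ → z + y ≡ 0ℤ → y ≡ -1ℤ
        shift y z refl e = trans (≡-sym (ℤₚ.+-identityˡ y)) (trans (ℤₚ.+-assoc -1ℤ 1ℤ y) (cong (λ z → -1ℤ + z) e))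
      found : ∃ λ j → g j ≡ f zero
      found = present g (f zero) nonempty
      j : Fin (ℕ.suc n)
      j = proj₁ found
      rest : ∀ k → size (λ i → f (suc i)) k ≡ size (λ i → g (punchIn j i)) k
      rest k = ∙-cancelˡ [ f zero ≐ k ] (size (λ i → f (suc i)) k) (size (λ i → g (punchIn j i)) k) (trans (h k)
        (trans (sum-remove {i = j} (λ i → [ g i ≐ k ])) (cong (λ z → [ z ≐ k ] + size (λ i → g (punchIn j i)) k) (proj₂ found))))
      ih : ∃ λ (π : Permutation′ n) → ∀ i → f (suc i) ≡ g (punchIn j (π ⟨$⟩ʳ i))
      ih = recolour (λ i → f (suc i)) (λ i → g (punchIn j i)) rest
      π : Permutation′ n
      π = proj₁ ih
      matches : ∀ i → f i ≡ g (Perm.insert zero j π ⟨$⟩ʳ i)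
      matches zero = ≡-sym (proj₂ found)
      matches (suc i) = trans (proj₂ ih i) (cong g (≡-sym (Perm.insert-punchIn zero j π i)))

    size-permute : ∀ {n} (f g : Fin n → K) (π : Permutation′ n) → (∀ i → f i ≡ g (π ⟨$⟩ʳ i)) → ∀ k → size f k ≡ size g k
    size-permute f g π h k = trans (sum-cong-≗ (λ i → cong (λ z → [ z ≐ k ]) (h i)))
                                   (≡-sym (∑-permute (λ i → [ g i ≐ k ]) π))

  -- The blow-up of the prism

  data Part : Set where
    U₁ U₂ U₃ V₁ V₂ V₃ : Part

  side index code : Part → ℕ
  side U₁ = 0
  side U₂ = 0
  side U₃ = 0
  side V₁ = 1
  side V₂ = 1
  side V₃ = 1
  index U₁ = 1
  index U₂ = 2
  index U₃ = 3
  index V₁ = 1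
  index V₂ = 2
  index V₃ = 3
  code k = side k ℕ.* 4 ℕ.+ index k

  decode : ℕ → Part
  decode 1 = U₁
  decode 2 = U₂
  decode 3 = U₃
  decode 5 = V₁
  decode 6 = V₂
  decode _ = V₃

  decode-code : ∀ k → decode (code k) ≡ k
  decode-code U₁ = refl
  decode-code U₂ = refl
  decode-code U₃ = refl
  decode-code V₁ = refl
  decode-code V₂ = refl
  decode-code V₃ = refl

  _≟ᴾ_ : DecidableEquality Part
  k ≟ᴾ l = map′ (λ e → trans (≡-sym (decode-code k)) (trans (cong decode e) (decode-code l))) (cong code)
                (code k ℕₚ.≟ code l)

  all-Part? : {P : Part → Set} → (∀ k → Dec (P k)) → Dec (∀ k → P k)
  all-Part? P? = map′ (λ { (a , b , c , d , e , f) → λ { U₁ → a ; U₂ → b ; U₃ → c ; V₁ → d ; V₂ → e ; V₃ → f } })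
    (λ h → h U₁ , h U₂ , h U₃ , h V₁ , h V₂ , h V₃)
    (P? U₁ ×-dec P? U₂ ×-dec P? U₃ ×-dec P? V₁ ×-dec P? V₂ ×-dec P? V₃)

  joined : Part → Part → Bool
  joined k l = (side k ≡ᵇ side l) xor (index k ≡ᵇ index l)

  -- The orderings of the two triangles of the prism. Edges of the matching lie in no triangle, so
  -- these are all ordered triangles of `joined`.
  triples : List (Part × Part × Part)
  triples = (U₁ , U₂ , U₃) ∷ (U₁ , U₃ , U₂) ∷ (U₂ , U₁ , U₃) ∷ (U₂ , U₃ , U₁) ∷ (U₃ , U₁ , U₂) ∷ (U₃ , U₂ , U₁)
          ∷ (V₁ , V₂ , V₃) ∷ (V₁ , V₃ , V₂) ∷ (V₂ , V₁ , V₃) ∷ (V₂ , V₃ , V₁) ∷ (V₃ , V₁ , V₂) ∷ (V₃ , V₂ , V₁) ∷ []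

  module _ {n : ℕ} (f : Fin n → Part) where

    open Colouring _≟ᴾ_

    private
      s : Part → ℤ
      s = size f

      term : Part × Part × Part → ℤ × (Fin n × Fin n × Fin n → ℤ)
      term (k , l , m) = 1ℤ , (λ (u , v , w) → [ f u ≐ k ] * ([ f v ≐ l ] * [ f w ≐ m ]))

      values : List (Part × Part × Part) → ℤ
      values [] = 0ℤ
      values ((k , l , m) ∷ L) = s k * (s l * s m) + values L

      total≡ : ∀ L → total (∑₃ n) (map term L) ≡ values L
      total≡ [] = refl
      total≡ ((k , l , m) ∷ L) = cong₂ _+_
        (trans (ℤₚ.*-identityˡ _) (trans (sum-cong-≗ (λ u → trans (scale (∑₂ n) [ f u ≐ k ] (λ (v , w) → [ f v ≐ l ] * [ f w ≐ m ]))
                                              (trans (cong (λ z → [ f u ≐ k ] * z) (∑∑-* (λ v → [ f v ≐ l ]) (λ w → [ f w ≐ m ])))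
                                                     (ℤₚ.*-comm [ f u ≐ k ] (s l * s m)))))
          (trans (≡-sym (*-distribˡ-sum (s l * s m) (λ u → [ f u ≐ k ]))) (ℤₚ.*-comm (s l * s m) (s k)))))
        (total≡ L)

    prism-triangles : Σ₃ (λ (u , v , w) → ⟦ joined (f u) (f v) ⟧ * (⟦ joined (f v) (f w) ⟧ * ⟦ joined (f u) (f w) ⟧))
      ≡ + 6 * (s U₁ * (s U₂ * s U₃) + s V₁ * (s V₂ * s V₃))
    prism-triangles = trans (cong-Φ (∑₃ n) (λ (u , v , w) → pt (f u) (f v) (f w)))
      (trans (Φ-total (∑₃ n) (map term triples)) (trans (total≡ triples) (lem (s U₁) (s U₂) (s U₃) (s V₁) (s V₂) (s V₃))))
      where
      L : Part → Part → Part → List (Part × Part × Part) → ℤ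
      L a b c [] = 0ℤ
      L a b c ((k , l , m) ∷ T) = 1ℤ * ([ a ≐ k ] * ([ b ≐ l ] * [ c ≐ m ])) + L a b c T
      pt : ∀ a b c → ⟦ joined a b ⟧ * (⟦ joined b c ⟧ * ⟦ joined a c ⟧) ≡ L a b c triples
      pt = exhaust (all-Part? λ _ → all-Part? λ _ → all-Part? λ _ → _ ≟ _)
      lem : ∀ a b c d e f → a * (b * c) + (a * (c * b) + (b * (a * c) + (b * (c * a) + (c * (a * b) + (c * (b * a)
        + (d * (e * f) + (d * (f * e) + (e * (d * f) + (e * (f * d) + (f * (d * e) + (f * (e * d) + 0ℤ)))))))))))
        ≡ + 6 * (a * (b * c) + d * (e * f))
      lem a b c d e f = solve (a ∷ b ∷ c ∷ d ∷ e ∷ f ∷ [])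

  count-below : ∀ {n} m → m ℕ.≤ n → ∑ {n} (λ i → ⟦ toℕ i <ᵇ m ⟧) ≡ + m
  count-below {n} ℕ.zero h = trans (∑-const n 0ℤ) (ℤₚ.*-zeroʳ (+ n))
  count-below {ℕ.suc n} (ℕ.suc m) (ℕ.s≤s h) = cong (λ z → 1ℤ + z) (count-below {n} m h)

  module Blow-up (b n : ℕ) (4b≤n : 4 ℕ.* b ℕ.≤ n) where

    open Colouring _≟ᴾ_

    private
      m c₅ : ℕ
      m = (n ∸ 4 ℕ.* b) ℕ./ 2
      c₅ = 4 ℕ.* b ℕ.+ m

      choose : Bool → Bool → Bool → Bool → Bool → Part
      choose e₁ e₂ e₃ e₄ e₅ = if e₁ then U₁ else if e₂ then U₂ else if e₃ then V₁ else if e₄ then V₂ else if e₅ then U₃ else V₃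

      lt : ℕ → ℕ → Bool
      lt k c = k <ᵇ c

      Monotone : Bool → Bool → Set
      Monotone e e′ = e ≡ true → e′ ≡ true

      mono : ∀ k {c c′} → c ℕ.≤ c′ → Monotone (lt k c) (lt k c′)
      mono k {c} {c′} h e = <ᵇ-true (ℕₚ.<-≤-trans (<ᵇ⇒< {k} {c} e) h)

      c₅≤n : c₅ ℕ.≤ n
      c₅≤n = ℕₚ.≤-trans (ℕₚ.+-monoʳ-≤ (4 ℕ.* b) (ℕᵈ.m/n≤m (n ∸ 4 ℕ.* b) 2)) (ℕₚ.≤-reflexive (ℕₚ.m+[n∸m]≡n 4b≤n))

      b≤2b : b ℕ.≤ 2 ℕ.* b
      b≤2b = ℕₚ.m≤m+n b (b ℕ.+ 0)
      2b≤3b : 2 ℕ.* b ℕ.≤ 3 ℕ.* b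
      2b≤3b = ℕₚ.*-monoˡ-≤ b {2} {3} (ℕ.s≤s (ℕ.s≤s ℕ.z≤n))
      3b≤4b : 3 ℕ.* b ℕ.≤ 4 ℕ.* b
      3b≤4b = ℕₚ.*-monoˡ-≤ b {3} {4} (ℕ.s≤s (ℕ.s≤s (ℕ.s≤s ℕ.z≤n)))
      4b≤c₅ : 4 ℕ.* b ℕ.≤ c₅
      4b≤c₅ = ℕₚ.m≤m+n (4 ℕ.* b) m

    part : Fin n → Part
    part i = choose (lt k b) (lt k (2 ℕ.* b)) (lt k (3 ℕ.* b)) (lt k (4 ℕ.* b)) (lt k c₅)
      where
      k : ℕ
      k = toℕ i

    private
      monotone-dec : ∀ e e′ → Dec (Monotone e e′)
      monotone-dec e e′ = (e Boolₚ.≟ true) →-dec (e′ Boolₚ.≟ true)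

      -- `sSide` skips the thresholds `b` and `3b`, so it agrees with the nested tests of `choose`
      -- only because a vertex below one threshold is below the later ones.
      side≡ : ∀ i → sSide b n (toℕ i) ≡ side (part i)
      side≡ i = pt (lt k b) (lt k (2 ℕ.* b)) (lt k (3 ℕ.* b)) (lt k (4 ℕ.* b)) (lt k c₅) (mono k b≤2b) (mono k 2b≤3b) (mono k 3b≤4b)
        where
        k : ℕ
        k = toℕ i
        pt : ∀ e₁ e₂ e₃ e₄ e₅ → Monotone e₁ e₂ → Monotone e₂ e₃ → Monotone e₃ e₄ →
          (if e₂ then 0 else if e₄ then 1 else if e₅ then 0 else 1) ≡ side (choose e₁ e₂ e₃ e₄ e₅)
        pt = exhaust (all-Bool? λ e₁ → all-Bool? λ e₂ → all-Bool? λ e₃ → all-Bool? λ e₄ → all-Bool? λ e₅ →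
          monotone-dec e₁ e₂ →-dec (monotone-dec e₂ e₃ →-dec (monotone-dec e₃ e₄ →-dec (_ ℕₚ.≟ _))))

      index≡ : ∀ i → sIndex b n (toℕ i) ≡ index (part i)
      index≡ i = pt (lt k b) (lt k (2 ℕ.* b)) (lt k (3 ℕ.* b)) (lt k (4 ℕ.* b)) (lt k c₅)
        where
        k : ℕ
        k = toℕ i
        pt : ∀ e₁ e₂ e₃ e₄ e₅ →
          (if e₁ then 1 else if e₂ then 2 else if e₃ then 1 else if e₄ then 2 else 3) ≡ index (choose e₁ e₂ e₃ e₄ e₅)
        pt = exhaust (all-Bool? λ e₁ → all-Bool? λ e₂ → all-Bool? λ e₃ → all-Bool? λ e₄ → all-Bool? λ e₅ → _ ℕₚ.≟ _)

    S≡joined : ∀ i j → S b n i j ≡ joined (part i) (part j)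
    S≡joined i j = cong₂ _xor_ (cong₂ _≡ᵇ_ (side≡ i) (side≡ j)) (cong₂ _≡ᵇ_ (index≡ i) (index≡ j))

    private
      below : ℕ → Fin n → ℤ
      below c i = ⟦ lt (toℕ i) c ⟧

      -- Each part is an interval of vertices, so its indicator is the difference of the indicators
      -- of two initial segments.
      size-by : ∀ k (g h : Fin n → ℤ) {x y} → ∑ g ≡ x → ∑ h ≡ y → (∀ i → [ part i ≐ k ] ≡ 1ℤ * g i + (-1ℤ * h i + 0ℤ)) →
        size part k ≡ x - y
      size-by k g h {x} {y} eg eh pt = trans (sum-cong-≗ pt) (trans (Φ-total (∑₁ n) ((1ℤ , g) ∷ (-1ℤ , h) ∷ []))
        (trans (cong₂ (λ x y → 1ℤ * x + (-1ℤ * y + 0ℤ)) eg eh) (lem x y)))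
        where
        lem : ∀ x y → 1ℤ * x + (-1ℤ * y + 0ℤ) ≡ x - y
        lem x y = solve (x ∷ y ∷ [])

      pointwise : ∀ k (g h : (e₁ e₂ e₃ e₄ e₅ : Bool) → ℤ) →
        (∀ e₁ e₂ e₃ e₄ e₅ → Monotone e₁ e₂ → Monotone e₂ e₃ → Monotone e₃ e₄ → Monotone e₄ e₅ →
          [ choose e₁ e₂ e₃ e₄ e₅ ≐ k ] ≡ 1ℤ * g e₁ e₂ e₃ e₄ e₅ + (-1ℤ * h e₁ e₂ e₃ e₄ e₅ + 0ℤ)) →
        ∀ i → let t = toℕ i ; e₁ = lt t b ; e₂ = lt t (2 ℕ.* b) ; e₃ = lt t (3 ℕ.* b) ; e₄ = lt t (4 ℕ.* b) ; e₅ = lt t c₅ in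
          [ part i ≐ k ] ≡ 1ℤ * g e₁ e₂ e₃ e₄ e₅ + (-1ℤ * h e₁ e₂ e₃ e₄ e₅ + 0ℤ)
      pointwise k g h pt i = pt (lt t b) (lt t (2 ℕ.* b)) (lt t (3 ℕ.* b)) (lt t (4 ℕ.* b)) (lt t c₅)
        (mono t b≤2b) (mono t 2b≤3b) (mono t 3b≤4b) (mono t 4b≤c₅)
        where
        t : ℕ
        t = toℕ i

      decide : ∀ k (g h : (e₁ e₂ e₃ e₄ e₅ : Bool) → ℤ) → Dec (∀ e₁ e₂ e₃ e₄ e₅ → Monotone e₁ e₂ → Monotone e₂ e₃ → Monotone e₃ e₄ → Monotone e₄ e₅ →
          [ choose e₁ e₂ e₃ e₄ e₅ ≐ k ] ≡ 1ℤ * g e₁ e₂ e₃ e₄ e₅ + (-1ℤ * h e₁ e₂ e₃ e₄ e₅ + 0ℤ))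
      decide k g h = all-Bool? λ e₁ → all-Bool? λ e₂ → all-Bool? λ e₃ → all-Bool? λ e₄ → all-Bool? λ e₅ →
        monotone-dec e₁ e₂ →-dec (monotone-dec e₂ e₃ →-dec (monotone-dec e₃ e₄ →-dec (monotone-dec e₄ e₅ →-dec (_ ≟ _))))

      3b≤n : 3 ℕ.* b ℕ.≤ n
      3b≤n = ℕₚ.≤-trans 3b≤4b 4b≤n
      2b≤n : 2 ℕ.* b ℕ.≤ n
      2b≤n = ℕₚ.≤-trans 2b≤3b 3b≤n
      b≤n : b ℕ.≤ n
      b≤n = ℕₚ.≤-trans b≤2b 2b≤n

      zero-sum : ∑ {n} (λ _ → 0ℤ) ≡ 0ℤ
      zero-sum = trans (∑-const n 0ℤ) (ℤₚ.*-zeroʳ (+ n))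

      step : ∀ c → + (ℕ.suc c ℕ.* b) - + (c ℕ.* b) ≡ + b
      step c = trans (cong (λ z → z - + (c ℕ.* b)) (ℤₚ.pos-+ b (c ℕ.* b))) (lem (+ b) (+ (c ℕ.* b)))
        where
        lem : ∀ x y → x + y - y ≡ x
        lem x y = solve (x ∷ y ∷ [])

    size-U₁ : size part U₁ ≡ + b
    size-U₁ = trans (size-by U₁ (below b) (λ _ → 0ℤ) (count-below b b≤n) zero-sum
      (pointwise U₁ (λ e₁ _ _ _ _ → ⟦ e₁ ⟧) (λ _ _ _ _ _ → 0ℤ) (exhaust (decide U₁ (λ e₁ _ _ _ _ → ⟦ e₁ ⟧) (λ _ _ _ _ _ → 0ℤ)))))
      (ℤₚ.+-identityʳ (+ b))

    size-U₂ : size part U₂ ≡ + b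
    size-U₂ = trans (size-by U₂ (below (2 ℕ.* b)) (below b) (count-below (2 ℕ.* b) 2b≤n) (count-below b b≤n)
      (pointwise U₂ (λ _ e₂ _ _ _ → ⟦ e₂ ⟧) (λ e₁ _ _ _ _ → ⟦ e₁ ⟧) (exhaust (decide U₂ (λ _ e₂ _ _ _ → ⟦ e₂ ⟧) (λ e₁ _ _ _ _ → ⟦ e₁ ⟧)))))
      (trans (cong (λ z → + (2 ℕ.* b) - + z) (≡-sym (ℕₚ.*-identityˡ b))) (step 1))

    size-V₁ : size part V₁ ≡ + b
    size-V₁ = trans (size-by V₁ (below (3 ℕ.* b)) (below (2 ℕ.* b)) (count-below (3 ℕ.* b) 3b≤n) (count-below (2 ℕ.* b) 2b≤n)
      (pointwise V₁ (λ _ _ e₃ _ _ → ⟦ e₃ ⟧) (λ _ e₂ _ _ _ → ⟦ e₂ ⟧) (exhaust (decide V₁ (λ _ _ e₃ _ _ → ⟦ e₃ ⟧) (λ _ e₂ _ _ _ → ⟦ e₂ ⟧)))))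
      (step 2)

    size-V₂ : size part V₂ ≡ + b
    size-V₂ = trans (size-by V₂ (below (4 ℕ.* b)) (below (3 ℕ.* b)) (count-below (4 ℕ.* b) 4b≤n) (count-below (3 ℕ.* b) 3b≤n)
      (pointwise V₂ (λ _ _ _ e₄ _ → ⟦ e₄ ⟧) (λ _ _ e₃ _ _ → ⟦ e₃ ⟧) (exhaust (decide V₂ (λ _ _ _ e₄ _ → ⟦ e₄ ⟧) (λ _ _ e₃ _ _ → ⟦ e₃ ⟧)))))
      (step 3)

    size-U₃ : size part U₃ ≡ + m
    size-U₃ = trans (size-by U₃ (below c₅) (below (4 ℕ.* b)) (count-below c₅ c₅≤n) (count-below (4 ℕ.* b) 4b≤n)
      (pointwise U₃ (λ _ _ _ _ e₅ → ⟦ e₅ ⟧) (λ _ _ _ e₄ _ → ⟦ e₄ ⟧) (exhaust (decide U₃ (λ _ _ _ _ e₅ → ⟦ e₅ ⟧) (λ _ _ _ e₄ _ → ⟦ e₄ ⟧)))))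
      (trans (cong (λ z → z - + (4 ℕ.* b)) (ℤₚ.pos-+ (4 ℕ.* b) m)) (lem (+ (4 ℕ.* b)) (+ m)))
      where
      lem : ∀ x y → x + y - x ≡ y
      lem x y = solve (x ∷ y ∷ [])

    size-V₃ : size part V₃ ≡ + n - + c₅
    size-V₃ = size-by V₃ (λ _ → 1ℤ) (below c₅) (trans (∑-const n 1ℤ) (ℤₚ.*-identityʳ (+ n))) (count-below c₅ c₅≤n)
      (pointwise V₃ (λ _ _ _ _ _ → 1ℤ) (λ _ _ _ _ e₅ → ⟦ e₅ ⟧) (exhaust (decide V₃ (λ _ _ _ _ _ → 1ℤ) (λ _ _ _ _ e₅ → ⟦ e₅ ⟧))))

    size-U₃+V₃ : size part U₃ + size part V₃ ≡ + n - + 4 * + b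
    size-U₃+V₃ = trans (cong₂ _+_ size-U₃ size-V₃)
      (trans (cong (λ z → + m + (+ n - z)) (trans (ℤₚ.pos-+ (4 ℕ.* b) m) (cong (λ z → z + + m) (ℤₚ.pos-* 4 b))))
             (lem (+ m) (+ n) (+ b)))
      where
      lem : ∀ m n b → m + (n - (+ 4 * b + m)) ≡ n - + 4 * b
      lem m n b = solve (m ∷ n ∷ b ∷ [])

  -- Recognising the extremal graphs

  square-zero : ∀ z → z * z ≡ 0ℤ → z ≡ 0ℤ
  square-zero z e = [ (λ h → h) , (λ h → h) ]′ (ℤₚ.i*j≡0⇒i≡0∨j≡0 z e)

  nonzero-term : ∀ {n} (f : Fin n → ℤ) → Pos (∑ f - 1ℤ) → ∃ λ i → f i ≢ 0ℤ
  nonzero-term {n} f h with Finₚ.any? (λ i → ¬? (f i ≟ 0ℤ))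
  ... | yes found = found
  ... | no none = ⊥-elim (¬Pos { -1ℤ} (pos 0) (subst (λ z → Pos (z - 1ℤ)) vanish h))
    where
    zero-term : ∀ i → f i ≡ 0ℤ
    zero-term i with f i ≟ 0ℤ
    ... | yes e = e
    ... | no e = ⊥-elim (none (i , e))
    vanish : ∑ f ≡ 0ℤ
    vanish = trans (sum-cong-≗ zero-term) (trans (∑-const n 0ℤ) (ℤₚ.*-zeroʳ (+ n)))

  -- The equation forces `m` to be even, so the floor in `m / 2` is exact. In this way the part
  -- sizes of a tight graph meet the floors in the definition of the target.
  halve : ∀ {z m} → Pos z → + 2 * z ≡ + m → z ≡ + (m ℕ./ 2)
  halve {+ j} {m} h e = cong +_ (≡-sym (trans (cong (ℕ._/ 2) (≡-sym (trans (ℕₚ.*-comm j 2) 2j≡m))) (ℕᵈ.m*n/n≡m j 2)))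
    where
    2j≡m : 2 ℕ.* j ≡ m
    2j≡m = ℤₚ.+-injective (trans (ℤₚ.pos-* 2 j) e)

  compatible-AA : ∀ {e} → compatible A A e ≡ true → e ≡ false
  compatible-AA {false} _ = refl

  compatible-BB : ∀ {e} → compatible B B e ≡ true → e ≡ false
  compatible-BB {false} _ = refl

  module Complete {n : ℕ} (adj : Fin n → Fin n → Bool) (adj-sym : ∀ u v → adj u v ≡ adj v u) (cls : Fin n → Cls) where

    open Partition adj adj-sym cls

    complete : r ≡ 0ℤ → ∀ u v → cls u ≡ A → cls v ≡ B → adj u v ≡ true
    complete r≡0 u v = pt (cls u) (cls v) (adj u v)
      (definite (∑₂ n) (λ (v , w) → nonneg (cls v) (cls w) (adj v w)) r≡0 (u , v))
      where
      nonneg : ∀ c c′ e → Pos ((isA c * isB c′) * (1ℤ - ⟦ e ⟧))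
      nonneg = exhaust (all-Cls? λ _ → all-Cls? λ _ → all-Bool? λ _ → _ ≤? _)
      pt : ∀ c c′ e → (isA c * isB c′) * (1ℤ - ⟦ e ⟧) ≡ 0ℤ → c ≡ A → c′ ≡ B → e ≡ true
      pt c c′ true h _ _ = refl
      pt .A .B false () refl refl

  module Balanced {n : ℕ} (G : Graph n) {cls : Fin n → Cls} (bip : Bipartition (adj G) (sym G) cls) where

    open Bipartition bip
    open Partition (adj G) (sym G) cls
    open Complete (adj G) (sym G) cls
    open Colouring Boolₚ._≟_

    private
      inside : Cls → Bool
      inside A = true
      inside _ = false

      g h : Fin n → Bool
      g i = inside (cls i)
      h i = toℕ i <ᵇ n ℕ./ 2

      not-X : ∀ u → cls u ≢ X
      not-X u e = absurd (trans (≡-sym (cong isX e)) (∑-definite inX-pos x≡0 u))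
        where
        absurd : ¬ (1ℤ ≡ 0ℤ)
        absurd ()

      g-size : size g true ≡ p
      g-size = sum-cong-≗ (λ i → pt (cls i))
        where
        pt : ∀ c → [ inside c ≐ true ] ≡ isA c
        pt = exhaust (all-Cls? λ _ → _ ≟ _)

      half : size g true ≡ + (n ℕ./ 2)
      half = trans g-size (halve {p} (∑-positive inA-pos) (trans (lem p q) (trans (cong₂ (λ y z → y + (p + q + z)) (square-zero (p - q) p≡q) (≡-sym x≡0))
        (trans (ℤₚ.+-identityˡ (p + q + x)) classes-total))))
        where
        lem : ∀ p q → + 2 * p ≡ (p - q) + (p + q + 0ℤ)
        lem p q = solve (p ∷ q ∷ [])

      h-size : size h true ≡ + (n ℕ./ 2)
      h-size = trans (sum-cong-≗ (λ i → pt (h i))) (count-below (n ℕ./ 2) (ℕᵈ.m/n≤m n 2))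
        where
        pt : ∀ e → [ e ≐ true ] ≡ ⟦ e ⟧
        pt = exhaust (all-Bool? λ _ → _ ≟ _)

      complement : ∀ (f : Fin n → Bool) → size f false ≡ + n - size f true
      complement f = trans (sum-cong-≗ (λ i → pt (f i)))
        (trans (Φ-total (∑₁ n) ((1ℤ , (λ _ → 1ℤ)) ∷ (-1ℤ , (λ i → [ f i ≐ true ])) ∷ []))
        (trans (cong (λ z → 1ℤ * z + (-1ℤ * size f true + 0ℤ)) (∑-const n 1ℤ)) (lem (+ n) (size f true))))
        where
        pt : ∀ e → [ e ≐ false ] ≡ 1ℤ * 1ℤ + (-1ℤ * [ e ≐ true ] + 0ℤ)
        pt = exhaust (all-Bool? λ _ → _ ≟ _)
        lem : ∀ m s → 1ℤ * (m * 1ℤ) + (-1ℤ * s + 0ℤ) ≡ m - s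
        lem m s = solve (m ∷ s ∷ [])

      sizes : ∀ e → size g e ≡ size h e
      sizes true = trans half (≡-sym h-size)
      sizes false = trans (complement g) (trans (cong (λ z → + n - z) (sizes true)) (≡-sym (complement h)))

      adj≡xor : ∀ i j → adj G i j ≡ (g i xor g j)
      adj≡xor i j = go (cls i) (cls j) refl refl
        where
        go : ∀ c c′ → cls i ≡ c → cls j ≡ c′ → adj G i j ≡ (inside c xor inside c′)
        go X c′ e e′ = ⊥-elim (not-X i e)
        go c X e e′ = ⊥-elim (not-X j e′)
        go A A e e′ = compatible-AA (subst₂ (λ c c′ → compatible c c′ (adj G i j) ≡ true) e e′ (independent i j))
        go B B e e′ = compatible-BB (subst₂ (λ c c′ → compatible c c′ (adj G i j) ≡ true) e e′ (independent i j))
        go A B e e′ = complete r≡0 i j e e′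
        go B A e e′ = trans (sym G i j) (complete r≡0 j i e′ e)

    iso : IsoTo G (balancedBipartite n)
    iso = π , λ i j → trans (adj≡xor i j) (trans (cong₂ _xor_ (match i) (match j))
                            (≡-sym (Boolₚ.not-involutive (h (π ⟨$⟩ʳ i) xor h (π ⟨$⟩ʳ j)))))
      where
      π : Permutation′ n
      π = proj₁ (recolour g h sizes)
      match : ∀ i → g i ≡ h (π ⟨$⟩ʳ i)
      match = proj₂ (recolour g h sizes)

  module Prism {n b : ℕ} (G : Graph n) {T : ℤ} {cls : Fin n → Cls} (4b<n : 4 ℕ.* b ℕ.< n)
    (b≥1 : Pos (+ b - 1ℤ)) (k≥1 : Pos (+ n - + 4 * + b - 1ℤ)) (ext : Extremal (+ b) T (adj G) (sym G) cls) where

    open Extremal ext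
    open Partition (adj G) (sym G) cls
    open Complete (adj G) (sym G) cls
    open Colouring _≟ᴾ_

    private
      p≡2b : p ≡ + 2 * + b
      p≡2b = ℤₚ.*-cancelˡ-≡ (+ 2) p (+ 2 * + b) (trans (lem p q x)
          (trans (cong₂ (λ y z → y + z - x) (square-zero (p - q) p≡q) classes-total)
          (trans (cong (λ z → 0ℤ + + n - z) x≡k) (lem₂ (+ n) (+ b)))))
        where
        lem : ∀ p q x → + 2 * p ≡ (p - q) + (p + q + x) - x
        lem p q x = solve (p ∷ q ∷ x ∷ [])
        lem₂ : ∀ n b → 0ℤ + n - (n - + 4 * b) ≡ + 2 * (+ 2 * b)
        lem₂ n b = solve (n ∷ b ∷ [])

      q≡2b : q ≡ + 2 * + b
      q≡2b = trans (≡-sym (ℤₚ.i-j≡0⇒i≡j p q (square-zero (p - q) p≡q))) p≡2b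

      isX≢0 : ∀ c z → isX c * z ≢ 0ℤ → c ≡ X
      isX≢0 A z h = ⊥-elim (h (ℤₚ.*-zeroˡ z))
      isX≢0 B z h = ⊥-elim (h (ℤₚ.*-zeroˡ z))
      isX≢0 X z h = refl

      isA≢0 : ∀ c e → isA c * ⟦ e ⟧ ≢ 0ℤ → c ≡ A × e ≡ true
      isA≢0 A true h = refl , refl
      isA≢0 A false h = ⊥-elim (h refl)
      isA≢0 B e h = ⊥-elim (h (ℤₚ.*-zeroˡ ⟦ e ⟧))
      isA≢0 X e h = ⊥-elim (h (ℤₚ.*-zeroˡ ⟦ e ⟧))

      hub : ∃ λ u → cls u ≡ X
      hub = proj₁ found , isX≢0 (cls (proj₁ found)) 1ℤ (λ e → proj₂ found (trans (≡-sym (ℤₚ.*-identityʳ _)) e))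
        where
        found : ∃ λ u → inX u ≢ 0ℤ
        found = nonzero-term inX (subst (λ z → Pos (z - 1ℤ)) (≡-sym x≡k) k≥1)

      o : Fin n
      o = proj₁ hub

      o∈X : cls o ≡ X
      o∈X = proj₂ hub

      A-neighbour : ∀ u → cls u ≡ X → ∃ λ w → cls w ≡ A × adj G u w ≡ true
      A-neighbour u e = proj₁ found , isA≢0 (cls (proj₁ found)) (adj G u (proj₁ found)) (proj₂ found)
        where
        found : ∃ λ w → inA w * E u w ≢ 0ℤ
        found = nonzero-term (λ w → inA w * E u w) (subst (λ z → Pos (z - 1ℤ)) (≡-sym (proj₁ (tight u e))) b≥1)

      -- A vertex `w` that distinguished `u` from `v` would contribute 1 to `Z`, which vanishes.
      same-neighbours : ∀ u v w → cls u ≡ X → cls v ≡ X → cls w ≢ X → adj G u v ≡ false → adj G w u ≡ adj G w v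
      same-neighbours u v w = pt (cls u) (cls v) (cls w) (adj G u v) (adj G w u) (adj G w v)
        (definite (∑₃ n) (λ (u , v , w) → nonneg (cls u) (cls v) (cls w) (adj G u v) (adj G w u) (adj G w v)) Z≡0 (u , v , w))
        where
        weight : (k k′ k″ : Cls) (e e′ e″ : Bool) → ℤ
        weight k k′ k″ e e′ e″ = (isX k * isX k′ * isN k″) * ((1ℤ - ⟦ e ⟧) * (⟦ e′ ⟧ + ⟦ e″ ⟧ - + 2 * (⟦ e′ ⟧ * ⟦ e″ ⟧)))
        nonneg : ∀ k k′ k″ e e′ e″ → Pos (weight k k′ k″ e e′ e″)
        nonneg = exhaust (all-Cls? λ _ → all-Cls? λ _ → all-Cls? λ _ → all-Bool? λ _ → all-Bool? λ _ → all-Bool? λ _ → _ ≤? _)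
        pt : ∀ k k′ k″ e e′ e″ → weight k k′ k″ e e′ e″ ≡ 0ℤ → k ≡ X → k′ ≡ X → k″ ≢ X → e ≡ false → e′ ≡ e″
        pt .X .X k″ .false true true h refl refl _ refl = refl
        pt .X .X k″ .false false false h refl refl _ refl = refl
        pt .X .X X .false e′ e″ h refl refl k refl = ⊥-elim (k refl)
        pt .X .X A .false true false () refl refl _ refl
        pt .X .X A .false false true () refl refl _ refl
        pt .X .X B .false true false () refl refl _ refl
        pt .X .X B .false false true () refl refl _ refl

      -- A common neighbour outside X would complete a triangle counted by `s u`, which vanishes.
      no-common : ∀ u v w → cls u ≡ X → cls v ≡ X → cls w ≢ X → adj G u v ≡ true → adj G v w ≡ true → adj G u w ≡ false
      no-common u v w hu = pt (cls v) (cls w) (adj G u v) (adj G v w) (adj G u w)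
        (definite (∑₂ n) (λ (v , w) → nonneg (cls v) (cls w) (adj G u v) (adj G v w) (adj G u w)) (proj₂ (proj₂ (tight u hu))) (v , w))
        where
        weight : (k k′ : Cls) (e e′ e″ : Bool) → ℤ
        weight k k′ e e′ e″ = (isX k * isN k′) * (⟦ e ⟧ * (⟦ e′ ⟧ * ⟦ e″ ⟧))
        nonneg : ∀ k k′ e e′ e″ → Pos (weight k k′ e e′ e″)
        nonneg = exhaust (all-Cls? λ _ → all-Cls? λ _ → all-Bool? λ _ → all-Bool? λ _ → all-Bool? λ _ → _ ≤? _)
        pt : ∀ k k′ e e′ e″ → weight k k′ e e′ e″ ≡ 0ℤ → k ≡ X → k′ ≢ X → e ≡ true → e′ ≡ true → e″ ≡ false
        pt .X k′ .true .true false h refl _ refl refl = refl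
        pt .X X .true .true true h refl k refl refl = ⊥-elim (k refl)
        pt .X A .true .true true () refl _ refl refl
        pt .X B .true .true true () refl _ refl refl

      -- In a class of `2b` vertices, `u` and `o` have `b` neighbours each and, by `no-common`, none
      -- together; so these neighbourhoods are complementary. An indicator `κ` allows one proof for
      -- A and B.
      complementary : ∀ (κ : Cls → ℤ) → (∀ c → κ c ≡ 0ℤ ⊎ (κ c ≡ 1ℤ × c ≢ X)) → ∑ (λ w → κ (cls w)) ≡ + 2 * + b →
        (∀ u → cls u ≡ X → ∑ (λ w → κ (cls w) * E u w) ≡ + b) →
        ∀ u → cls u ≡ X → adj G o u ≡ true → ∀ w → κ (cls w) ≡ 1ℤ → adj G u w ≡ not (adj G o w)
      complementary κ dich total≡ deg≡ u hu e w κ≡1 =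
        pt (adj G u w) (adj G o w) (trans (≡-sym (ℤₚ.*-identityˡ _)) (trans (cong (λ z → z * (1ℤ - E u w - E o w)) (≡-sym κ≡1))
          (∑-definite nonneg sum≡0 w)))
        where
        gap : Fin n → ℤ
        gap w = κ (cls w) * (1ℤ - E u w - E o w)
        disjoint : ∀ e e′ → (e ≡ true → e′ ≡ false) → Pos (1ℤ - ⟦ e′ ⟧ - ⟦ e ⟧)
        disjoint true e′ h = subst (λ e′ → Pos (1ℤ - ⟦ e′ ⟧ - 1ℤ)) (≡-sym (h refl)) (pos 0)
        disjoint false true h = pos 0
        disjoint false false h = pos 1
        nonneg : ∀ w → Pos (gap w)
        nonneg w = [ (λ z → subst (λ k → Pos (k * (1ℤ - E u w - E o w))) (≡-sym z) (subst Pos (≡-sym (ℤₚ.*-zeroˡ (1ℤ - E u w - E o w))) (pos 0)))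
                   , (λ (z , ≢X) → subst (λ k → Pos (k * (1ℤ - E u w - E o w))) (≡-sym z)
                        (subst Pos (≡-sym (ℤₚ.*-identityˡ (1ℤ - E u w - E o w)))
                          (disjoint (adj G o w) (adj G u w) (no-common u o w hu o∈X ≢X (trans (sym G u o) e))))) ]′
                   (dich (cls w))
        sum≡0 : ∑ gap ≡ 0ℤ
        sum≡0 = trans (sum-cong-≗ (λ w → lem (κ (cls w)) (E u w) (E o w)))
          (trans (Φ-total (∑₁ n) ((1ℤ , (λ w → κ (cls w))) ∷ (-1ℤ , (λ w → κ (cls w) * E u w)) ∷ (-1ℤ , (λ w → κ (cls w) * E o w)) ∷ []))
          (trans (cong₂ (λ y z → 1ℤ * y + (-1ℤ * z + (-1ℤ * ∑ (λ w → κ (cls w) * E o w) + 0ℤ))) total≡ (deg≡ u hu))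
          (trans (cong (λ z → 1ℤ * (+ 2 * + b) + (-1ℤ * + b + (-1ℤ * z + 0ℤ))) (deg≡ o o∈X)) (lem₂ (+ b)))))
          where
          lem : ∀ k y z → k * (1ℤ - y - z) ≡ 1ℤ * k + (-1ℤ * (k * y) + (-1ℤ * (k * z) + 0ℤ))
          lem k y z = solve (k ∷ y ∷ z ∷ [])
          lem₂ : ∀ b → 1ℤ * (+ 2 * b) + (-1ℤ * b + (-1ℤ * b + 0ℤ)) ≡ 0ℤ
          lem₂ b = solve (b ∷ [])
        pt : ∀ e e′ → 1ℤ - ⟦ e ⟧ - ⟦ e′ ⟧ ≡ 0ℤ → e ≡ not e′
        pt true false h = refl
        pt false true h = refl

      twin : ∀ u w → cls u ≡ X → cls w ≢ X → adj G u w ≡ (adj G o w xor adj G o u)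
      twin u w hu hw = go (adj G o u) refl
        where
        opposite : adj G o u ≡ true → ∀ c → cls w ≡ c → adj G u w ≡ not (adj G o w)
        opposite e A k = complementary isA (λ { A → inj₂ (refl , λ ()) ; B → inj₁ refl ; X → inj₁ refl }) p≡2b
          (λ u h → proj₁ (tight u h)) u hu e w (cong isA k)
        opposite e B k = complementary isB (λ { B → inj₂ (refl , λ ()) ; A → inj₁ refl ; X → inj₁ refl }) q≡2b
          (λ u h → proj₁ (proj₂ (tight u h))) u hu e w (cong isB k)
        opposite e X k = ⊥-elim (hw k)
        go : ∀ e → adj G o u ≡ e → adj G u w ≡ (adj G o w xor e)
        go false e = trans (sym G u w) (trans (≡-sym (same-neighbours o u w o∈X hu hw e))
                           (trans (sym G w o) (≡-sym (Boolₚ.xor-identityʳ (adj G o w)))))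
        go true e = trans (opposite e (cls w) refl) (≡-sym (Boolₚ.xor-comm (adj G o w) true))

      A≢X : ∀ {c} → c ≡ A → c ≢ X
      A≢X refl ()

      -- A neighbour `w` of `o` in A is adjacent to exactly those vertices of X that `o` is not.
      -- This settles everything except adjacent `u`, `v` that are both neighbours of `o`; there a
      -- neighbour `z` of `u` in A is adjacent to `v` as well, against `no-common`.
      exceptional-pairs : ∀ u v → cls u ≡ X → cls v ≡ X → adj G u v ≡ (adj G o u xor adj G o v)
      exceptional-pairs u v hu hv = go (adj G u v) refl
        where
        w z : Fin n
        w = proj₁ (A-neighbour o o∈X)
        z = proj₁ (A-neighbour u hu)
        w≢X : cls w ≢ X
        w≢X = A≢X (proj₁ (proj₂ (A-neighbour o o∈X)))
        z≢X : cls z ≢ X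
        z≢X = A≢X (proj₁ (proj₂ (A-neighbour u hu)))
        ow : adj G o w ≡ true
        ow = proj₂ (proj₂ (A-neighbour o o∈X))
        uz : adj G u z ≡ true
        uz = proj₂ (proj₂ (A-neighbour u hu))
        at-w : ∀ u → cls u ≡ X → adj G u w ≡ not (adj G o u)
        at-w u hu = trans (twin u w hu w≢X) (cong (λ e → e xor adj G o u) ow)
        differ : ∀ e e′ f f′ g → (true ≡ f xor e) → (f′ ≡ f xor e′) → (not e′ ≡ true → not e ≡ false) → (f′ ≡ true → g ≡ false) → g ≡ true
          → true ≡ (e xor e′)
        differ false true f f′ g _ _ _ _ _ = refl
        differ true false f f′ g _ _ _ _ _ = refl
        differ false false f f′ g _ _ h _ _ with h refl
        ... | ()
        differ true true false f′ g _ refl _ h refl with h refl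
        ... | ()
        agree : ∀ e e′ → not e ≡ not e′ → false ≡ (e xor e′)
        agree true true _ = refl
        agree false false _ = refl
        go : ∀ e → adj G u v ≡ e → e ≡ (adj G o u xor adj G o v)
        go true e = differ (adj G o u) (adj G o v) (adj G o z) (adj G v z) (adj G u z)
          (trans (≡-sym uz) (twin u z hu z≢X)) (twin v z hv z≢X)
          (λ h → trans (≡-sym (at-w u hu)) (no-common u v w hu hv w≢X e (trans (at-w v hv) h)))
          (no-common u v z hu hv z≢X e) uz
        go false e = agree (adj G o u) (adj G o v) (trans (≡-sym (at-w u hu)) (trans (sym G u w)
          (trans (same-neighbours u v w hu hv w≢X e) (trans (sym G w v) (at-w v hv)))))

    -- The flag tells adjacency to `o`. Fixing `o` in `U₃` breaks the symmetry of the prism: its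
    -- neighbours in A, B and X then have to be `U₁`, `U₂` and `V₃`.
    colour : Cls → Bool → Part
    colour A true = U₁
    colour A false = V₂
    colour B true = U₂
    colour B false = V₁
    colour X true = V₃
    colour X false = U₃

    f : Fin n → Part
    f u = colour (cls u) (adj G o u)

    adj≡joined : ∀ i j → adj G i j ≡ joined (f i) (f j)
    adj≡joined i j = go (cls i) (cls j) refl refl
      where
      ei ej : Bool
      ei = adj G o i
      ej = adj G o j
      split : ∀ (g : Bool → Bool → Bool) (h : Bool → Bool → Bool) → (∀ e e′ → g e e′ ≡ h e e′) → adj G i j ≡ g ei ej → adj G i j ≡ h ei ej
      split g h eq e = trans e (eq ei ej)
      go : ∀ c c′ → cls i ≡ c → cls j ≡ c′ → adj G i j ≡ joined (colour c ei) (colour c′ ej)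
      go A A e e′ = split (λ _ _ → false) (λ y z → joined (colour A y) (colour A z))
        (exhaust (all-Bool? λ _ → all-Bool? λ _ → _ Boolₚ.≟ _))
        (compatible-AA (subst₂ (λ c c′ → compatible c c′ (adj G i j) ≡ true) e e′ (independent i j)))
      go B B e e′ = split (λ _ _ → false) (λ y z → joined (colour B y) (colour B z))
        (exhaust (all-Bool? λ _ → all-Bool? λ _ → _ Boolₚ.≟ _))
        (compatible-BB (subst₂ (λ c c′ → compatible c c′ (adj G i j) ≡ true) e e′ (independent i j)))
      go A B e e′ = split (λ _ _ → true) (λ y z → joined (colour A y) (colour B z))
        (exhaust (all-Bool? λ _ → all-Bool? λ _ → _ Boolₚ.≟ _)) (complete r≡0 i j e e′)
      go B A e e′ = split (λ _ _ → true) (λ y z → joined (colour B y) (colour A z))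
        (exhaust (all-Bool? λ _ → all-Bool? λ _ → _ Boolₚ.≟ _)) (trans (sym G i j) (complete r≡0 j i e′ e))
      go X X e e′ = split _xor_ (λ y z → joined (colour X y) (colour X z))
        (exhaust (all-Bool? λ _ → all-Bool? λ _ → _ Boolₚ.≟ _)) (exceptional-pairs i j e e′)
      go X A e e′ = split (λ y z → z xor y) (λ y z → joined (colour X y) (colour A z))
        (exhaust (all-Bool? λ _ → all-Bool? λ _ → _ Boolₚ.≟ _)) (twin i j e (λ k → A≢X e′ k))
      go X B e e′ = split (λ y z → z xor y) (λ y z → joined (colour X y) (colour B z))
        (exhaust (all-Bool? λ _ → all-Bool? λ _ → _ Boolₚ.≟ _)) (twin i j e (λ k → B≢X (trans (≡-sym e′) k)))
        where
        B≢X : B ≢ X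
        B≢X ()
      go A X e e′ = split _xor_ (λ y z → joined (colour A y) (colour X z))
        (exhaust (all-Bool? λ _ → all-Bool? λ _ → _ Boolₚ.≟ _)) (trans (sym G i j) (twin j i e′ (λ k → A≢X e k)))
      go B X e e′ = split _xor_ (λ y z → joined (colour B y) (colour X z))
        (exhaust (all-Bool? λ _ → all-Bool? λ _ → _ Boolₚ.≟ _)) (trans (sym G i j) (twin j i e′ (λ k → B≢X (trans (≡-sym e) k))))
        where
        B≢X : B ≢ X
        B≢X ()

    private
      module Target = Blow-up b n (ℕₚ.<⇒≤ 4b<n)

      adjacent-size : ∀ k (κ : Cls → ℤ) → (∀ c e → [ colour c e ≐ k ] ≡ κ c * ⟦ e ⟧) → size f k ≡ ∑ (λ w → κ (cls w) * E o w)
      adjacent-size k κ pt = sum-cong-≗ (λ w → pt (cls w) (adj G o w))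

      remaining-size : ∀ k (κ : Cls → ℤ) → (∀ c e → [ colour c e ≐ k ] ≡ 1ℤ * κ c + (-1ℤ * (κ c * ⟦ e ⟧) + 0ℤ)) →
        size f k ≡ ∑ (λ w → κ (cls w)) - ∑ (λ w → κ (cls w) * E o w)
      remaining-size k κ pt = trans (sum-cong-≗ (λ w → pt (cls w) (adj G o w)))
        (trans (Φ-total (∑₁ n) ((1ℤ , (λ w → κ (cls w))) ∷ (-1ℤ , (λ w → κ (cls w) * E o w)) ∷ []))
               (lem (∑ (λ w → κ (cls w))) (∑ (λ w → κ (cls w) * E o w))))
        where
        lem : ∀ y z → 1ℤ * y + (-1ℤ * z + 0ℤ) ≡ y - z
        lem y z = solve (y ∷ z ∷ [])

      2b-b : ∀ {y z} → y ≡ + 2 * + b → z ≡ + b → y - z ≡ + b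
      2b-b refl refl = lem (+ b)
        where
        lem : ∀ b → + 2 * b - b ≡ b
        lem b = solve (b ∷ [])

      o-tight : a o ≡ + b × c o ≡ + b × s o ≡ 0ℤ
      o-tight = tight o o∈X

      size-U₁ : size f U₁ ≡ + b
      size-U₁ = trans (adjacent-size U₁ isA (exhaust (all-Cls? λ _ → all-Bool? λ _ → _ ≟ _))) (proj₁ o-tight)
      size-U₂ : size f U₂ ≡ + b
      size-U₂ = trans (adjacent-size U₂ isB (exhaust (all-Cls? λ _ → all-Bool? λ _ → _ ≟ _))) (proj₁ (proj₂ o-tight))
      size-V₁ : size f V₁ ≡ + b
      size-V₁ = trans (remaining-size V₁ isB (exhaust (all-Cls? λ _ → all-Bool? λ _ → _ ≟ _))) (2b-b q≡2b (proj₁ (proj₂ o-tight)))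
      size-V₂ : size f V₂ ≡ + b
      size-V₂ = trans (remaining-size V₂ isA (exhaust (all-Cls? λ _ → all-Bool? λ _ → _ ≟ _))) (2b-b p≡2b (proj₁ o-tight))

      size-U₃+V₃ : size f U₃ + size f V₃ ≡ + n - + 4 * + b
      size-U₃+V₃ = trans (cong₂ _+_ (remaining-size U₃ isX (exhaust (all-Cls? λ _ → all-Bool? λ _ → _ ≟ _)))
                                    (adjacent-size V₃ isX (exhaust (all-Cls? λ _ → all-Bool? λ _ → _ ≟ _))))
                         (trans (lem x (d o)) x≡k)
        where
        lem : ∀ x d → x - d + d ≡ x
        lem x d = solve (x ∷ d ∷ [])

      w : Fin n
      w = proj₁ (A-neighbour o o∈X)

      w∈A : cls w ≡ A
      w∈A = proj₁ (proj₂ (A-neighbour o o∈X))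

      -- By `twin`, a neighbour of `o` in A sees in X exactly the non-neighbours of `o`. As `Y = 0`
      -- forces every such degree to be `x / 2`, this determines the size of `U₃`.
      degree-w : d w ≡ size f U₃
      degree-w = sum-cong-≗ (λ v → go v (cls v) refl)
        where
        go : ∀ v c → cls v ≡ c → isX c * E w v ≡ [ colour c (adj G o v) ≐ U₃ ]
        go v A e = trans (ℤₚ.*-zeroˡ (E w v)) (pt (adj G o v))
          where
          pt : ∀ e → 0ℤ ≡ [ colour A e ≐ U₃ ]
          pt = exhaust (all-Bool? λ _ → _ ≟ _)
        go v B e = trans (ℤₚ.*-zeroˡ (E w v)) (pt (adj G o v))
          where
          pt : ∀ e → 0ℤ ≡ [ colour B e ≐ U₃ ]
          pt = exhaust (all-Bool? λ _ → _ ≟ _)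
        go v X e = trans (cong (λ y → 1ℤ * ⟦ y ⟧) (trans (sym G w v) (trans (twin v w e (λ k → A≢X w∈A k))
                     (cong (λ y → y xor adj G o v) (proj₂ (proj₂ (A-neighbour o o∈X))))))) (pt (adj G o v))
          where
          pt : ∀ e → 1ℤ * ⟦ not e ⟧ ≡ [ colour X e ≐ U₃ ]
          pt = exhaust (all-Bool? λ _ → _ ≟ _)

      x≡2dw : x - + 2 * d w ≡ 0ℤ
      x≡2dw = square-zero (x - + 2 * d w) (trans (≡-sym (ℤₚ.*-identityˡ ((x - + 2 * d w) * (x - + 2 * d w))))
        (trans (cong (λ k → isN k * ((x - + 2 * d w) * (x - + 2 * d w))) (≡-sym w∈A))
          (∑-definite (λ w → _⊗_ {inN w} {(x - + 2 * d w) * (x - + 2 * d w)} (inN-pos w) (Pos-sq (x - + 2 * d w))) Y≡0 w)))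

      size-U₃ : size f U₃ ≡ + ((n ∸ 4 ℕ.* b) ℕ./ 2)
      size-U₃ = trans (≡-sym degree-w) (halve {d w} (degree-pos inX inX-pos w)
        (trans (≡-sym (ℤₚ.i-j≡0⇒i≡j x (+ 2 * d w) x≡2dw)) (trans x≡k
          (trans (cong (λ z → + n - z) (≡-sym (ℤₚ.pos-* 4 b))) (trans (ℤₚ.m-n≡m⊖n n (4 ℕ.* b)) (ℤₚ.⊖-≥ (ℕₚ.<⇒≤ 4b<n)))))))

      V₃-from : ∀ {y y′ z z′ k} → y + z ≡ k → y′ + z′ ≡ k → y ≡ y′ → z ≡ z′
      V₃-from {y} {.y} {z} {z′} e e′ refl = trans (lem y z) (trans (cong (λ k → k - y) (trans e (≡-sym e′))) (≡-sym (lem y z′)))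
        where
        lem : ∀ y z → z ≡ y + z - y
        lem y z = solve (y ∷ z ∷ [])

      sizes : ∀ k → size f k ≡ size Target.part k
      sizes U₁ = trans size-U₁ (≡-sym Target.size-U₁)
      sizes U₂ = trans size-U₂ (≡-sym Target.size-U₂)
      sizes V₁ = trans size-V₁ (≡-sym Target.size-V₁)
      sizes V₂ = trans size-V₂ (≡-sym Target.size-V₂)
      sizes U₃ = trans size-U₃ (≡-sym Target.size-U₃)
      sizes V₃ = V₃-from size-U₃+V₃ Target.size-U₃+V₃ (sizes U₃)

    iso : IsoTo G (S b n)
    iso = π , λ i j → trans (adj≡joined i j) (trans (cong₂ joined (match i) (match j)) (≡-sym (Target.S≡joined (π ⟨$⟩ʳ i) (π ⟨$⟩ʳ j))))
      where
      π : Permutation′ n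
      π = proj₁ (recolour f Target.part sizes)
      match : ∀ i → f i ≡ Target.part (π ⟨$⟩ʳ i)
      match = proj₂ (recolour f Target.part sizes)

  module S-triangles {n b : ℕ} (4b<n : 4 ℕ.* b ℕ.< n) (G : Graph n) (iso : IsoTo G (S b n)) where

    open Colouring _≟ᴾ_

    private
      module Target = Blow-up b n (ℕₚ.<⇒≤ 4b<n)

      π : Permutation′ n
      π = proj₁ iso

      f : Fin n → Part
      f i = Target.part (π ⟨$⟩ʳ i)

      size≡ : ∀ k {y} → size Target.part k ≡ y → size f k ≡ y
      size≡ k e = trans (size-permute f Target.part π (λ _ → refl) k) e

      adj≡ : ∀ i j → adj G i j ≡ joined (f i) (f j)
      adj≡ i j = trans (proj₂ iso i j) (Target.S≡joined (π ⟨$⟩ʳ i) (π ⟨$⟩ʳ j))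

    count : triangleCount G ≡ b ℕ.* b ℕ.* (n ∸ 4 ℕ.* b)
    count = ℤₚ.+-injective (ℤₚ.*-cancelˡ-≡ (+ 6) (+ triangleCount G) (+ (b ℕ.* b ℕ.* (n ∸ 4 ℕ.* b)))
      (trans (Counting.triangles-sixfold G)
      (trans (cong-Φ (∑₃ n) (λ (u , v , w) → cong₂ (λ x y → ⟦ x ⟧ * y) (adj≡ u v) (cong₂ (λ x y → ⟦ x ⟧ * ⟦ y ⟧) (adj≡ v w) (adj≡ u w))))
      (trans (prism-triangles f)
             (cong (λ z → + 6 * z) product)))))
      where
      -- Each triangle of the prism contributes `b²` times its third part, and `U₃` and `V₃`
      -- together have `n - 4b` vertices whatever the parity.
      product : size f U₁ * (size f U₂ * size f U₃) + size f V₁ * (size f V₂ * size f V₃) ≡ + (b ℕ.* b ℕ.* (n ∸ 4 ℕ.* b))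
      product = trans (lem (size≡ U₁ Target.size-U₁) (size≡ U₂ Target.size-U₂) (size≡ V₁ Target.size-V₁) (size≡ V₂ Target.size-V₂))
        (trans (cong (λ z → + b * + b * z) (trans (cong₂ _+_ (size≡ U₃ refl) (size≡ V₃ refl)) (trans Target.size-U₃+V₃ k≡)))
        (trans (cong (λ z → z * + (n ∸ 4 ℕ.* b)) (≡-sym (ℤₚ.pos-* b b))) (≡-sym (ℤₚ.pos-* (b ℕ.* b) (n ∸ 4 ℕ.* b)))))
        where
        k≡ : + n - + 4 * + b ≡ + (n ∸ 4 ℕ.* b)
        k≡ = trans (cong (λ z → + n - z) (≡-sym (ℤₚ.pos-* 4 b))) (trans (ℤₚ.m-n≡m⊖n n (4 ℕ.* b)) (ℤₚ.⊖-≥ (ℕₚ.<⇒≤ 4b<n)))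
        lem : ∀ {u₁ u₂ u₃ v₁ v₂ v₃ b} → u₁ ≡ b → u₂ ≡ b → v₁ ≡ b → v₂ ≡ b →
          u₁ * (u₂ * u₃) + v₁ * (v₂ * v₃) ≡ b * b * (u₃ + v₃)
        lem {u₃ = u₃} {v₃ = v₃} {b} refl refl refl refl = solve (b ∷ u₃ ∷ v₃ ∷ [])

-- Transfer to the natural numbers and conclusion

open import Data.Nat using (ℕ; _+_; _*_; _∸_; _≤_; _<_)
import Data.Nat as ℕ
import Data.Nat.Properties as ℕₚ
open import Data.Empty using (⊥-elim)
open import Data.Integer as ℤ using (ℤ; 1ℤ)
import Data.Integer.Properties as ℤₚ
open import Data.Integer.Tactic.RingSolver using (solve)
open import Data.List using ([]; _∷_)
open import Data.Product using (_,_; proj₁; proj₂)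
open import Data.Sum using ([_,_]′)
open import Relation.Binary.PropositionalEquality using (trans; cong; cong₂; subst) renaming (sym to ≡-sym)
open Counting-books-and-triangles

module Few-triangles {n b : ℕ} (b-large : 2495 * n ≤ 10000 * b) (4b<n : 4 * b < n) (G : Graph n)
  (e-large : n * n ≤ 4 * edgeCount G) (bookNumber≤b : bookNumber G ≤ b)
  (few : triangleCount G ≤ b * b * (n ∸ 4 * b)) where

  private
    k≡ : ℤ.+ (n ∸ 4 * b) ≡ ℤ.+ n ℤ.- ℤ.+ 4 ℤ.* ℤ.+ b
    k≡ = trans (≡-sym (ℤₚ.⊖-≥ (ℕₚ.<⇒≤ 4b<n))) (trans (≡-sym (ℤₚ.m-n≡m⊖n n (4 * b)))
           (cong (λ z → ℤ.+ n ℤ.- z) (ℤₚ.pos-* 4 b)))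

    k≥1 : Pos (ℤ.+ n ℤ.- ℤ.+ 4 ℤ.* ℤ.+ b ℤ.- 1ℤ)
    k≥1 = subst (λ z → Pos (z ℤ.- 1ℤ)) k≡ (≤⇒Pos (ℤ.+≤+ (ℕₚ.m<n⇒0<n∸m 4b<n)))

    499n≤2000b : 499 * n ≤ 2000 * b
    499n≤2000b = ℕₚ.*-cancelˡ-≤ 5 (ℕₚ.≤-trans (ℕₚ.≤-reflexive (≡-sym (ℕₚ.*-assoc 5 499 n)))
      (ℕₚ.≤-trans b-large (ℕₚ.≤-reflexive (ℕₚ.*-assoc 5 2000 b))))

    k-small : Pos (ℤ.+ 4 ℤ.* ℤ.+ b ℤ.- ℤ.+ 499 ℤ.* (ℤ.+ n ℤ.- ℤ.+ 4 ℤ.* ℤ.+ b))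
    k-small = ≤⇒Pos (ℤ.+≤+ 499n≤2000b) ∴ trans (cong₂ ℤ._-_ (ℤₚ.pos-* 2000 b) (ℤₚ.pos-* 499 n)) (lem (ℤ.+ n) (ℤ.+ b))
      where
      lem : ∀ n b → ℤ.+ 2000 ℤ.* b ℤ.- ℤ.+ 499 ℤ.* n ≡ ℤ.+ 4 ℤ.* b ℤ.- ℤ.+ 499 ℤ.* (n ℤ.- ℤ.+ 4 ℤ.* b)
      lem n b = solve (n ∷ b ∷ [])

    n≥1 : Pos (ℤ.+ n ℤ.- 1ℤ)
    n≥1 = ≤⇒Pos (ℤ.+≤+ (ℕₚ.≤-<-trans ℕ.z≤n 4b<n))

    many-edges : Pos (ℤ.+ 2 ℤ.* Neighbourhood-cuts.M (adj G) (sym G) ℤ.- ℤ.+ n ℤ.* ℤ.+ n)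
    many-edges = subst (λ z → Pos (ℤ.+ 2 ℤ.* z ℤ.- ℤ.+ n ℤ.* ℤ.+ n)) (Counting.edges-twice G)
      (≤⇒Pos (ℤ.+≤+ e-large) ∴ trans (cong₂ ℤ._-_ (ℤₚ.pos-* 4 (edgeCount G)) (ℤₚ.pos-* n n)) (lem (ℤ.+ edgeCount G) (ℤ.+ n)))
      where
      lem : ∀ e n → ℤ.+ 4 ℤ.* e ℤ.- n ℤ.* n ≡ ℤ.+ 2 ℤ.* (ℤ.+ 2 ℤ.* e) ℤ.- n ℤ.* n
      lem e n = solve (e ∷ n ∷ [])

    bound≡ : ℤ.+ (b * b * (n ∸ 4 * b)) ≡ ℤ.+ b ℤ.* ℤ.+ b ℤ.* (ℤ.+ n ℤ.- ℤ.+ 4 ℤ.* ℤ.+ b)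
    bound≡ = trans (ℤₚ.pos-* (b * b) (n ∸ 4 * b)) (cong₂ ℤ._*_ (ℤₚ.pos-* b b) k≡)

    hypotheses : Hypotheses n (ℤ.+ b) (ℤ.+ triangleCount G) (adj G)
    hypotheses = record
      { adj-sym = sym G ; k≥1 = k≥1 ; k-small = k-small ; n≥1 = n≥1 ; many-edges = many-edges
      ; six = ≡-sym (Counting.triangles-sixfold G)
      ; few-triangles = subst (λ z → Pos (z ℤ.- ℤ.+ triangleCount G)) bound≡ (≤⇒Pos (ℤ.+≤+ few))
      ; book = Counting.book G b bookNumber≤b }

  extremal : ¬ IsoTo G (balancedBipartite n) → triangleCount G ≡ b * b * (n ∸ 4 * b) × IsoTo G (S b n)
  extremal not-balanced = [ (λ bip → ⊥-elim (not-balanced (Balanced.iso G bip)))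
    , (λ ext → ℤₚ.+-injective (trans (Extremal.T≡ ext) (≡-sym bound≡))
             , Prism.iso G 4b<n (Range.b≥1 (ℤ.+ n) (ℤ.+ b) k≥1 k-small) k≥1 ext) ]′
    (Structure.outcome hypotheses)

theorem1p2 : (n b : ℕ) → 2495 * n ≤ 10000 * b → 4 * b < n →
    (G : Graph n) → n * n ≤ 4 * edgeCount G → bookNumber G ≤ b →
    ¬ IsoTo G (balancedBipartite n) →
    (b * b * (n ∸ 4 * b) ≤ triangleCount G)
    × (triangleCount G ≡ b * b * (n ∸ 4 * b) → IsoTo G (S b n))
    × (IsoTo G (S b n) → triangleCount G ≡ b * b * (n ∸ 4 * b))
theorem1p2 n b b-large 4b<n G e-large book≤b not-balanced =
  -- If the count is at most the bound, `extremal` makes it equal to the bound, which is the lower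
  -- estimate in that case.
  [ (λ T≤ → ℕₚ.≤-reflexive (≡-sym (proj₁ (extremal T≤)))) , (λ T≥ → T≥) ]′ (ℕₚ.≤-total (triangleCount G) (b * b * (n ∸ 4 * b)))
  , (λ T≡ → proj₂ (extremal (ℕₚ.≤-reflexive T≡)))
  , S-triangles.count {n} {b} 4b<n G
  where
  extremal : triangleCount G ≤ b * b * (n ∸ 4 * b) → triangleCount G ≡ b * b * (n ∸ 4 * b) × IsoTo G (S b n)
  extremal few = Few-triangles.extremal {n} {b} b-large 4b<n G e-large book≤b few not-balanced
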